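{- Let $q=2^t$ for a positive integer $t$. The rank over $\mathbb{F}_2$ of the incidence matrix $M(P_1,L_1)$ is $$1+\left(\frac{1+\sqrt{17}}{2}\right)^{2t}+\left(\frac{1-\sqrt{17}}{2}\right)^{2t}-2^{t+1}.$$
   Context: Let $q$ be a prime power and $V$ a $4$-dimensional vector space over $\mathbb{F}_q$ with a nonsingular alternating bilinear form $(\cdot,\cdot)$, and a symplectic basis $e_0,e_1,e_2,e_3$ with $(e_0,e_3)=(e_1,e_2)=1$ (and the other pairings of basis vectors zero apart from those forced by alternation). Write points of the projective space $P=P(V)$ (the set of $1$-dimensional subspaces of $V$) in homogeneous coordinates $(a:b:c:d)$ with respect to this basis. $L$ denotes the set of totally isotropic $2$-dimensional subspaces of $V$ ("lines"), with incidence given by containment; $(P,L)$ is the symplectic generalized quadrangle $W(q)$. Fix $p_0=\langle e_0\rangle$ and $\ell_0=\langle e_0,e_1\rangle$. Let $p_0^{\perp}=\{(a:b:c:0)\}$ be the set of points on lines through $p_0$, let $P_1=P\setminus p_0^{\perp}$ (the points with last coordinate nonzero), and let $L_1$ be the set of lines of $L$ having no point in common with $\ell_0$. $M(P_1,L_1)$ is the $0/1$ incidence matrix with rows indexed by $P_1$ and columns indexed by $L_1$. -}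

module Defs where

open import Level using (Level; _⊔_; suc)
open import Algebra.Bundles using (Ring; CommutativeRing; RawRing)
import Algebra.Construct.Pointwise as Pointwise
import Algebra.Definitions
import Algebra.Definitions.RawMonoid
import Algebra.Definitions.RawSemiring
open import Algebra.Module.Bundles using (LeftModule)
import Algebra.Module.Construct.TensorUnit as TensorUnit
open import Algebra.Module.Morphism.Structures using (IsLeftModuleHomomorphism)
import Algebra.Properties.Group
open import Data.Bool.Base using (Bool)
open import Data.Bool.Properties using (xor-∧-commutativeRing)
open import Data.Fin.Base as Fin using (Fin; finToFun; funToFin)
open import Data.Fin.Patterns using (0F; 1F; 2F; 3F)
import Data.Fin.Properties as Fin
open import Data.Integer.Base using (+_)
open import Data.Nat.Base as ℕ using (ℕ)
open import Data.Product.Base using (Σ; ∃; ∃-syntax; _×_; _,_; proj₁; proj₂)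
open import Data.Rational.Base as ℚ using (ℚ; 0ℚ; 1ℚ; ½)
open import Data.Vec.Functional using (Vector; []; _∷_)
open import Function.Base using (_∘_)
open import Function.Bundles using (Inverse)
open import Function.Properties.Inverse using (Inverse⇒Injection)
open import Relation.Binary.Definitions using (Decidable)
open import Relation.Binary.PropositionalEquality as ≡ using (_≡_)
open import Relation.Nullary.Decidable using (Dec; does; map′; via-injection)
open import Relation.Nullary.Negation using (¬_)
open import Relation.Unary using (Pred)

private
  variable
    c ℓ m ℓm i j s s′ : Level
    n : ℕ

module LinearAlgebra {c ℓ m ℓm} {R : Ring c ℓ} (M : LeftModule R m ℓm) where
  open Ring R using (Carrier; _≈_; 0#)
  open LeftModule M
  open Algebra.Definitions.RawMonoid +ᴹ-rawMonoid using (sum)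

  linearCombination : Vector Carrier n → Vector Carrierᴹ n → Carrierᴹ
  linearCombination x v = sum (λ k → x k *ₗ v k)

  LinearlyIndependent : Vector Carrierᴹ n → Set (c ⊔ ℓ ⊔ ℓm)
  LinearlyIndependent v = ∀ x → linearCombination x v ≈ᴹ 0ᴹ → ∀ k → x k ≈ 0#

  record Subspace s : Set (c ⊔ m ⊔ ℓm ⊔ suc s) where
    field
      member    : Pred Carrierᴹ s
      resp      : ∀ {v w} → v ≈ᴹ w → member v → member w
      0-closed  : member 0ᴹ
      +-closed  : ∀ {v w} → member v → member w → member (v +ᴹ w)
      *ₗ-closed : ∀ x {v} → member v → member (x *ₗ v)

  infix 4 _∈_ _⊆_

  _∈_ : Carrierᴹ → Subspace s → Set s
  v ∈ W = Subspace.member W v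

  _⊆_ : Subspace s → Subspace s′ → Set (m ⊔ s ⊔ s′)
  U ⊆ W = ∀ {v} → v ∈ U → v ∈ W

  data Generated {I : Set i} (f : I → Carrierᴹ) : Pred Carrierᴹ (c ⊔ m ⊔ ℓm ⊔ i) where
    generator : ∀ k → Generated f (f k)
    resp      : ∀ {v w} → v ≈ᴹ w → Generated f v → Generated f w
    zero      : Generated f 0ᴹ
    add       : ∀ {v w} → Generated f v → Generated f w → Generated f (v +ᴹ w)
    scale     : ∀ x {v} → Generated f v → Generated f (x *ₗ v)

  span : {I : Set i} → (I → Carrierᴹ) → Subspace (c ⊔ m ⊔ ℓm ⊔ i)
  span f = record
    { member    = Generated f
    ; resp      = resp
    ; 0-closed  = zero
    ; +-closed  = add
    ; *ₗ-closed = scale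
    }

  record IsBasisOf (W : Subspace s) (v : Vector Carrierᴹ n) : Set (c ⊔ ℓ ⊔ m ⊔ ℓm ⊔ s) where
    field
      contained   : ∀ k → v k ∈ W
      independent : LinearlyIndependent v
      spanning    : ∀ {w} → w ∈ W → ∃[ x ] w ≈ᴹ linearCombination x v

  HasDimension : Subspace s → ℕ → Set (c ⊔ ℓ ⊔ m ⊔ ℓm ⊔ s)
  HasDimension W n = Σ (Vector Carrierᴹ n) (IsBasisOf W)

  record IsBasis (v : Vector Carrierᴹ n) : Set (c ⊔ ℓ ⊔ m ⊔ ℓm) where
    field
      independent : LinearlyIndependent v
      spanning    : ∀ w → ∃[ x ] w ≈ᴹ linearCombination x v

  combination-congˡ : {x y : Vector Carrier n} (v : Vector Carrierᴹ n) →
                      (∀ k → x k ≈ y k) → linearCombination x v ≈ᴹ linearCombination y v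
  combination-congˡ {ℕ.zero}  v x≈y = ≈ᴹ-refl
  combination-congˡ {ℕ.suc n} v x≈y =
    +ᴹ-cong (*ₗ-cong (x≈y 0F) ≈ᴹ-refl) (combination-congˡ (v ∘ Fin.suc) (x≈y ∘ Fin.suc))

  combination-zeroˡ : {x : Vector Carrier n} (v : Vector Carrierᴹ n) →
                      (∀ k → x k ≈ 0#) → linearCombination x v ≈ᴹ 0ᴹ
  combination-zeroˡ {ℕ.zero}  v x≈0 = ≈ᴹ-refl
  combination-zeroˡ {ℕ.suc n} v x≈0 =
    ≈ᴹ-trans
      (+ᴹ-cong (≈ᴹ-trans (*ₗ-cong (x≈0 0F) ≈ᴹ-refl) (*ₗ-zeroˡ (v 0F)))
               (combination-zeroˡ (v ∘ Fin.suc) (x≈0 ∘ Fin.suc)))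
      (+ᴹ-identityˡ 0ᴹ)

  combination-closed : (W : Subspace s) (x : Vector Carrier n) (v : Vector Carrierᴹ n) →
                       (∀ k → v k ∈ W) → linearCombination x v ∈ W
  combination-closed {n = ℕ.zero}  W x v v∈W = Subspace.0-closed W
  combination-closed {n = ℕ.suc n} W x v v∈W =
    Subspace.+-closed W (Subspace.*ₗ-closed W (x 0F) (v∈W 0F))
      (combination-closed W (x ∘ Fin.suc) (v ∘ Fin.suc) (v∈W ∘ Fin.suc))

functionModule : (R : Ring c ℓ) (J : Set j) → LeftModule R (j ⊔ c) (j ⊔ ℓ)
functionModule R J = record
  { Carrierᴹ = J → Carrier
  ; _≈ᴹ_ = RowGroup._≈_
  ; _+ᴹ_ = RowGroup._∙_
  ; _*ₗ_ = λ x f y → x * f y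
  ; 0ᴹ = RowGroup.ε
  ; -ᴹ_ = RowGroup._⁻¹
  ; isLeftModule = record
    { isLeftSemimodule = record
      { +ᴹ-isCommutativeMonoid = RowGroup.isCommutativeMonoid
      ; isPreleftSemimodule = record
        { *ₗ-cong = λ x≈y f≈g k → *-cong x≈y (f≈g k)
        ; *ₗ-zeroˡ = λ f k → zeroˡ (f k)
        ; *ₗ-distribʳ = λ f x y k → distribʳ (f k) x y
        ; *ₗ-identityˡ = λ f k → *-identityˡ (f k)
        ; *ₗ-assoc = λ x y f k → *-assoc x y (f k)
        ; *ₗ-zeroʳ = λ x k → zeroʳ x
        ; *ₗ-distribˡ = λ x f g k → distribˡ x (f k) (g k)
        }
      }
    ; -ᴹ‿cong = RowGroup.⁻¹-cong
    ; -ᴹ‿inverse = RowGroup.inverse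
    }
  }
  where
  open Ring R
  module RowGroup = Algebra.Bundles.AbelianGroup (Pointwise.abelianGroup J +-abelianGroup)

-- The rank of a matrix is the dimension of its row space.  The index types
-- need not be finite or free of repetitions: repeated rows or columns do not
-- change this dimension.
HasRank : (K : Ring c ℓ) {I : Set i} {J : Set j} →
          (I → J → Ring.Carrier K) → ℕ → Set (c ⊔ ℓ ⊔ i ⊔ j)
HasRank K {J = J} A r = HasDimension (span A) r
  where open LinearAlgebra (functionModule K J)

𝔽₂ : Ring Level.zero Level.zero
𝔽₂ = CommutativeRing.ring xor-∧-commutativeRing

record FiniteField c ℓ (q : ℕ) : Set (suc (c ⊔ ℓ)) where
  field
    commutativeRing : CommutativeRing c ℓ

  open CommutativeRing commutativeRing public

  field
    1≉0         : 1# ≉ 0#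
    invertible  : ∀ x → x ≉ 0# → Algebra.Definitions.Invertible _≈_ 1# _*_ x
    enumeration : Inverse setoid (≡.setoid (Fin q))

  _≈?_ : Decidable _≈_
  _≈?_ = via-injection (Inverse⇒Injection enumeration) Fin._≟_

  any-vector? : ∀ {p} {P : Pred (Vector Carrier n) p} →
                (∀ {x y} → (∀ k → x k ≈ y k) → P x → P y) →
                (∀ x → Dec (P x)) → Dec (∃ P)
  any-vector? {P = P} P-resp P? =
    map′ (λ (k , Pk) → vector k , Pk)
         (λ (x , Px) → index x , P-resp (sym ∘ vector-index x) Px)
         (Fin.any? (P? ∘ vector))
    where
    open Inverse enumeration using (to; from; strictlyInverseʳ)

    vector : Fin (q ℕ.^ n) → Vector Carrier n
    vector k = from ∘ finToFun k

    index : Vector Carrier n → Fin (q ℕ.^ n)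
    index x = funToFin (to ∘ x)

    vector-index : ∀ (x : Vector Carrier n) k → vector (index x) k ≈ x k
    vector-index x k =
      trans (reflexive (≡.cong from (Fin.finToFun-funToFin (to ∘ x) k))) (strictlyInverseʳ (x k))

module _ {c ℓ} {q : ℕ} (F : FiniteField c ℓ q) where
  private module F = FiniteField F

  record SymplecticSpace m ℓm : Set (c ⊔ ℓ ⊔ suc (m ⊔ ℓm)) where
    field
      vectorSpace : LeftModule F.ring m ℓm

    open LeftModule vectorSpace public

    private
      IsLinear : (Carrierᴹ → F.Carrier) → Set (c ⊔ ℓ ⊔ m ⊔ ℓm)
      IsLinear = IsLeftModuleHomomorphism rawLeftModule
                   (LeftModule.rawLeftModule (TensorUnit.leftModule {R = F.ring}))

    field
      form        : Carrierᴹ → Carrierᴹ → F.Carrier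
      linearˡ     : ∀ w → IsLinear (λ v → form v w)
      linearʳ     : ∀ v → IsLinear (λ w → form v w)
      alternating : ∀ v → form v v F.≈ F.0#
      nonsingular : ∀ v → (∀ w → form v w F.≈ F.0#) → v ≈ᴹ 0ᴹ

  record SymplecticBasis {m ℓm} (S : SymplecticSpace m ℓm) : Set (c ⊔ ℓ ⊔ m ⊔ ℓm) where
    open SymplecticSpace S
    open LinearAlgebra vectorSpace using (IsBasis)
    field
      e       : Vector Carrierᴹ 4
      isBasis : IsBasis e
      e₀e₃    : form (e 0F) (e 3F) F.≈ F.1#
      e₁e₂    : form (e 1F) (e 2F) F.≈ F.1#
      e₀e₁    : form (e 0F) (e 1F) F.≈ F.0#
      e₀e₂    : form (e 0F) (e 2F) F.≈ F.0#
      e₁e₃    : form (e 1F) (e 3F) F.≈ F.0#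
      e₂e₃    : form (e 2F) (e 3F) F.≈ F.0#

module SymplecticQuadrangle
  {c ℓ m ℓm} {q : ℕ} {F : FiniteField c ℓ q} {S : SymplecticSpace F m ℓm}
  (B : SymplecticBasis F S) where

  private module F = FiniteField F
  open SymplecticSpace S
  open SymplecticBasis B
  open LinearAlgebra vectorSpace public

  IsTotallyIsotropic : Subspace s → Set (ℓ ⊔ m ⊔ s)
  IsTotallyIsotropic W = ∀ {v w} → v ∈ W → w ∈ W → form v w F.≈ F.0#

  record Point : Set (ℓ ⊔ suc (c ⊔ m ⊔ ℓm)) where
    field
      subspace  : Subspace (c ⊔ m ⊔ ℓm)
      dimension : HasDimension subspace 1

  record Line : Set (ℓ ⊔ suc (c ⊔ m ⊔ ℓm)) where
    field
      subspace  : Subspace (c ⊔ m ⊔ ℓm)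
      dimension : HasDimension subspace 2
      isotropic : IsTotallyIsotropic subspace

  infix 4 _I_ _I?_

  _I_ : Point → Line → Set (c ⊔ m ⊔ ℓm)
  p I l = Point.subspace p ⊆ Line.subspace l

  p₀ : Subspace (c ⊔ m ⊔ ℓm)
  p₀ = span (e 0F ∷ [])

  ℓ₀ : Subspace (c ⊔ m ⊔ ℓm)
  ℓ₀ = span (e 0F ∷ e 1F ∷ [])

  p₀⊥ : Pred Point (ℓ ⊔ suc (c ⊔ m ⊔ ℓm))
  p₀⊥ p = ∃[ l ] (p₀ ⊆ Line.subspace l × p I l)

  P₁ : Set (ℓ ⊔ suc (c ⊔ m ⊔ ℓm))
  P₁ = ∃[ p ] ¬ p₀⊥ p

  L₁ : Set (ℓ ⊔ suc (c ⊔ m ⊔ ℓm))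
  L₁ = ∃[ l ] (∀ p → ¬ (p I l × Point.subspace p ⊆ ℓ₀))

  0ᴹ? : ∀ v → Dec (v ≈ᴹ 0ᴹ)
  0ᴹ? v with x , v≈xe ← IsBasis.spanning isBasis v =
    map′ (λ x≈0 → ≈ᴹ-trans v≈xe (combination-zeroˡ e x≈0))
         (λ v≈0 → IsBasis.independent isBasis x (≈ᴹ-trans (≈ᴹ-sym v≈xe) v≈0))
         (Fin.all? (λ k → x k F.≈? F.0#))

  _≈ᴹ?_ : Decidable _≈ᴹ_
  v ≈ᴹ? w = map′ (x∙y⁻¹≈ε⇒x≈y v w) x≈y⇒x∙y⁻¹≈ε (0ᴹ? (v +ᴹ (-ᴹ w)))
    where open Algebra.Properties.Group +ᴹ-group

  member? : (W : Subspace s) → HasDimension W n → ∀ v → Dec (v ∈ W)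
  member? W (b , b-basis) v =
    map′ (λ (x , v≈xb) → Subspace.resp W (≈ᴹ-sym v≈xb)
                           (combination-closed W x b (IsBasisOf.contained b-basis)))
         (IsBasisOf.spanning b-basis)
         (F.any-vector?
           (λ x≈y v≈xb → ≈ᴹ-trans v≈xb (combination-congˡ b x≈y))
           (λ x → v ≈ᴹ? linearCombination x b))

  _I?_ : Decidable _I_
  p I? l with b , b-basis ← Point.dimension p =
    map′ (λ b∈l {v} v∈p → let x , v≈xb = IsBasisOf.spanning b-basis v∈p in
            Subspace.resp (Line.subspace l) (≈ᴹ-sym v≈xb)
              (combination-closed (Line.subspace l) x b b∈l))
         (λ p⊆l k → p⊆l (IsBasisOf.contained b-basis k))
         (Fin.all? (λ k → member? (Line.subspace l) (Line.dimension l) (b k)))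

  -- true is the unit of 𝔽₂, so this is the 0/1 incidence matrix over 𝔽₂.
  incidenceMatrix : P₁ → L₁ → Bool
  incidenceMatrix (p , _) (l , _) = does (p I? l)

-- rat +√17· irr is the element rat + irr √17 of the subfield ℚ(√17) of the
-- reals.  As 17 is not a square in ℚ, equality is equality of both parts.
infix 6 _+√17·_

record ℚ√17 : Set where
  constructor _+√17·_
  field
    rat : ℚ
    irr : ℚ

ℚ√17-rawRing : RawRing Level.zero Level.zero
ℚ√17-rawRing = record
  { Carrier = ℚ√17
  ; _≈_ = _≡_
  ; _+_ = λ (a +√17· b) (a′ +√17· b′) → (a ℚ.+ a′) +√17· (b ℚ.+ b′)
  ; _*_ = λ (a +√17· b) (a′ +√17· b′) →
      (a ℚ.* a′ ℚ.+ (+ 17 ℚ./ 1) ℚ.* (b ℚ.* b′)) +√17· (a ℚ.* b′ ℚ.+ b ℚ.* a′)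
  ; -_ = λ (a +√17· b) → (ℚ.- a) +√17· (ℚ.- b)
  ; 0# = 0ℚ +√17· 0ℚ
  ; 1# = 1ℚ +√17· 0ℚ
  }

module ℚ√17-Notation where
  open RawRing ℚ√17-rawRing public using (_+_; _*_; -_; 0#; 1#)
  open Algebra.Definitions.RawSemiring (RawRing.rawSemiring ℚ√17-rawRing) public using (_^_)

  infixl 6 _-_

  _-_ : ℚ√17 → ℚ√17 → ℚ√17
  x - y = x + (- y)

  fromℚ : ℚ → ℚ√17
  fromℚ a = a +√17· 0ℚ

  fromℕ : ℕ → ℚ√17
  fromℕ n = fromℚ (+ n ℚ./ 1)

  √17 : ℚ√17
  √17 = 0ℚ +√17· 1ℚ

rankFormula : ℕ → ℚ√17
rankFormula t =
  1# + (fromℚ ½ * (1# + √17)) ^ (2 ℕ.* t) + (fromℚ ½ * (1# - √17)) ^ (2 ℕ.* t)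
    - fromℕ 2 ^ (t ℕ.+ 1)
  where open ℚ√17-Notation

{-# OPTIONS --safe #-}

-- In coordinates P₁ and L₁ are copies of F³, and the point (a : b : c : 1) is on
-- the line [α, β, γ] iff b = ξ and a = η, where ξ = X + c Z, η = Y + c X and
-- X = α, Y = β, Z = γ.  Since u^(q-1) is the indicator of u ≠ 0, the rows span the
-- same functions of the line over F as the coefficients, with respect to c, of
-- the products ∏ₛ λₛ^(2^s) with λₛ ∈ {1, ξ, η, ξη}.  Here ξη = P + c N + c² Q for
-- P = X Y, N = X² + Y Z, Q = X Z, and the 7^t products of 2^s-th powers of the
-- letters 1, X, Y, Z, P, N, Q are linearly independent: as N has the monomial
-- Y Z, they are triangular in the monomials.  So the rank is that of a 0/1 matrix
-- whose rows are indexed by the λₛ and the binary digits of the power of c, and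
-- whose columns are indexed by words in the letters; an entry is decided by the
-- carries of a binary addition with end-around carry.  Its distinct non-zero rows
-- are linearly independent, as they are unitriangular against suitable pivot
-- words, and they correspond to closed paths in an automaton with two states
-- whose transition matrix (5 1; 4 4) has the eigenvalues ((1 ± √17)/2)².  Counting
-- them gives 1 + tr (5 1; 4 4)^t - 2^(t+1).
module Submission where

open import Data.Bool.Base using (Bool; true; false; T; _∧_; _∨_; _xor_; not; if_then_else_)
import Data.Bool.Properties as Bool
open import Data.Empty using (⊥; ⊥-elim)
open import Data.Fin.Base as Fin using (Fin; zero; suc; punchIn; punchOut; finToFun; funToFin)
import Data.Fin.Properties as Fin
open import Data.Maybe.Base using (Maybe; just; nothing; _>>=_)
open import Data.Nat.Base as ℕ using (ℕ; zero; suc; _≤_; _<_; z≤n; s≤s)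
import Data.Nat.Properties as ℕ
open import Data.Product.Base using (∃; ∃-syntax; _×_; _,_; proj₁; proj₂)
open import Data.Sum.Base using (_⊎_; inj₁; inj₂)
open import Defs
open import Function.Base using (_∘_)
open import Function.Bundles using (Inverse)
open import Level using (Level; _⊔_)
open import Relation.Binary.PropositionalEquality as ≡ using (_≡_; _≢_)
open import Relation.Nullary.Decidable using (Dec; yes; no; does)
open import Relation.Nullary.Negation using (¬_; contradiction)

-- Enlarging the scalars from 𝔽₂ to F makes the indicators polynomial. The rank survives this,
-- because a reduced echelon basis over 𝔽₂ keeps its identity block over F. The obstacle is that
-- exponents of c matter only modulo 2^t - 1: the carry runs around a circle, and different rows can
-- coincide or vanish. The words of a row depend on which carries can enter each place, and two
-- states record enough of this. Another row may read the same pivot word with other carries, so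
-- triangularity needs a global measure. It is a weight summed over the row, with a credit for a
-- difference of states; this reduces the comparison to finitely many single steps. The matrix (5 1;
-- 4 4) is the square of (1 1; 4 0), whose eigenvalues are (1 ± √17)/2; hence the exponent 2t. The
-- correction 1 - 2^(t+1) removes the closed paths that would give a row a second time: 2^t - 1 of
-- those at J and 2^t of those at I.

-- Rows, words and the carries of a binary addition.

module RowWords where

  import Algebra.Properties.CommutativeSemigroup
  open import Data.List.Base using (List; []; _∷_; cartesianProduct)
  open import Data.List.Membership.Propositional using (_∈_)
  open import Data.List.Membership.Propositional.Properties using (∈-cartesianProduct⁺)
  open import Data.List.Relation.Unary.Any using (here; there)
  open import Data.Nat.Base using (_+_; _*_; _≡ᵇ_; _≤ᵇ_)
  open import Data.Unit.Base using (tt)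
  open import Data.Vec.Base using (Vec; []; _∷_)
  open import Relation.Binary.PropositionalEquality using (refl; sym; trans; cong; cong₂; subst; subst₂)

  private variable n : ℕ

  ∧-true : ∀ {a b} → a ∧ b ≡ true → a ≡ true × b ≡ true
  ∧-true {true} {true} _ = refl , refl

  infixr 5 _⇒_
  _⇒_ : Bool → Bool → Bool
  a ⇒ b = not a ∨ b

  mp : ∀ {a b} → (a ⇒ b) ≡ true → a ≡ true → b ≡ true
  mp {true} p _ = p

  false≢true : false ≢ true
  false≢true ()

  record Finite (A : Set) : Set where
    field
      elements : List A
      complete : ∀ x → x ∈ elements

  open Finite {{...}} public

  all : {A : Set} → (A → Bool) → List A → Bool
  all f []       = true
  all f (x ∷ xs) = f x ∧ all f xs

  all-sound : {A : Set} (f : A → Bool) {xs : List A} → all f xs ≡ true → ∀ {x} → x ∈ xs → f x ≡ true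
  all-sound f {x ∷ xs} p (here refl) = proj₁ (∧-true p)
  all-sound f {x ∷ xs} p (there x∈)  = all-sound f (proj₂ (∧-true {f x} p)) x∈

  -- Finite case distinctions are decided by evaluation: the second argument is refl.
  sound : {A : Set} {{_ : Finite A}} (f : A → Bool) → all f elements ≡ true → ∀ x → f x ≡ true
  sound f p x = all-sound f p (complete x)

  instance
    bool-finite : Finite Bool
    bool-finite .elements = false ∷ true ∷ []
    bool-finite .complete false = here refl
    bool-finite .complete true  = there (here refl)

    ×-finite : {A B : Set} {{_ : Finite A}} {{_ : Finite B}} → Finite (A × B)
    ×-finite .elements = cartesianProduct elements elements
    ×-finite .complete (a , b) = ∈-cartesianProduct⁺ (complete a) (complete b)

  -- The factors 1, ξ = X + c Z, η = Y + c X and ξ η = P + c N + c² Q.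
  data Factor : Set where
    one ξ η ξη : Factor

  -- P = X Y, Q = X Z and N = X² + Y Z.
  data Letter : Set where
    𝟙 X Y Z P N Q : Letter

  -- In state J the carry is known to be 0; in state I it can be 0 or 1.
  data State : Set where
    J I : State

  instance
    factor-finite : Finite Factor
    factor-finite .elements = one ∷ ξ ∷ η ∷ ξη ∷ []
    factor-finite .complete one = here refl
    factor-finite .complete ξ   = there (here refl)
    factor-finite .complete η   = there (there (here refl))
    factor-finite .complete ξη  = there (there (there (here refl)))

    letter-finite : Finite Letter
    letter-finite .elements = 𝟙 ∷ X ∷ Y ∷ Z ∷ P ∷ N ∷ Q ∷ []
    letter-finite .complete 𝟙 = here refl
    letter-finite .complete X = there (here refl)
    letter-finite .complete Y = there (there (here refl))
    letter-finite .complete Z = there (there (there (here refl)))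
    letter-finite .complete P = there (there (there (there (here refl))))
    letter-finite .complete N = there (there (there (there (there (here refl)))))
    letter-finite .complete Q = there (there (there (there (there (there (here refl))))))

    state-finite : Finite State
    state-finite .elements = J ∷ I ∷ []
    state-finite .complete J = here refl
    state-finite .complete I = there (here refl)

  -- A factor together with a binary digit of the exponent of c.
  Row : Set
  Row = Factor × Bool

  pattern z0 = (one , false)
  pattern z1 = (one , true)
  pattern x0 = (ξ , false)
  pattern x1 = (ξ , true)
  pattern e0 = (η , false)
  pattern e1 = (η , true)
  pattern q0 = (ξη , false)
  pattern q1 = (ξη , true)

  data Digit : Set where
    0d 1d 2d : Digit

  -- The power of `c` with which a letter occurs in a factor; `nothing` if it does not occur.
  exponent : Factor → Letter → Maybe Digit
  exponent one 𝟙 = just 0d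
  exponent ξ   X = just 0d
  exponent ξ   Z = just 1d
  exponent η   Y = just 0d
  exponent η   X = just 1d
  exponent ξη  P = just 0d
  exponent ξη  N = just 1d
  exponent ξη  Q = just 2d
  exponent _   _ = nothing

  -- Digit plus incoming carry, split into a binary digit and the outgoing carry.
  addDigit : Digit → Bool → Bool × Bool
  addDigit 0d h     = h , false
  addDigit 1d false = true , false
  addDigit 1d true  = false , true
  addDigit 2d h     = h , true

  eqB : Bool → Bool → Bool
  eqB false b = not b
  eqB true  b = b

  eqB-sound : ∀ {a b} → eqB a b ≡ true → a ≡ b
  eqB-sound {false} {false} _ = refl
  eqB-sound {true}  {true}  _ = refl

  eqB-refl : ∀ a → eqB a a ≡ true
  eqB-refl false = refl
  eqB-refl true  = refl

  emit : Bool → Bool × Bool → Maybe Bool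
  emit κ (κ′ , h) = if eqB κ κ′ then just h else nothing

  step : Row → Letter → Bool → Maybe Bool
  step (τ , κ) w h = exponent τ w >>= λ k → emit κ (addDigit k h)

  run : Vec Row n → Vec Letter n → Bool → Maybe Bool
  run []       []       h = just h
  run (x ∷ xs) (w ∷ ws) h = step x w h >>= run xs ws

  infix 4 _is_
  _is_ : Maybe Bool → Bool → Bool
  just a  is b = eqB a b
  nothing is b = false

  is-sound : ∀ {m b} → (m is b) ≡ true → m ≡ just b
  is-sound {just a} p = cong just (eqB-sound p)

  hasκ : Vec Row n → Bool
  hasκ []             = false
  hasκ ((_ , κ) ∷ xs) = κ ∨ hasκ xs

  -- Whether the word w occurs in the coefficient of c^κ in the product of the
  -- factors: addition modulo 2^t - 1 is addition with end-around carry, where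
  -- exponent 2^t - 1 is represented by the digits 1…1 and not by 0…0.
  occurs : Vec Row n → Vec Letter n → Bool
  occurs x w = (run x w false is false) ∨ ((run x w true is true) ∧ hasκ x)

  -- ξ0 and η0 pass the carry on unchanged. ξη1 keeps a carry 0 but can turn 1 into either value.
  -- ξη0 can create a carry by the letter `Q`. The remaining rows always leave carry 0.
  next : State → Row → State
  next s x0 = s
  next s e0 = s
  next s q1 = s
  next s q0 = I
  next s _  = J

  allowed : State → Row → Bool
  allowed J x0 = false
  allowed J z1 = false
  allowed _ _  = true

  eqS : State → State → Bool
  eqS J J = true
  eqS I I = true
  eqS _ _ = false

  eqS-sound : ∀ {a b} → eqS a b ≡ true → a ≡ b
  eqS-sound {J} {J} _ = refl
  eqS-sound {I} {I} _ = refl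

  isJ : State → Bool
  isJ J = true
  isJ I = false

  path : State → State → Vec Row n → Bool
  path s s′ []       = eqS s s′
  path s s′ (x ∷ xs) = allowed s x ∧ path (next s x) s′ xs

  allV : {A : Set} → (A → Bool) → Vec A n → Bool
  allV p []       = true
  allV p (x ∷ xs) = p x ∧ allV p xs

  isE0 isE0Q1 isX0E0 notQ0 : Row → Bool
  isE0 e0 = true
  isE0 _  = false
  isE0Q1 e0 = true
  isE0Q1 q1 = true
  isE0Q1 _  = false
  isX0E0 x0 = true
  isX0E0 e0 = true
  isX0E0 _  = false
  notQ0 q0 = false
  notQ0 _  = true

  -- A word in η0 and ξη1 is a closed path from both states.  It is counted from I,
  -- except for η0…η0, which is counted from J.  The other words in ξ0 and η0
  -- give the same rows as words with η1 for ξ0 from J.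
  basic : State → Vec Row n → Bool
  basic J x = path J J x ∧ (not (allV isE0Q1 x) ∨ allV isE0 x)
  basic I x = path I I x ∧ not (allV isX0E0 x)

  carryOK : State → Bool → Bool
  carryOK s h = isJ s ⇒ not h

  just-inj : {A : Set} {a b : A} → just a ≡ just b → a ≡ b
  just-inj refl = refl

  step-carry : ∀ s x w h → carryOK s h ≡ true → ∀ {h′} → step x w h ≡ just h′ →
               carryOK (next s x) h′ ≡ true
  step-carry s x w h ok {h′} p = mp (mp (sound check refl (s , x , w , h , h′)) ok)
      (subst (λ m → (m is h′) ≡ true) (sym p) (eqB-refl h′))
    where
    check : State × Row × Letter × Bool × Bool → Bool
    check (s , x , w , h , h′) =
      carryOK s h ⇒ (step x w h is h′) ⇒ carryOK (next s x) h′

  run-step : ∀ {x} {xs : Vec Row n} {w ws h h″} → run (x ∷ xs) (w ∷ ws) h ≡ just h″ →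
             ∃[ h′ ] step x w h ≡ just h′ × run xs ws h′ ≡ just h″
  run-step {x = x} {w = w} {h = h} p with step x w h
  ... | just h′ = h′ , refl , p

  end : State → Vec Row n → State
  end s []       = s
  end s (x ∷ xs) = end (next s x) xs

  run-carry : ∀ s (x : Vec Row n) w h → carryOK s h ≡ true → ∀ {h′} → run x w h ≡ just h′ →
              carryOK (end s x) h′ ≡ true
  run-carry s []       []       h ok refl = ok
  run-carry s (x ∷ xs) (w ∷ ws) h ok p with run-step {x = x} {xs} {w} {ws} p
  ... | h₁ , p₁ , p₂ = run-carry (next s x) xs ws h₁ (step-carry s x w h ok p₁) p₂

  path-end : ∀ s s′ (x : Vec Row n) → path s s′ x ≡ true → end s x ≡ s′
  path-end s s′ []       p = eqS-sound p
  path-end s s′ (x ∷ xs) p = path-end (next s x) s′ xs (proj₂ (∧-true {allowed s x} p))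

  carryOK-J : ∀ {h} → carryOK J h ≡ true → h ≡ false
  carryOK-J {false} _ = refl

  -- After a letter other than η0 and ξη1 a path from J to J forgets the initial carry.
  run-forget : ∀ (x : Vec Row n) w h {h′} → path J J x ≡ true → allV isE0Q1 x ≡ false →
               run x w h ≡ just h′ → h′ ≡ false
  run-forget [] [] h _ () _
  run-forget (x ∷ xs) (w ∷ ws) h {h′} p q r with run-step {x = x} {xs} {w} {ws} r
  ... | h₁ , r₁ , r₂ = go x p q r₁
    where
    go : ∀ x → path J J (x ∷ xs) ≡ true → (isE0Q1 x ∧ allV isE0Q1 xs) ≡ false →
         step x w h ≡ just h₁ → h′ ≡ false
    later : ∀ s → path s J xs ≡ true → carryOK s h₁ ≡ true → h′ ≡ false
    later s p ok = carryOK-J (subst (λ e → carryOK e h′ ≡ true) (path-end s J xs p)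
                               (run-carry s xs ws h₁ ok r₂))
    go e0 p q _ = run-forget xs ws h₁ p q r₂
    go q1 p q _ = run-forget xs ws h₁ p q r₂
    go z0 p q r = later J p (step-carry I z0 w h refl r)
    go x1 p q r = later J p (step-carry I x1 w h refl r)
    go e1 p q r = later J p (step-carry I e1 w h refl r)
    go q0 p q r = later I p refl

  -- Every row vanishes or equals a basic row.

  -- With carry 0, the factor ξ with digit 0 and the factor η with digit 1 both
  -- only admit the letter X, and the factor one with digit 1 admits nothing.
  canonRow : State → Row → Row
  canonRow J x0 = e1
  canonRow s x  = x

  canon : State → Vec Row n → Vec Row n
  canon s []       = []
  canon s (x ∷ xs) = canonRow s x ∷ canon (next s x) xs

  live : State → Vec Row n → Bool
  live s []       = true
  live s (x ∷ xs) = allowed s (canonRow s x) ∧ live (next s x) xs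

  next-canonRow : ∀ s x → next s (canonRow s x) ≡ next s x
  next-canonRow s x = eqS-sound (sound (λ (s , x) → eqS (next s (canonRow s x)) (next s x)) refl (s , x))

  canon-path : ∀ s (x : Vec Row n) → live s x ≡ true → path s (end s x) (canon s x) ≡ true
  canon-path J []       _ = refl
  canon-path I []       _ = refl
  canon-path s (x ∷ xs) p with ∧-true {allowed s (canonRow s x)} p
  ... | p₁ , p₂ rewrite p₁ | next-canonRow s x = canon-path (next s x) xs p₂

  eqM : Maybe Bool → Maybe Bool → Bool
  eqM (just a) (just b) = eqB a b
  eqM nothing  nothing  = true
  eqM _        _        = false

  eqM-sound : ∀ {a b} → eqM a b ≡ true → a ≡ b
  eqM-sound {just a}  {just b}  p = cong just (eqB-sound p)
  eqM-sound {nothing} {nothing} _ = refl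

  step-canon : ∀ s x w h → carryOK s h ≡ true → step x w h ≡ step (canonRow s x) w h
  step-canon s x w h ok = eqM-sound (mp (sound check refl (s , x , w , h)) ok)
    where
    check : State × Row × Letter × Bool → Bool
    check (s , x , w , h) =
      carryOK s h ⇒ eqM (step x w h) (step (canonRow s x) w h)

  run-canon : ∀ s (x : Vec Row n) w h → carryOK s h ≡ true → run x w h ≡ run (canon s x) w h
  run-canon s []       []       h ok = refl
  run-canon s (x ∷ xs) (w ∷ ws) h ok rewrite sym (step-canon s x w h ok)
    with step x w h in eq
  ... | nothing = refl
  ... | just h₁ = run-canon (next s x) xs ws h₁ (step-carry s x w h ok eq)

  step-dead : ∀ s x w h → carryOK s h ≡ true → allowed s (canonRow s x) ≡ false → step x w h ≡ nothing
  step-dead s x w h ok dead = eqM-sound (mp (mp (sound check refl (s , x , w , h)) ok)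
                                (cong not dead))
    where
    check : State × Row × Letter × Bool → Bool
    check (s , x , w , h) =
      carryOK s h ⇒ not (allowed s (canonRow s x)) ⇒ eqM (step x w h) nothing

  run-dead : ∀ s (x : Vec Row n) w h → carryOK s h ≡ true → live s x ≡ false → run x w h ≡ nothing
  run-dead s (x ∷ xs) (w ∷ ws) h ok dead with allowed s (canonRow s x) in eq
  ... | false rewrite step-dead s x w h ok eq = refl
  ... | true  with step x w h in eq₁
  ...   | nothing = refl
  ...   | just h₁ = run-dead (next s x) xs ws h₁ (step-carry s x w h ok eq₁) dead

  hasκ-canon : ∀ s (x : Vec Row n) → hasκ x ≡ true → hasκ (canon s x) ≡ true
  hasκ-canon s (x ∷ xs) p with proj₂ x in eq | proj₂ (canonRow s x) in eq₁
  ... | _     | true  = refl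
  ... | true  | false = contradiction (trans (sym eq₁) (κ-mono s x eq)) false≢true
    where
    κ-mono : ∀ s x → proj₂ x ≡ true → proj₂ (canonRow s x) ≡ true
    κ-mono s x = mp (sound (λ (s , x) → proj₂ x ⇒ proj₂ (canonRow s x)) refl (s , x))
  ... | false | false = hasκ-canon (next s x) xs p

  -- Without exponent digits the carry 1 persists, which keeps the path out of J.
  canon-id : ∀ (x : Vec Row n) w {h} → hasκ x ≡ false → run x w true ≡ just h → canon I x ≡ x
  canon-id []       []       _ _ = refl
  canon-id (z0 ∷ xs) (𝟙 ∷ ws) p ()
  canon-id (x0 ∷ xs) (Z ∷ ws) p r = cong (x0 ∷_) (canon-id xs ws p r)
  canon-id (e0 ∷ xs) (X ∷ ws) p r = cong (e0 ∷_) (canon-id xs ws p r)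
  canon-id (q0 ∷ xs) (N ∷ ws) p r = cong (q0 ∷_) (canon-id xs ws p r)
  canon-id (q0 ∷ xs) (P ∷ ws) p ()
  canon-id (q0 ∷ xs) (Q ∷ ws) p ()

  allV-⇒ : ∀ {A : Set} {p q : A → Bool} → (∀ a → p a ≡ true → q a ≡ true) →
           ∀ (x : Vec A n) → allV p x ≡ true → allV q x ≡ true
  allV-⇒ f [] _ = refl
  allV-⇒ {p = p} {q} f (x ∷ xs) h with ∧-true {p x} h
  ... | h₁ , h₂ rewrite f x h₁ = allV-⇒ f xs h₂

  allV-canon : ∀ (p : Row → Bool) → (∀ s x → p (canonRow s x) ≡ true → p x ≡ true) →
               ∀ s (x : Vec Row n) → allV p (canon s x) ≡ true → allV p x ≡ true
  allV-canon p f s [] _ = refl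
  allV-canon p f s (x ∷ xs) h with ∧-true {p (canonRow s x)} h
  ... | h₁ , h₂ rewrite f s x h₁ = allV-canon p f (next s x) xs h₂

  contra : ∀ {a b} → (a ≡ true → b ≡ true) → b ≡ false → a ≡ false
  contra {false} f _ = refl
  contra {true} {true} f ()
  contra {true} {false} f _ = sym (f refl)

  -- No row swaps the two states, so the path from `J` is at `J` whenever the path from `I` is.
  end-J : ∀ (x : Vec Row n) → end I x ≡ J → end J x ≡ J
  end-J [] ()
  end-J (x ∷ xs) p with next I x in a | next J x in b
  end-J (x ∷ xs) p | I | J = end-J xs p
  end-J (x ∷ xs) p | J | J = p
  end-J (x ∷ xs) p | I | I = p
  end-J (z1 ∷ xs) p | J | I = contradiction b λ ()
  end-J (x1 ∷ xs) p | J | I = contradiction b λ ()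
  end-J (z0 ∷ xs) p | J | I = contradiction b λ ()
  end-J (e1 ∷ xs) p | J | I = contradiction b λ ()

  end-pure : ∀ s (x : Vec Row n) → allV isE0Q1 x ≡ true → end s x ≡ s
  end-pure s [] _ = refl
  end-pure s (e0 ∷ xs) p = end-pure s xs p
  end-pure s (q1 ∷ xs) p = end-pure s xs p

  end-X0E0 : ∀ s (x : Vec Row n) → allV isX0E0 x ≡ true → end s x ≡ s
  end-X0E0 s [] _ = refl
  end-X0E0 s (e0 ∷ xs) p = end-X0E0 s xs p
  end-X0E0 s (x0 ∷ xs) p = end-X0E0 s xs p

  hasκ-X0E0 : ∀ (x : Vec Row n) → allV isX0E0 x ≡ true → hasκ x ≡ false
  hasκ-X0E0 [] _ = refl
  hasκ-X0E0 (e0 ∷ xs) p = hasκ-X0E0 xs p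
  hasκ-X0E0 (x0 ∷ xs) p = hasκ-X0E0 xs p

  hasκ-E0 : ∀ (x : Vec Row n) → allV isE0 x ≡ true → hasκ x ≡ false
  hasκ-E0 [] _ = refl
  hasκ-E0 (e0 ∷ xs) p = hasκ-E0 xs p

  -- In `J` every ξ0 becomes η1, which is neither η0 nor ξη1, so the result is pure only if it is
  -- η0...η0.
  canon-X0E0 : ∀ (x : Vec Row n) → allV isX0E0 x ≡ true →
    live J x ≡ true × (allV isE0Q1 (canon J x) ≡ true → allV isE0 (canon J x) ≡ true)
  canon-X0E0 [] _ = refl , λ _ → refl
  canon-X0E0 (x0 ∷ xs) p = proj₁ (canon-X0E0 xs p) , λ ()
  canon-X0E0 (e0 ∷ xs) p = canon-X0E0 xs p

  imp : ∀ {a b} → (a ≡ true → b ≡ true) → (a ⇒ b) ≡ true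
  imp {true}  f = f refl
  imp {false} f = refl

  is-false : ∀ {m b c} → (∀ {h} → m ≡ just h → h ≡ b) → b ≢ c → (m is c) ≡ false
  is-false {nothing} f _ = refl
  is-false {just a} {b} {c} f b≢c with f refl
  is-false {just false} {.false} {false} f b≢c | refl = contradiction refl b≢c
  is-false {just false} {.false} {true}  f b≢c | refl = refl
  is-false {just true}  {.true}  {false} f b≢c | refl = refl
  is-false {just true}  {.true}  {true}  f b≢c | refl = contradiction refl b≢c

  true-or-false : ∀ b → b ≡ true ⊎ b ≡ false
  true-or-false true  = inj₁ refl
  true-or-false false = inj₂ refl

  Canonical : Vec Row n → Set
  Canonical x = (∀ w → occurs x w ≡ false) ⊎
                ∃[ s ] ∃[ y ] basic s y ≡ true × (∀ w → occurs x w ≡ occurs y w)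

  canonical : ∀ (x : Vec Row n) → Canonical x
  canonical x with end I x in eqI | true-or-false (allV isX0E0 x) | true-or-false (live I x) | true-or-false (live J x)
  canonical x | I | inj₂ q | inj₂ d | _ = inj₁ λ w →
    cong₂ _∨_ (cong (_is false) (run-dead I x w false refl d))
      (cong (λ m → (m is true) ∧ hasκ x) (run-dead I x w true refl d))
  canonical x | I | inj₂ q | inj₁ l | _ = inj₂ (I , canon I x ,
      cong₂ _∧_ (subst (λ s → path I s (canon I x) ≡ true) eqI (canon-path I x l))
        (cong not (contra (allV-canon isX0E0 keep I x) q)) ,
      same)
    where
    keep : ∀ s x → isX0E0 (canonRow s x) ≡ true → isX0E0 x ≡ true
    keep s x = mp (sound (λ (s , x) → isX0E0 (canonRow s x) ⇒ isX0E0 x) refl (s , x))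
    same : ∀ w → occurs x w ≡ occurs (canon I x) w
    same w with hasκ x in eqκ
    ... | true rewrite hasκ-canon I x eqκ | run-canon I x w false refl | run-canon I x w true refl = refl
    -- `canon` can create a digit 1 by turning ξ0 into η1, which would admit runs from carry 1. If
    -- such a run exists for an `x` without digits 1, then `canon` does not change `x`.
    ... | false with run x w true in eqr
    ...   | nothing rewrite run-canon I x w false refl | trans (sym (run-canon I x w true refl)) eqr = refl
    ...   | just h rewrite canon-id x w eqκ eqr | eqr | eqκ = refl
  canonical x | _ | inj₁ q | _ | _ with canon-X0E0 x q
  ... | l , f = inj₂ (J , canon J x , cong₂ _∧_ (subst (λ s → path J s (canon J x) ≡ true) (end-X0E0 J x q) (canon-path J x l)) good , same)
    where
    good : (not (allV isE0Q1 (canon J x)) ∨ allV isE0 (canon J x)) ≡ true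
    good = imp f
    closed : path J J (canon J x) ≡ true
    closed = subst (λ s → path J s (canon J x) ≡ true) (end-X0E0 J x q) (canon-path J x l)
    second : ∀ w → ((run (canon J x) w true is true) ∧ hasκ (canon J x)) ≡ false
    second w with true-or-false (allV isE0Q1 (canon J x))
    ... | inj₂ p rewrite is-false {run (canon J x) w true} {false} {true} (run-forget (canon J x) w true closed p) (λ ()) = refl
    ... | inj₁ p rewrite hasκ-E0 (canon J x) (f p) = Bool.∧-zeroʳ _
    same : ∀ w → occurs x w ≡ occurs (canon J x) w
    same w rewrite second w | hasκ-X0E0 x q | run-canon J x w false refl with run x w true is true
    ... | true  = refl
    ... | false = refl
  canonical x | J | inj₂ q | _ | inj₂ d = inj₁ λ w →
    cong₂ _∨_ (cong (_is false) (run-dead J x w false refl d))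
      (cong (_∧ hasκ x) (is-false {run x w true} {false} {true}
        (λ r → carryOK-J (subst (λ e → carryOK e _ ≡ true) eqI (run-carry I x w true refl r))) λ ()))
  canonical x | J | inj₂ q | _ | inj₁ l = inj₂ (J , canon J x , cong₂ _∧_ closed good , same)
    where
    closed : path J J (canon J x) ≡ true
    closed = subst (λ s → path J s (canon J x) ≡ true) (end-J x eqI) (canon-path J x l)
    keep : ∀ s x → isE0Q1 (canonRow s x) ≡ true → isE0Q1 x ≡ true
    keep s x = mp (sound (λ (s , x) → isE0Q1 (canonRow s x) ⇒ isE0Q1 x) refl (s , x))
    impure : allV isE0Q1 (canon J x) ≡ false
    impure with true-or-false (allV isE0Q1 (canon J x))
    ... | inj₂ p = p
    ... | inj₁ p = contradiction (trans (sym eqI) (end-pure I x (allV-canon isE0Q1 keep J x p))) λ ()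
    good : (not (allV isE0Q1 (canon J x)) ∨ allV isE0 (canon J x)) ≡ true
    good rewrite impure = refl
    same : ∀ w → occurs x w ≡ occurs (canon J x) w
    same w rewrite is-false {run (canon J x) w true} {false} {true} (run-forget (canon J x) w true closed impure) (λ ())
      | is-false {run x w true} {false} {true}
          (λ r → carryOK-J (subst (λ e → carryOK e _ ≡ true) eqI (run-carry I x w true refl r))) (λ ())
      | run-canon J x w false refl = refl

  -- Pivot words.  The Boolean is the carry that the next letter of the row
  -- which fixes the carry asks for.

  back : State → Row → Bool → Bool
  back J _  _ = false
  back I x0 b = b
  back I e0 b = b
  back I z1 b = true
  back I e1 b = true
  back I q1 b = true
  back I _  b = false

  pivotLetter : State → Row → Bool → Letter
  pivotLetter s (one , _)     b = 𝟙
  pivotLetter s x0 false = X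
  pivotLetter s x0 true  = Z
  pivotLetter s e0 false = Y
  pivotLetter s e0 true  = X
  pivotLetter s x1 b = Z
  pivotLetter J e1 b = X
  pivotLetter I e1 b = Y
  pivotLetter J q1 b = N
  pivotLetter s (ξη , _) false = P
  pivotLetter s (ξη , _) true  = Q

  backs : State → Vec Row n → Bool → Bool
  backs s []       b = b
  backs s (x ∷ xs) b = back s x (backs (next s x) xs b)

  pivotFrom : State → Vec Row n → Bool → Vec Letter n
  pivotFrom s []       b = []
  pivotFrom s (x ∷ xs) b = pivotLetter s x (backs (next s x) xs b) ∷ pivotFrom (next s x) xs b

  -- Only runs that return to their initial carry count. One pass backwards yields a
  -- self-reproducing carry, as `backs-idem` shows; passing in `false` selects carry 0 where no row
  -- fixes the carry.
  pivot : State → Vec Row n → Vec Letter n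
  pivot s x = pivotFrom s x (backs s x false)

  back-const : ∀ s x → (∀ b → back s x b ≡ b) ⊎ ∃[ c ] (∀ b → back s x b ≡ c)
  back-const J _  = inj₂ (false , λ _ → refl)
  back-const I x0 = inj₁ λ _ → refl
  back-const I e0 = inj₁ λ _ → refl
  back-const I z0 = inj₂ (false , λ _ → refl)
  back-const I z1 = inj₂ (true  , λ _ → refl)
  back-const I x1 = inj₂ (false , λ _ → refl)
  back-const I e1 = inj₂ (true  , λ _ → refl)
  back-const I q0 = inj₂ (false , λ _ → refl)
  back-const I q1 = inj₂ (true  , λ _ → refl)

  -- Each row forwards the requested carry or replaces it by a constant, and a composite of such
  -- maps is again of this kind. In particular it is idempotent.
  backs-const : ∀ s (x : Vec Row n) → (∀ b → backs s x b ≡ b) ⊎ ∃[ c ] (∀ b → backs s x b ≡ c)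
  backs-const s [] = inj₁ λ _ → refl
  backs-const s (x ∷ xs) with back-const s x | backs-const (next s x) xs
  ... | inj₂ (c , f) | _            = inj₂ (c , λ b → f _)
  ... | inj₁ f       | inj₁ g       = inj₁ λ b → trans (f _) (g b)
  ... | inj₁ f       | inj₂ (c , g) = inj₂ (c , λ b → trans (f _) (g b))

  backs-idem : ∀ s (x : Vec Row n) b → backs s x (backs s x b) ≡ backs s x b
  backs-idem s x b with backs-const s x
  ... | inj₁ f       = f _
  ... | inj₂ (c , f) = trans (f _) (sym (f b))

  back-carry : ∀ s x b → carryOK s (back s x b) ≡ true
  back-carry s x b = sound check refl (s , x , b)
    where
    check : State × Row × Bool → Bool
    check (s , x , b) = carryOK s (back s x b)

  backs-carry : ∀ s s′ (x : Vec Row n) b → path s s′ x ≡ true → carryOK s′ b ≡ true →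
                carryOK s (backs s x b) ≡ true
  backs-carry s s′ []       b p ok rewrite eqS-sound {s} {s′} p = ok
  backs-carry s s′ (x ∷ xs) b p ok = back-carry s x _

  step-pivot : ∀ s x b → allowed s x ≡ true → carryOK (next s x) b ≡ true →
               step x (pivotLetter s x b) (back s x b) ≡ just b
  step-pivot s x b a ok = is-sound (mp (mp (sound check refl (s , x , b)) a) ok)
    where
    check : State × Row × Bool → Bool
    check (s , x , b) = allowed s x ⇒ carryOK (next s x) b ⇒
      (step x (pivotLetter s x b) (back s x b) is b)

  run-pivot : ∀ s s′ (x : Vec Row n) b → path s s′ x ≡ true → carryOK s′ b ≡ true →
              run x (pivotFrom s x b) (backs s x b) ≡ just b
  run-pivot s s′ []       b p ok = refl
  run-pivot s s′ (x ∷ xs) b p ok with ∧-true {allowed s x} p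
  ... | p₁ , p₂ rewrite step-pivot s x (backs (next s x) xs b) p₁ (backs-carry (next s x) s′ xs b p₂ ok)
    = run-pivot (next s x) s′ xs b p₂ ok

  -- Runs from carry 1 count only if some exponent digit is 1, so without such a digit the pivot
  -- word has to close with carry 0.
  hasκ-backs : ∀ s (x : Vec Row n) → hasκ x ≡ false → backs s x false ≡ false
  hasκ-backs J [] _ = refl
  hasκ-backs I [] _ = refl
  hasκ-backs s ((τ , false) ∷ xs) p rewrite hasκ-backs (next s (τ , false)) xs p =
    eqB-sound (sound (λ (s , τ) → eqB (back s (τ , false) false) false) refl (s , τ))

  module Closed {s} {x : Vec Row n} (p : path s s x ≡ true) where

    start : Bool
    start = backs s x false

    start-carry : carryOK s start ≡ true
    start-carry = backs-carry s s x false p (carry-false s)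
      where
      carry-false : ∀ s → carryOK s false ≡ true
      carry-false J = refl
      carry-false I = refl

    closed : run x (pivot s x) start ≡ just start
    closed = subst (λ b → run x (pivot s x) b ≡ just start) (backs-idem s x false)
               (run-pivot s s x start p start-carry)

    occurs-pivot : occurs x (pivot s x) ≡ true
    occurs-pivot with true-or-false start
    ... | inj₂ q rewrite subst (λ b → run x (pivot s x) b ≡ just b) q closed = refl
    ... | inj₁ q with true-or-false (hasκ x)
    ...   | inj₂ r = contradiction (trans (sym (hasκ-backs s x r)) q) λ ()
    ...   | inj₁ r rewrite r | subst (λ b → run x (pivot s x) b ≡ just b) q closed = Bool.∨-zeroʳ _

  basic-path : ∀ s (x : Vec Row n) → basic s x ≡ true → path s s x ≡ true
  basic-path J x p = proj₁ (∧-true p)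
  basic-path I x p = proj₁ (∧-true p)

  -- Only state `J` with carry 1 needs an argument. A row not pure in η0 and ξη1 ends with carry 0
  -- from any start; the only pure basic row at `J` is η0...η0, which has no exponent digit 1.
  occurs-run : ∀ s (x : Vec Row n) w → basic s x ≡ true → occurs x w ≡ true →
               ∃[ h ] run x w h ≡ just h × carryOK s h ≡ true
  occurs-run s x w p o with true-or-false (run x w false is false)
  occurs-run J x w p o | inj₁ r = false , is-sound r , refl
  occurs-run I x w p o | inj₁ r = false , is-sound r , refl
  occurs-run s x w p o | inj₂ r rewrite r with ∧-true {run x w true is true} o
  occurs-run I x w p o | inj₂ r | r₁ , k = true , is-sound r₁ , refl
  occurs-run J x w p o | inj₂ r | r₁ , k with ∧-true {path J J x} p | true-or-false (allV isE0Q1 x)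
  ... | c , _ | inj₂ i = contradiction (sym (run-forget x w true c i (is-sound r₁))) λ ()
  ... | c , e | inj₁ i = contradiction (trans (sym (hasκ-E0 x (mp e i))) k) λ ()

  -- Triangularity of the basic rows against their pivot words.

  -- Chosen, together with credit, so that weight plus credit does not increase
  -- in a joint step of two rows and stays equal only if the rows agree there.
  weight : Row → ℕ
  weight x0 = 5
  weight e0 = 3
  weight e1 = 2
  weight _  = 0

  weights : Vec Row n → ℕ
  weights []       = 0
  weights (x ∷ xs) = weight x + weights xs

  -- Two rows with runs along the same word: x follows its pivot word, and
  -- (s , b) and (s′ , h) are the states and carries of the two.
  same ahead good : State → Bool → State → Bool → Bool
  same s b s′ h = eqS s s′ ∧ eqB b h
  ahead I b J false = true
  ahead _ _ _ _     = false
  good s b s′ h = same s b s′ h ∨ ahead s b s′ h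

  -- The constants are forced by the possible confusions. Along `X`, η1 can replace ξ0, and ξ1 can
  -- replace η0, each gaining the credit: 2 + 2 < 5 and 0 + 2 < 3. With the credit already held, η1
  -- can replace η0 along `X` and keep it, and η0 can replace η1 along `Y` and lose it: 2 + 2 < 3 +
  -- 2 and 3 < 2 + 2.
  credit : State → Bool → State → Bool → ℕ
  credit s b s′ h = if ahead s b s′ h then 2 else 0

  eqR : Row → Row → Bool
  eqR (one , a) (one , b) = eqB a b
  eqR (ξ   , a) (ξ   , b) = eqB a b
  eqR (η   , a) (η   , b) = eqB a b
  eqR (ξη  , a) (ξη  , b) = eqB a b
  eqR _ _ = false

  eqR-sound : ∀ {a b} → eqR a b ≡ true → a ≡ b
  eqR-sound {one , _} {one , _} p = cong (one ,_) (eqB-sound p)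
  eqR-sound {ξ   , _} {ξ   , _} p = cong (ξ ,_) (eqB-sound p)
  eqR-sound {η   , _} {η   , _} p = cong (η ,_) (eqB-sound p)
  eqR-sound {ξη  , _} {ξη  , _} p = cong (ξη ,_) (eqB-sound p)

  isPQ : Letter → Bool
  isPQ P = true
  isPQ Q = true
  isPQ _ = false

  hasPQ : Vec Letter n → Bool
  hasPQ []       = false
  hasPQ (w ∷ ws) = isPQ w ∨ hasPQ ws

  module JointStep (s : State) (x : Row) (b : Bool) (s′ : State) (x′ : Row) (h h′ : Bool) where

    joint : Bool
    joint = (step x′ (pivotLetter s x b) h is h′) ∧ allowed s x ∧ allowed s′ x′
          ∧ carryOK s′ h ∧ carryOK (next s x) b

    start+ end+ : ℕ
    start+ = weight x + credit s (back s x b) s′ h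
    end+   = weight x′ + credit (next s x) b (next s′ x′) h′

    claim-good claim-sync : Bool
    claim-good = joint ⇒ good s (back s x b) s′ h ⇒
      (good (next s x) b (next s′ x′) h′ ∧ (end+ ≤ᵇ start+) ∧ ((end+ ≡ᵇ start+) ⇒ eqR x′ x))
    claim-sync = joint ⇒ isPQ (pivotLetter s x b) ⇒ good (next s x) b (next s′ x′) h′

  ∀-good : ∀ s x b s′ x′ h h′ → JointStep.claim-good s x b s′ x′ h h′ ≡ true
  ∀-good s x b s′ x′ h h′ =
    sound check refl (s , x , b , s′ , x′ , h , h′)
    where
    check : State × Row × Bool × State × Row × Bool × Bool → Bool
    check (s , x , b , s′ , x′ , h , h′) =
      JointStep.claim-good s x b s′ x′ h h′

  -- `P` and `Q` occur only in ξη, and they determine the outgoing carry: 0 after `P` and 1 after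
  -- `Q`. Both rows leave such a pivot letter in state `I`.
  ∀-sync : ∀ s x b s′ x′ h h′ → JointStep.claim-sync s x b s′ x′ h h′ ≡ true
  ∀-sync s x b s′ x′ h h′ =
    sound check refl (s , x , b , s′ , x′ , h , h′)
    where
    check : State × Row × Bool × State × Row × Bool × Bool → Bool
    check (s , x , b , s′ , x′ , h , h′) =
      JointStep.claim-sync s x b s′ x′ h h′

  true⇒T : ∀ {b} → b ≡ true → T b
  true⇒T refl = tt

  T⇒true : ∀ {b} → T b → b ≡ true
  T⇒true {true} _ = refl

  ∧-intro : ∀ {a b} → a ≡ true → b ≡ true → a ∧ b ≡ true
  ∧-intro refl refl = refl

  chain-≤ : ∀ w′ W′ w W c₀ c₁ c₂ → w′ + c₁ ≤ w + c₀ → W′ + c₂ ≤ W + c₁ →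
            (w′ + W′) + c₂ ≤ (w + W) + c₀ ×
            ((w′ + W′) + c₂ ≡ (w + W) + c₀ → w′ + c₁ ≡ w + c₀ × W′ + c₂ ≡ W + c₁)
  chain-≤ w′ W′ w W c₀ c₁ c₂ p q =
    subst₂ _≤_ (sym lhs) (sym rhs) (ℕ.≤-trans q′ p′) , λ eq →
    let eq′ = trans (sym lhs) (trans eq rhs) in
    sym (ℕ.+-cancelˡ-≡ W _ _ (ℕ.≤-antisym (ℕ.≤-trans (ℕ.≤-reflexive (sym eq′)) q′) p′)) ,
    ℕ.+-cancelˡ-≡ w′ _ _ (trans (ℕ.≤-antisym q′ (ℕ.≤-trans p′ (ℕ.≤-reflexive (sym eq′)))) mid)
    where
    open Algebra.Properties.CommutativeSemigroup ℕ.+-commutativeSemigroup using (x∙yz≈y∙xz)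
    mid : W + (w′ + c₁) ≡ w′ + (W + c₁)
    mid = x∙yz≈y∙xz W w′ c₁
    lhs : (w′ + W′) + c₂ ≡ w′ + (W′ + c₂)
    lhs = ℕ.+-assoc w′ W′ c₂
    rhs : (w + W) + c₀ ≡ W + (w + c₀)
    rhs = trans (cong (_+ c₀) (ℕ.+-comm w W)) (ℕ.+-assoc W w c₀)
    q′ : w′ + (W′ + c₂) ≤ W + (w′ + c₁)
    q′ = subst (w′ + (W′ + c₂) ≤_) (sym mid) (ℕ.+-monoʳ-≤ w′ q)
    p′ : W + (w′ + c₁) ≤ W + (w + c₀)
    p′ = ℕ.+-monoʳ-≤ W p

  record Runs (s : State) (x : Vec Row n) (b : Bool) (s₁ : State)
              (s′ : State) (x′ : Vec Row n) (h : Bool) (s₁′ : State) (h₁ : Bool) : Set where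
    constructor runs
    field
      pathˡ  : path s s₁ x ≡ true
      carryˡ : carryOK s₁ b ≡ true
      pathʳ  : path s′ s₁′ x′ ≡ true
      carryʳ : carryOK s′ h ≡ true
      runʳ   : run x′ (pivotFrom s x b) h ≡ just h₁

  runs-step : ∀ {s x b s₁ s′ x′ h s₁′ h₁} {xs xs′ : Vec Row n} →
    Runs s (x ∷ xs) b s₁ s′ (x′ ∷ xs′) h s₁′ h₁ →
    ∃[ h′ ] Runs (next s x) xs b s₁ (next s′ x′) xs′ h′ s₁′ h₁ ×
            JointStep.joint s x (backs (next s x) xs b) s′ x′ h h′ ≡ true
  runs-step {s = s} {x} {b} {s₁} {s′} {x′} {h} {xs = xs} {xs′} (runs p c p′ c′ r)
    with ∧-true {allowed s x} p | ∧-true {allowed s′ x′} p′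
       | run-step {x = x′} {xs′} {pivotLetter s x (backs (next s x) xs b)} {pivotFrom (next s x) xs b} r
  ... | a , p₁ | a′ , p₁′ | h′ , r₁ , r₂ =
    h′ , runs p₁ c p₁′ (step-carry s′ x′ _ h c′ r₁) r₂ ,
    ∧-intro (trans (cong (_is h′) r₁) (eqB-refl h′))
      (∧-intro a (∧-intro a′ (∧-intro c′ (backs-carry (next s x) s₁ xs b p₁ c))))

  -- The inequalities of the single steps telescope, since the credit after one step is the credit
  -- before the next. Equality of the totals forces equality in each step.
  good-runs : ∀ {s b s₁ s′ h s₁′ h₁} {x x′ : Vec Row n} → Runs s x b s₁ s′ x′ h s₁′ h₁ →
    good s (backs s x b) s′ h ≡ true →
    good s₁ b s₁′ h₁ ≡ true ×
    weights x′ + credit s₁ b s₁′ h₁ ≤ weights x + credit s (backs s x b) s′ h ×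
    (weights x′ + credit s₁ b s₁′ h₁ ≡ weights x + credit s (backs s x b) s′ h → x′ ≡ x)
  good-runs {s = s} {b} {s₁} {s′} {h} {s₁′} {h₁} {[]} {[]} (runs p c p′ c′ r) g
    with refl ← eqS-sound {s} {s₁} p | refl ← eqS-sound {s′} {s₁′} p′ | refl ← just-inj r =
    g , ℕ.≤-refl , λ _ → refl
  good-runs {s = s} {b} {s₁} {s′} {h} {s₁′} {h₁} {x ∷ xs} {x′ ∷ xs′} R g with runs-step R
  ... | h′ , R′ , j
    with ∧-true (mp (mp (∀-good s x (backs (next s x) xs b) s′ x′ h h′) j) g)
  ... | g₁ , q with ∧-true {JointStep.end+ s x (backs (next s x) xs b) s′ x′ h h′ ≤ᵇ _} q
  ... | le , eq with good-runs R′ g₁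
  ... | g₂ , le₂ , eq₂ with chain-≤ (weight x′) (weights xs′) (weight x) (weights xs)
        (credit s (back s x (backs (next s x) xs b)) s′ h) (credit (next s x) (backs (next s x) xs b) (next s′ x′) h′)
        (credit s₁ b s₁′ h₁) (ℕ.≤ᵇ⇒≤ _ _ (true⇒T le)) le₂
  ... | le₃ , eq₃ = g₂ , le₃ , λ e → let e₁ , e₂ = eq₃ e in
    cong₂ _∷_ (eqR-sound (mp eq (T⇒true (ℕ.≡⇒≡ᵇ _ _ e₁)))) (eq₂ e₂)

  -- A good pair stays good, so one `P` or `Q` anywhere makes the end good. For closed runs the end
  -- is also the start, which supplies the hypothesis of `good-runs`.
  sync-runs : ∀ {s b s₁ s′ h s₁′ h₁} {x x′ : Vec Row n} → Runs s x b s₁ s′ x′ h s₁′ h₁ →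
    hasPQ (pivotFrom s x b) ≡ true → good s₁ b s₁′ h₁ ≡ true
  sync-runs {x = []} {[]} R ()
  sync-runs {s = s} {b} {s₁} {s′} {h} {s₁′} {h₁} {x ∷ xs} {x′ ∷ xs′} R pq with runs-step R
  ... | h′ , R′ , j with true-or-false (isPQ (pivotLetter s x (backs (next s x) xs b)))
  ...   | inj₁ q = proj₁ (good-runs R′ (mp (mp (∀-sync s x (backs (next s x) xs b) s′ x′ h h′) j) q))
  ...   | inj₂ q rewrite q = sync-runs R′ pq

  -- Idle rows contain a single word, which other rows may contain as well, so
  -- they have to come last.
  idle : State → Vec Row n → Bool
  idle J x = allV notQ0 x
  idle I x = false

  bound : ∀ (x : Vec Row n) → weights x ≤ n * 5
  bound [] = z≤n
  bound (x ∷ xs) = ℕ.+-mono-≤ (weight≤5 x) (bound xs)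
    where
    weight≤5 : ∀ x → weight x ≤ 5
    weight≤5 x = ℕ.≤ᵇ⇒≤ _ _ (true⇒T (sound (λ x → weight x ≤ᵇ 5) refl x))

  -- 5 is the largest weight of a letter, so `suc (n * 5)` puts the idle rows strictly above all
  -- others.
  size : State → Vec Row n → ℕ
  size {n} s x = if idle s x then suc (n * 5) else weights x

  ∨-left : ∀ {a} b → a ≡ true → a ∨ b ≡ true
  ∨-left b refl = refl

  ∨-right : ∀ a {b} → b ≡ true → a ∨ b ≡ true
  ∨-right a refl = Bool.∨-zeroʳ a

  hasPQ-Q0 : ∀ s (x : Vec Row n) b → allV notQ0 x ≡ false → hasPQ (pivotFrom s x b) ≡ true
  hasPQ-Q0 s (x ∷ xs) b p with notQ0 x in eq
  ... | true = ∨-right (isPQ (pivotLetter s x (backs (next s x) xs b))) (hasPQ-Q0 (next s x) xs b p)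
  hasPQ-Q0 s (q0 ∷ xs) b p | false =
    ∨-left _ (sound (λ (s , b) → isPQ (pivotLetter s q0 b)) refl (s , backs I xs b))

  J-to-I : ∀ (x : Vec Row n) → path J I x ≡ true → allV notQ0 x ≡ false
  J-to-I (z0 ∷ xs) p = J-to-I xs p
  J-to-I (x1 ∷ xs) p = J-to-I xs p
  J-to-I (e0 ∷ xs) p = J-to-I xs p
  J-to-I (e1 ∷ xs) p = J-to-I xs p
  J-to-I (q1 ∷ xs) p = J-to-I xs p
  J-to-I (q0 ∷ xs) p = refl

  -- A closed path at `I` not made of ξ0 and η0 alone either reads ξη in state `I`, where the pivot
  -- letter is `P` or `Q`, or drops to `J`, from where only ξη0 leads back.
  hasPQ-I : ∀ (x : Vec Row n) b → path I I x ≡ true → allV isX0E0 x ≡ false →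
            hasPQ (pivotFrom I x b) ≡ true
  hasPQ-J : ∀ (x : Vec Row n) b → path J I x ≡ true → hasPQ (pivotFrom J x b) ≡ true
  hasPQ-J x b p = hasPQ-Q0 J x b (J-to-I x p)
  hasPQ-I (z0 ∷ xs) b p q = hasPQ-J xs b p
  hasPQ-I (z1 ∷ xs) b p q = hasPQ-J xs b p
  hasPQ-I (x1 ∷ xs) b p q = ∨-right (isPQ (pivotLetter I x1 (backs J xs b))) (hasPQ-J xs b p)
  hasPQ-I (e1 ∷ xs) b p q = ∨-right (isPQ (pivotLetter I e1 (backs J xs b))) (hasPQ-J xs b p)
  hasPQ-I (x0 ∷ xs) b p q = ∨-right (isPQ (pivotLetter I x0 (backs I xs b))) (hasPQ-I xs b p q)
  hasPQ-I (e0 ∷ xs) b p q = ∨-right (isPQ (pivotLetter I e0 (backs I xs b))) (hasPQ-I xs b p q)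
  hasPQ-I (q0 ∷ xs) b p q with backs I xs b
  ... | true  = refl
  ... | false = refl
  hasPQ-I (q1 ∷ xs) b p q with backs I xs b
  ... | true  = refl
  ... | false = refl

  hasPQ-basic : ∀ s (x : Vec Row n) b → basic s x ≡ true → idle s x ≡ false → hasPQ (pivotFrom s x b) ≡ true
  hasPQ-basic J x b p i = hasPQ-Q0 J x b i
  hasPQ-basic I x b p i with ∧-true {path I I x} p
  ... | p₁ , p₂ = hasPQ-I x b p₁ (trans (sym (Bool.not-involutive _)) (cong not p₂))

  idle-noPQ : ∀ (x : Vec Row n) w {h} → path J J x ≡ true → allV notQ0 x ≡ true → run x w false ≡ just h →
              hasPQ w ≡ false
  idle-noPQ [] [] _ _ _ = refl
  idle-noPQ (z0 ∷ xs) (𝟙 ∷ ws) p q r = idle-noPQ xs ws p q r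
  idle-noPQ (x1 ∷ xs) (Z ∷ ws) p q r = idle-noPQ xs ws p q r
  idle-noPQ (e0 ∷ xs) (Y ∷ ws) p q r = idle-noPQ xs ws p q r
  idle-noPQ (e1 ∷ xs) (X ∷ ws) p q r = idle-noPQ xs ws p q r
  idle-noPQ (q1 ∷ xs) (N ∷ ws) p q r = idle-noPQ xs ws p q r

  -- An idle path stays in `J` with carry 0. There the letter determines the allowed row: `𝟙`, `Z`,
  -- `Y`, `X` and `N` belong to one0, ξ1, η0, η1 and ξη1.
  idle-unique : ∀ (x x′ : Vec Row n) b {h} → path J J x ≡ true → allV notQ0 x ≡ true →
                path J J x′ ≡ true → allV notQ0 x′ ≡ true →
                run x′ (pivotFrom J x b) false ≡ just h → carryOK J b ≡ true → x′ ≡ x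
  idle-unique [] [] b _ _ _ _ _ _ = refl
  idle-unique (x ∷ xs) (x′ ∷ xs′) b {h} p q p′ q′ r ok =
    go x x′ p q p′ q′ (subst (λ c → run (x′ ∷ xs′) (pivotLetter J x c ∷ pivotFrom (next J x) xs b) false ≡ just h) b≡ r)
    where
    tails : ∀ x x′ → next J x ≡ J → path (next J x) J xs ≡ true → allV notQ0 xs ≡ true → path J J xs′ ≡ true →
            allV notQ0 xs′ ≡ true → run xs′ (pivotFrom (next J x) xs b) false ≡ just h → x′ ≡ x → x′ ∷ xs′ ≡ x ∷ xs
    tails x x′ e p q p′ q′ r refl rewrite e = cong (x ∷_) (idle-unique xs xs′ b p q p′ q′ r ok)
    b≡ : backs (next J x) xs b ≡ false
    b≡ with true-or-false (notQ0 x) | ∧-true {allowed J x} p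
    ... | inj₂ n | _ = contradiction (trans (sym (cong (_∧ allV notQ0 xs) n)) q) λ ()
    ... | inj₁ n | a , p₂ with next-J x a n
      where
      next-J : ∀ x → allowed J x ≡ true → notQ0 x ≡ true → next J x ≡ J
      next-J x a n = eqS-sound (mp (mp (sound (λ x → allowed J x ⇒ notQ0 x ⇒ eqS (next J x) J) refl x) a) n)
    ... | e rewrite e = carryOK-J (backs-carry J J xs b p₂ ok)
    go : ∀ x x′ → path J J (x ∷ xs) ≡ true → allV notQ0 (x ∷ xs) ≡ true → path J J (x′ ∷ xs′) ≡ true →
         allV notQ0 (x′ ∷ xs′) ≡ true → run (x′ ∷ xs′) (pivotLetter J x false ∷ pivotFrom (next J x) xs b) false ≡ just h →
         x′ ∷ xs′ ≡ x ∷ xs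
    go z0 z0 p q p′ q′ r = tails z0 z0 refl p q p′ q′ r refl
    go x1 x1 p q p′ q′ r = tails x1 x1 refl p q p′ q′ r refl
    go e0 e0 p q p′ q′ r = tails e0 e0 refl p q p′ q′ r refl
    -- With carry 0 the letter `X` fits ξ0 as well as η1, but ξ0 is not allowed in `J`.
    go e1 x0 p q () q′ r
    go e1 e1 p q p′ q′ r = tails e1 e1 refl p q p′ q′ r refl
    go q1 q1 p q p′ q′ r = tails q1 q1 refl p q p′ q′ r refl

  both-pure : ∀ (x : Vec Row n) → path J J x ≡ true → path I I x ≡ true → allV isE0Q1 x ≡ true
  both-pure [] _ _ = refl
  both-pure (e0 ∷ xs) p q = both-pure xs p q
  both-pure (q1 ∷ xs) p q = both-pure xs p q
  both-pure (z0 ∷ xs) p q = contradiction (trans (sym (path-end J J xs p)) (path-end J I xs q)) λ ()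
  both-pure (x1 ∷ xs) p q = contradiction (trans (sym (path-end J J xs p)) (path-end J I xs q)) λ ()
  both-pure (e1 ∷ xs) p q = contradiction (trans (sym (path-end J J xs p)) (path-end J I xs q)) λ ()
  both-pure (q0 ∷ xs) p q = contradiction (trans (sym (path-end I J xs p)) (path-end I I xs q)) λ ()

  -- A word closed at both states is pure in η0 and ξη1. Of these `basic J` keeps only η0...η0,
  -- which `basic I` excludes.
  one-state : ∀ (x : Vec Row n) → basic J x ≡ true → basic I x ≡ true → ⊥
  one-state x p q with ∧-true {path J J x} p | ∧-true {path I I x} q
  ... | p₁ , p₂ | q₁ , q₂ = contradiction (trans (sym q₂) (cong not (allV-⇒ e⇒ x (mp p₂ (both-pure x p₁ q₁))))) λ ()
    where
    e⇒ : ∀ a → isE0 a ≡ true → isX0E0 a ≡ true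
    e⇒ a = mp (sound (λ a → isE0 a ⇒ isX0E0 a) refl a)

  -- The pivot word of a row that is not idle has a `P` or `Q`, so no idle row contains it; if the
  -- other row is not idle either, the two closed runs form a good pair and the weights decide. Two
  -- idle rows are separated by `idle-unique`, and an idle row is larger than any other by
  -- definition of `size`.
  triangular : ∀ s (x : Vec Row n) s′ x′ → basic s x ≡ true → basic s′ x′ ≡ true →
               occurs x′ (pivot s x) ≡ true → (s′ , x′) ≢ (s , x) → size s′ x′ < size s x
  triangular {n} s x s′ x′ p p′ o ne with occurs-run s′ x′ (pivot s x) p′ o
  ... | h , r , c with true-or-false (idle s x) | true-or-false (idle s′ x′)
  ... | inj₁ i | inj₂ i′ rewrite i | i′ = s≤s (bound x′)
  triangular J x J x′ p p′ o ne | h , r , c | inj₁ i | inj₁ i′ =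
    contradiction (cong (J ,_) (idle-unique x x′ _ (basic-path J x p) i (basic-path J x′ p′) i′
      (subst (λ h → run x′ (pivot J x) h ≡ just h) (carryOK-J c) r) (Closed.start-carry {s = J} {x} (basic-path J x p)))) ne
  triangular s x J x′ p p′ o ne | h , r , c | inj₂ i | inj₁ i′ =
    contradiction (trans (sym (idle-noPQ x′ (pivot s x) (basic-path J x′ p′) i′
      (subst (λ h → run x′ (pivot s x) h ≡ just h) (carryOK-J c) r))) (hasPQ-basic s x _ p i)) λ ()
  ... | inj₂ i | inj₂ i′ rewrite i | i′ = ℕ.≤∧≢⇒< (proj₁ result) λ e → differ s s′ p p′ ne (proj₂ result e)
    where
    b = backs s x false
    R : Runs s x b s s′ x′ h s′ h
    R = runs (basic-path s x p) (Closed.start-carry {s = s} {x} (basic-path s x p)) (basic-path s′ x′ p′) c r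
    result : weights x′ ≤ weights x × (weights x′ ≡ weights x → x′ ≡ x)
    -- Both runs are closed, so goodness at the end is goodness at the start, and the credits at the
    -- two ends are equal and cancel.
    result with good-runs R (subst (λ b′ → good s b′ s′ h ≡ true) (sym (backs-idem s x false))
                  (sync-runs R (hasPQ-basic s x b p i)))
    ... | _ , le , eq rewrite backs-idem s x false =
      ℕ.+-cancelʳ-≤ _ _ _ le , λ e → eq (cong (_+ _) e)
    differ : ∀ s s′ → basic s x ≡ true → basic s′ x′ ≡ true → (s′ , x′) ≢ (s , x) → x′ ≢ x
    differ J J p p′ ne refl = ne refl
    differ I I p p′ ne refl = ne refl
    differ J I p p′ ne refl = one-state x p p′
    differ I J p p′ ne refl = one-state x p′ p

-- Enumeration and counting of the basic rows.

module BasicRows where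

  open RowWords
  open import Data.List.Base as List using (List; []; _∷_; _++_; length; filter; map; cartesianProductWith)
  import Data.List.Properties as List
  open import Data.List.Membership.Propositional using (_∈_)
  import Data.List.Membership.Propositional.Properties as ∈
  open import Data.List.Relation.Unary.Any as Any using (here)
  import Data.List.Relation.Unary.All as All
  import Data.List.Relation.Unary.Any.Properties as AnyP
  open import Data.List.Relation.Unary.AllPairs using ([]; _∷_)
  open import Data.List.Relation.Unary.Unique.Propositional using (Unique)
  import Data.List.Relation.Unary.Unique.Propositional.Properties as Unique
  open import Data.Nat.Base using (_+_; _*_; _^_)
  open import Data.Nat.ListAction using (sum)
  open import Data.Nat.Tactic.RingSolver using (solve-∀)
  open import Data.Vec.Base using (Vec; []; _∷_)
  import Data.Vec.Properties as Vec
  open import Relation.Binary.PropositionalEquality using (refl; sym; trans; cong; cong₂; subst; module ≡-Reasoning)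

  private variable n : ℕ

  select : {A : Set} → (A → Bool) → List A → List A
  select p = filter (λ x → p x Bool.≟ true)

  rows : List Row
  rows = elements

  wordsOver : {A : Set} → List A → ∀ n → List (Vec A n)
  wordsOver as zero    = [] ∷ []
  wordsOver as (suc n) = cartesianProductWith _∷_ as (wordsOver as n)

  wordsOver-unique : {A : Set} {as : List A} → Unique as → ∀ n → Unique (wordsOver as n)
  wordsOver-unique u zero    = All.[] ∷ []
  wordsOver-unique u (suc n) = Unique.cartesianProductWith⁺ _∷_ Vec.∷-injective u (wordsOver-unique u n)

  ∈-wordsOver : {A : Set} {as : List A} → (∀ a → a ∈ as) → (w : Vec A n) → w ∈ wordsOver as n
  ∈-wordsOver all []      = here refl
  ∈-wordsOver all (a ∷ w) = ∈.∈-cartesianProductWith⁺ _∷_ (all a) (∈-wordsOver all w)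

  rowWords : ∀ n → List (Vec Row n)
  rowWords = wordsOver rows

  tag : State → Vec Row n → State × Vec Row n
  tag s x = s , x

  basicRows : ∀ n → List (State × Vec Row n)
  basicRows n = map (tag J) (select (basic J) (rowWords n)) ++ map (tag I) (select (basic I) (rowWords n))

  factors-unique : Unique (elements {Factor})
  factors-unique =
    ((λ ()) All.∷ (λ ()) All.∷ (λ ()) All.∷ All.[]) ∷ ((λ ()) All.∷ (λ ()) All.∷ All.[]) ∷ ((λ ()) All.∷ All.[]) ∷ All.[] ∷ []

  rows-unique : Unique rows
  rows-unique = Unique.cartesianProduct⁺ factors-unique (((λ ()) All.∷ All.[]) ∷ All.[] ∷ [])

  basicRows-unique : ∀ n → Unique (basicRows n)
  basicRows-unique n = Unique.++⁺ (unique J) (unique I) disjoint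
    where
    unique : ∀ s → Unique (map (tag s) (select (basic s) (rowWords n)))
    unique s = Unique.map⁺ (λ {refl → refl}) (Unique.filter⁺ _ (wordsOver-unique rows-unique n))
    disjoint : ∀ {v} → v ∈ map (tag J) (select (basic J) (rowWords n)) × v ∈ map (tag I) (select (basic I) (rowWords n)) → _
    disjoint (a , b) with ∈.∈-map⁻ (tag J) a | ∈.∈-map⁻ (tag I) b
    ... | _ , _ , refl | _ , _ , ()

  basicRow : Fin (length (basicRows n)) → State × Vec Row n
  basicRow {n} = List.lookup (basicRows n)

  lookup-injective : {A : Set} {xs : List A} → Unique xs → ∀ i j → List.lookup xs i ≡ List.lookup xs j → i ≡ j
  lookup-injective (x ∷ u) zero    zero    _ = refl
  lookup-injective (x ∷ u) zero    (suc j) e = contradiction e (All.lookup x (∈.∈-lookup j))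
  lookup-injective (x ∷ u) (suc i) zero    e = contradiction (sym e) (All.lookup x (∈.∈-lookup i))
  lookup-injective (x ∷ u) (suc i) (suc j) e = cong suc (lookup-injective u i j e)

  basicRow-injective : ∀ (i j : Fin (length (basicRows n))) → basicRow {n} i ≡ basicRow j → i ≡ j
  basicRow-injective {n} = lookup-injective (basicRows-unique n)

  basicRow-surjective : ∀ s (x : Vec Row n) → basic s x ≡ true → ∃[ i ] basicRow {n} i ≡ (s , x)
  basicRow-surjective {n} s x p = Any.index (member s p) , sym (AnyP.lookup-index (member s p))
    where
    member : ∀ s → basic s x ≡ true → (s , x) ∈ basicRows n
    member J p = ∈.∈-++⁺ˡ (∈.∈-map⁺ _ (∈.∈-filter⁺ _ (∈-wordsOver complete x) p))
    member I p = ∈.∈-++⁺ʳ _ (∈.∈-map⁺ _ (∈.∈-filter⁺ _ (∈-wordsOver complete x) p))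

  basicRow-basic : ∀ i → let s , x = basicRow {n} i in basic s x ≡ true
  basicRow-basic {n} i = member (∈.∈-lookup {xs = basicRows n} i)
    where
    member : ∀ {v} → v ∈ basicRows n → basic (proj₁ v) (proj₂ v) ≡ true
    member m with ∈.∈-++⁻ (map (tag J) (select (basic J) (rowWords n))) m
    ... | inj₁ a with ∈.∈-map⁻ (tag J) a
    ...   | _ , b , refl = proj₂ (∈.∈-filter⁻ _ {xs = rowWords n} b)
    member m | inj₂ a with ∈.∈-map⁻ (tag I) a
    ...   | _ , b , refl = proj₂ (∈.∈-filter⁻ _ {xs = rowWords n} b)

  count : ∀ n → (Vec Row n → Bool) → ℕ
  count n p = length (select p (rowWords n))

  toℕ : Bool → ℕ
  toℕ true  = 1
  toℕ false = 0

  select-∷ : {A : Set} (p : A → Bool) (x : A) (xs : List A) →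
             length (select p (x ∷ xs)) ≡ toℕ (p x) + length (select p xs)
  select-∷ p x xs with p x
  ... | true  = refl
  ... | false = refl

  length-select-map : {A B : Set} (p : B → Bool) (f : A → B) (xs : List A) →
                      length (select p (map f xs)) ≡ length (select (λ a → p (f a)) xs)
  length-select-map p f []       = refl
  length-select-map p f (x ∷ xs) = trans (select-∷ p (f x) (map f xs))
    (trans (cong (toℕ (p (f x)) +_) (length-select-map p f xs)) (sym (select-∷ (λ a → p (f a)) x xs)))

  count-suc : ∀ p → count (suc n) p ≡ sum (map (λ x → count n (λ xs → p (x ∷ xs))) rows)
  count-suc {n} p = go rows
    where
    go : ∀ rs → length (select p (cartesianProductWith _∷_ rs (rowWords n))) ≡
                sum (map (λ x → count n (λ xs → p (x ∷ xs))) rs)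
    go []       = refl
    go (r ∷ rs) = trans (cong length (List.filter-++ (λ x → p x Bool.≟ true) (map (r ∷_) (rowWords n)) _))
      (trans (List.length-++ (select p (map (r ∷_) (rowWords n))))
        (cong₂ _+_ (length-select-map p (r ∷_) (rowWords n)) (go rs)))

  balance : {A : Set} (p q r s : A → Bool) → (∀ a → toℕ (p a) + toℕ (q a) ≡ toℕ (r a) + toℕ (s a)) →
            ∀ xs → length (select p xs) + length (select q xs) ≡ length (select r xs) + length (select s xs)
  balance p q r s f [] = refl
  balance p q r s f (x ∷ xs) rewrite select-∷ p x xs | select-∷ q x xs | select-∷ r x xs | select-∷ s x xs =
    trans (swap (toℕ (p x)) _ _ _) (trans (cong₂ _+_ (f x) (balance p q r s f xs)) (sym (swap (toℕ (r x)) _ _ _)))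
    where
    swap : ∀ a b c d → (a + b) + (c + d) ≡ (a + c) + (b + d)
    swap = solve-∀

  count-false : ∀ n → count n (λ _ → false) ≡ 0
  count-false n = go (rowWords n)
    where
    go : ∀ (xs : List (Vec Row n)) → length (select (λ _ → false) xs) ≡ 0
    go []       = refl
    go (x ∷ xs) = go xs

  paths : ℕ → State → State → ℕ
  paths n s s′ = count n (path s s′)

  paths-J : ∀ n s → paths (suc n) J s ≡ 5 * paths n J s + paths n I s
  paths-J n s rewrite count-suc {n} (path J s) | count-false n = arith (paths n J s) (paths n I s)
    where
    arith : ∀ a b → a + (a + (a + (a + (b + (a + 0))))) ≡ 5 * a + b
    arith = solve-∀

  paths-I : ∀ n s → paths (suc n) I s ≡ 4 * paths n J s + 4 * paths n I s
  paths-I n s rewrite count-suc {n} (path I s) = arith (paths n J s) (paths n I s)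
    where
    arith : ∀ a b → a + (a + (b + (a + (b + (a + (b + (b + 0))))))) ≡ 4 * a + 4 * b
    arith = solve-∀

  count-E0Q1 : ∀ n → count n (allV isE0Q1) ≡ 2 ^ n
  count-E0Q1 zero = refl
  count-E0Q1 (suc n) rewrite count-suc {n} (allV isE0Q1) | count-false n | count-E0Q1 n = refl

  count-X0E0 : ∀ n → count n (allV isX0E0) ≡ 2 ^ n
  count-X0E0 zero = refl
  count-X0E0 (suc n) rewrite count-suc {n} (allV isX0E0) | count-false n | count-X0E0 n = refl

  count-E0 : ∀ n → count n (allV isE0) ≡ 1
  count-E0 zero = refl
  count-E0 (suc n) rewrite count-suc {n} (allV isE0) | count-false n | count-E0 n = refl

  pure-path : (x : Vec Row n) → allV isE0Q1 x ≡ true → path J J x ≡ true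
  pure-path []        _ = refl
  pure-path (e0 ∷ xs) p = pure-path xs p
  pure-path (q1 ∷ xs) p = pure-path xs p

  x0e0-path : (x : Vec Row n) → allV isX0E0 x ≡ true → path I I x ≡ true
  x0e0-path []        _ = refl
  x0e0-path (e0 ∷ xs) p = x0e0-path xs p
  x0e0-path (x0 ∷ xs) p = x0e0-path xs p

  e0-pure : (x : Vec Row n) → allV isE0 x ≡ true → allV isE0Q1 x ≡ true
  e0-pure = allV-⇒ (λ a → mp (sound (λ a → isE0 a ⇒ isE0Q1 a) refl a))

  -- Adding the 2^n words in η0 and ξη1 to the basic rows at `J` gives all closed paths at `J`, with
  -- η0...η0 counted twice. Adding the 2^n words in ξ0 and η0 to those at `I` gives all closed paths
  -- at `I`. The sums avoid truncated subtraction.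
  length-basicRows : ∀ n → length (basicRows n) + 2 ^ suc n ≡ paths n J J + paths n I I + 1
  length-basicRows n = begin
    length (basicRows n) + 2 ^ suc n              ≡⟨ cong (_+ 2 ^ suc n) lengths ⟩
    count n (basic J) + count n (basic I) + 2 ^ suc n
      ≡⟨ arith (count n (basic J)) (count n (basic I)) (2 ^ n) ⟩
    (count n (basic J) + 2 ^ n) + (count n (basic I) + 2 ^ n)
      ≡⟨ cong₂ _+_ balance-J balance-I ⟩
    (paths n J J + 1) + (paths n I I + 0)         ≡⟨ arith₂ (paths n J J) (paths n I I) ⟩
    paths n J J + paths n I I + 1                 ∎
    where
    open ≡-Reasoning
    arith : ∀ a b c → a + b + (c + (c + 0)) ≡ (a + c) + (b + c)
    arith = solve-∀
    arith₂ : ∀ a b → (a + 1) + (b + 0) ≡ a + b + 1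
    arith₂ = solve-∀
    lengths : length (basicRows n) ≡ count n (basic J) + count n (basic I)
    lengths = trans (List.length-++ (map (tag J) (select (basic J) (rowWords n))))
      (cong₂ _+_ (List.length-map (tag J) (select (basic J) (rowWords n)))
                 (List.length-map (tag I) (select (basic I) (rowWords n))))
    balance-J : count n (basic J) + 2 ^ n ≡ paths n J J + 1
    balance-J = subst (λ m → count n (basic J) + m ≡ paths n J J + 1) (count-E0Q1 n)
      (subst (λ m → count n (basic J) + count n (allV isE0Q1) ≡ paths n J J + m) (count-E0 n)
        (balance (basic J) (allV isE0Q1) (path J J) (allV isE0) pointwise (rowWords n)))
      where
      pointwise : ∀ x → toℕ (basic J x) + toℕ (allV isE0Q1 x) ≡ toℕ (path J J x) + toℕ (allV isE0 x)
      pointwise x with path J J x | allV isE0Q1 x | allV isE0 x | pure-path x | e0-pure x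
      ... | true  | true  | true  | _ | _ = refl
      ... | true  | true  | false | _ | _ = refl
      ... | true  | false | false | _ | _ = refl
      ... | false | false | false | _ | _ = refl
      ... | _     | false | true  | _ | f = contradiction (f refl) λ ()
      ... | false | true  | _     | f | _ = contradiction (f refl) λ ()
    balance-I : count n (basic I) + 2 ^ n ≡ paths n I I + 0
    balance-I = subst (λ m → count n (basic I) + m ≡ paths n I I + 0) (count-X0E0 n)
      (subst (λ m → count n (basic I) + count n (allV isX0E0) ≡ paths n I I + m) (count-false n)
        (balance (basic I) (allV isX0E0) (path I I) (λ _ → false) pointwise (rowWords n)))
      where
      pointwise : ∀ x → toℕ (basic I x) + toℕ (allV isX0E0 x) ≡ toℕ (path I I x) + 0
      pointwise x with path I I x | allV isX0E0 x | x0e0-path x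
      ... | true  | true  | _ = refl
      ... | true  | false | _ = refl
      ... | false | false | _ = refl
      ... | false | true  | f = contradiction (f refl) λ ()

-- The closed formula in ℚ(√17).

module RankFormula where

  open RowWords using (J; I)
  open BasicRows using (paths; paths-J; paths-I)
  open import Algebra.Bundles using (CommutativeRing)
  import Data.Integer.Base as ℤ
  import Data.Integer.Properties as ℤ
  import Data.Nat.Tactic.RingSolver as ℕSolver
  open import Data.Rational.Base as ℚ using (ℚ; ½; 0ℚ; 1ℚ; _+_; _*_; _-_; -_; toℚᵘ)
  import Data.Rational.Properties as ℚ
  import Algebra.Solver.Ring.NaturalCoefficients.Default (CommutativeRing.commutativeSemiring ℚ.+-*-commutativeRing) as ℚSolver
  import Data.Rational.Unnormalised.Base as ℚᵘ
  import Data.Rational.Unnormalised.Properties as ℚᵘ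
  open import Relation.Binary.PropositionalEquality using (refl; sym; trans; cong; cong₂)
  open ℚ√17-Notation using (_^_; fromℕ; 1#) renaming (_*_ to _⊛_; _+_ to _⊕_; -_ to ⊖_)


  ι : ℕ → ℚ
  ι n = ℤ.+ n ℚ./ 1

  toℚᵘ-ι : ∀ n → toℚᵘ (ι n) ℚᵘ.≃ ℚᵘ.mkℚᵘ (ℤ.+ n) 0
  toℚᵘ-ι n = ℚ.toℚᵘ-fromℚᵘ (ℚᵘ.mkℚᵘ (ℤ.+ n) 0)

  ι-+ : ∀ m n → ι (m ℕ.+ n) ≡ ι m + ι n
  ι-+ m n = ℚ.toℚᵘ-injective (begin
    toℚᵘ (ι (m ℕ.+ n))                          ≈⟨ toℚᵘ-ι (m ℕ.+ n) ⟩
    ℚᵘ.mkℚᵘ (ℤ.+ (m ℕ.+ n)) 0                      ≈⟨ ℚᵘ.*≡* (cong (ℤ._* ℤ.+ 1) (cong₂ ℤ._+_ (sym (ℤ.*-identityʳ (ℤ.+ m))) (sym (ℤ.*-identityʳ (ℤ.+ n))))) ⟩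
    ℚᵘ.mkℚᵘ (ℤ.+ m) 0 ℚᵘ.+ ℚᵘ.mkℚᵘ (ℤ.+ n) 0          ≈⟨ ℚᵘ.+-cong (toℚᵘ-ι m) (toℚᵘ-ι n) ⟨
    toℚᵘ (ι m) ℚᵘ.+ toℚᵘ (ι n)                   ≈⟨ ℚ.toℚᵘ-homo-+ (ι m) (ι n) ⟨
    toℚᵘ (ι m + ι n)                            ∎)
    where open ℚᵘ.≃-Reasoning

  -- For A = (1 1; 4 0) the transition matrix is A² = A + 4, so each of its powers has the form v +
  -- u A. The two equations express this with u = `paths n J I` and v = `paths n I I`.
  paths-symmetric : ∀ n → paths n J J ≡ paths n I I ℕ.+ paths n J I × paths n I J ≡ 4 ℕ.* paths n J I
  paths-symmetric zero = refl , refl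
  paths-symmetric (suc n) with paths-symmetric n
  ... | a , b rewrite paths-J n J | paths-J n I | paths-I n J | paths-I n I | a | b =
    first (paths n J I) (paths n I I) , second (paths n J I) (paths n I I)
    where
    first : ∀ u v → 5 ℕ.* (v ℕ.+ u) ℕ.+ 4 ℕ.* u ≡ 4 ℕ.* u ℕ.+ 4 ℕ.* v ℕ.+ (5 ℕ.* u ℕ.+ v)
    first = ℕSolver.solve-∀
    second : ∀ u v → 4 ℕ.* (v ℕ.+ u) ℕ.+ 4 ℕ.* (4 ℕ.* u) ≡ 4 ℕ.* (5 ℕ.* u ℕ.+ v)
    second = ℕSolver.solve-∀

  ι-4 : ∀ n → ι (4 ℕ.* n) ≡ (ι 4) * ι n
  ι-4 n = trans (trans (ι-+ n (n ℕ.+ (n ℕ.+ (n ℕ.+ 0)))) (cong (ι n +_) (trans (ι-+ n (n ℕ.+ (n ℕ.+ 0))) (cong (ι n +_) (trans (ι-+ n (n ℕ.+ 0)) (cong (ι n +_) (ι-+ n 0)))))))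
    (solve 1 (λ x → x :+ (x :+ (x :+ (x :+ con 0))) := (con 1 :+ (con 1 :+ (con 1 :+ con 1))) :* x) refl (ι n))
    where open ℚSolver

  module Powers (n : ℕ) where
    u v : ℚ
    u = ι (paths n J I)
    v = ι (paths n I I)

  u-suc : ∀ n → Powers.u (suc n) ≡ (ι 5) * Powers.u n + Powers.v n
  u-suc n = trans (cong ι (paths-J n I)) (trans (ι-+ (5 ℕ.* paths n J I) (paths n I I)) (cong (_+ ι (paths n I I))
    (trans (ι-+ (paths n J I) (4 ℕ.* paths n J I)) (trans (cong (ι (paths n J I) +_) (ι-4 (paths n J I)))
      (solve 1 (λ x → x :+ (con 1 :+ (con 1 :+ (con 1 :+ con 1))) :* x := (con 1 :+ (con 1 :+ (con 1 :+ (con 1 :+ con 1)))) :* x) refl (ι (paths n J I)))))))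
    where open ℚSolver

  v-suc : ∀ n → Powers.v (suc n) ≡ (ι 4) * Powers.u n + (ι 4) * Powers.v n
  v-suc n = trans (cong ι (paths-I n I)) (trans (ι-+ (4 ℕ.* paths n J I) (4 ℕ.* paths n I I)) (cong₂ _+_ (ι-4 (paths n J I)) (ι-4 (paths n I I))))

  double-suc : ∀ t → 2 ℕ.* suc t ≡ suc (suc (2 ℕ.* t))
  double-suc t = cong suc (ℕ.+-suc t _)

  conjugate : ℚ√17 → ℚ√17
  conjugate (a +√17· b) = a +√17· (- b)

  φ φ̄ : ℚ√17
  φ = ½ +√17· ½
  φ̄ = ½ +√17· (- ½)

  conjugate-φ : ∀ z → φ̄ ⊛ conjugate z ≡ conjugate (φ ⊛ z)
  conjugate-φ (a +√17· b) = cong₂ _+√17·_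
    (cong (λ x → ½ * a + ι 17 * x) (trans (sym (ℚ.neg-distribˡ-* ½ (- b))) (trans (cong -_ (sym (ℚ.neg-distribʳ-* ½ b))) (⁻¹-involutive (½ * b)))))
    (trans (cong₂ _+_ (sym (ℚ.neg-distribʳ-* ½ b)) (sym (ℚ.neg-distribˡ-* ½ a))) (sym (ℚ.neg-distrib-+ (½ * b) (½ * a))))
    where open import Algebra.Properties.Group ℚ.+-0-group using (⁻¹-involutive)

  power-conjugate : ∀ n → φ̄ ^ n ≡ conjugate (φ ^ n)
  power-conjugate zero    = refl
  power-conjugate (suc n) = trans (cong (φ̄ ⊛_) (power-conjugate n)) (conjugate-φ (φ ^ n))

  -- `h` and `s` stand for `½` and 17. As variables they leave an identity with natural
  -- coefficients; the constants that arise are evaluated by `rat₁` to `irr₂` below.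
  square-rat : ∀ h s u v → h * (h * (v + h * u) + s * (h * (h * u))) + s * (h * (h * (h * u) + h * (v + h * u)))
    ≡ (h * h * (1ℚ + s)) * v + (h * h * h * (1ℚ + s + s + s)) * u
  square-rat = solve 4 (λ h s u v →
    h :* (h :* (v :+ h :* u) :+ s :* (h :* (h :* u))) :+ s :* (h :* (h :* (h :* u) :+ h :* (v :+ h :* u)))
    := (h :* h :* (con 1 :+ s)) :* v :+ (h :* h :* h :* (con 1 :+ s :+ s :+ s)) :* u) refl
    where open ℚSolver

  square-irr : ∀ h s u v → h * (h * (h * u) + h * (v + h * u)) + h * (h * (v + h * u) + s * (h * (h * u)))
    ≡ (h * h * (1ℚ + 1ℚ)) * v + (h * h * h * (1ℚ + 1ℚ + 1ℚ + s)) * u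
  square-irr = solve 4 (λ h s u v →
    h :* (h :* (h :* u) :+ h :* (v :+ h :* u)) :+ h :* (h :* (v :+ h :* u) :+ s :* (h :* (h :* u)))
    := (h :* h :* (con 1 :+ con 1)) :* v :+ (h :* h :* h :* (con 1 :+ con 1 :+ con 1 :+ s)) :* u) refl
    where open ℚSolver

  collect-rat : ∀ h f g u v → (f * u + f * v) + h * (g * u + v) ≡ (f + h) * v + (f + h * g) * u
  collect-rat = solve 5 (λ h f g u v → (f :* u :+ f :* v) :+ h :* (g :* u :+ v) := (f :+ h) :* v :+ (f :+ h :* g) :* u) refl
    where open ℚSolver

  collect-irr : ∀ h g u v → h * (g * u + v) ≡ h * v + (h * g) * u
  collect-irr = solve 4 (λ h g u v → h :* (g :* u :+ v) := h :* v :+ (h :* g) :* u) refl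
    where open ℚSolver

  -- As φ² = φ + 4, we get φ² (v + u φ) = (4 u + 4 v) + (5 u + v) φ, which is the recursion of
  -- `u-suc` and `v-suc`. The components appear as v + u/2 and u/2.
  square-φ : ∀ u v → φ ⊛ (φ ⊛ ((v + ½ * u) +√17· (½ * u))) ≡
    ((ι 4 * u + ι 4 * v) + ½ * (ι 5 * u + v)) +√17· (½ * (ι 5 * u + v))
  square-φ u v = cong₂ _+√17·_
    (trans (square-rat ½ (ι 17) u v) (trans (cong₂ (λ x y → x * v + y * u) rat₁ rat₂) (sym (collect-rat ½ (ι 4) (ι 5) u v))))
    (trans (square-irr ½ (ι 17) u v) (trans (cong₂ (λ x y → x * v + y * u) irr₁ irr₂) (sym (collect-irr ½ (ι 5) u v))))
    where
    rat₁ : ½ * ½ * (1ℚ + ι 17) ≡ ι 4 + ½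
    rat₁ = refl
    rat₂ : ½ * ½ * ½ * (1ℚ + ι 17 + ι 17 + ι 17) ≡ ι 4 + ½ * ι 5
    rat₂ = refl
    irr₁ : ½ * ½ * (1ℚ + 1ℚ) ≡ ½
    irr₁ = refl
    irr₂ : ½ * ½ * ½ * (1ℚ + 1ℚ + 1ℚ + ι 17) ≡ ½ * ι 5
    irr₂ = refl

  power-φ : ∀ t → φ ^ (2 ℕ.* t) ≡ (Powers.v t + ½ * Powers.u t) +√17· (½ * Powers.u t)
  power-φ zero    = refl
  power-φ (suc t) = trans (cong (φ ^_) (double-suc t)) (trans (cong (λ z → φ ⊛ (φ ⊛ z)) (power-φ t))
    (trans (square-φ (Powers.u t) (Powers.v t))
      (cong₂ (λ u v → (v + ½ * u) +√17· (½ * u)) (sym (u-suc t)) (sym (v-suc t)))))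

  power-two : ∀ n → fromℕ 2 ^ n ≡ ι (2 ℕ.^ n) +√17· 0ℚ
  power-two zero    = refl
  power-two (suc n) = trans (cong (fromℕ 2 ⊛_) (power-two n)) (cong₂ _+√17·_
      (trans (double x) (sym (trans (ι-+ (2 ℕ.^ n) (2 ℕ.^ n ℕ.+ 0)) (cong (x +_) (ι-+ (2 ℕ.^ n) 0)))))
      (trans (cong₂ _+_ (ℚ.*-zeroʳ (ι 2)) (ℚ.*-zeroˡ x)) (ℚ.+-identityʳ 0ℚ)))
    where
    x = ι (2 ℕ.^ n)
    double : ∀ x → (1ℚ + 1ℚ) * x + 0ℚ ≡ x + (x + 0ℚ)
    double = solve 1 (λ x → (con 1 :+ con 1) :* x :+ con 0 := x :+ (x :+ con 0)) refl
      where open ℚSolver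

  rankFormula-paths : ∀ t r → r ℕ.+ 2 ℕ.^ suc t ≡ paths t J J ℕ.+ paths t I I ℕ.+ 1 → fromℕ r ≡ rankFormula t
  rankFormula-paths t r eq = trans (cong₂ _+√17·_ rational irrational)
    (sym (cong₂ (λ a b → ((1# ⊕ a) ⊕ conjugate a) ⊕ (⊖ b)) (power-φ t) two)
      ▸ cong (λ a → ((1# ⊕ (φ ^ (2 ℕ.* t))) ⊕ a) ⊕ (⊖ (fromℕ 2 ^ (t ℕ.+ 1)))) (sym (power-conjugate (2 ℕ.* t))))
    where
    _▸_ = trans
    x = ½ * Powers.u t
    p = ι (2 ℕ.^ suc t)
    two : fromℕ 2 ^ (t ℕ.+ 1) ≡ p +√17· 0ℚ
    two = trans (cong (fromℕ 2 ^_) (ℕ.+-comm t 1)) (power-two (suc t))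
    irrational : 0ℚ ≡ 0ℚ + x + - x + - 0ℚ
    irrational = sym (trans (cong (_+ - 0ℚ) (trans (cong (_+ - x) (ℚ.+-identityˡ x)) (ℚ.+-inverseʳ x))) (ℚ.+-inverseʳ 0ℚ))
    ι-eq : ι r + p ≡ Powers.v t + Powers.u t + Powers.v t + 1ℚ
    ι-eq = trans (sym (ι-+ r (2 ℕ.^ suc t))) (trans (cong ι eq) (trans (ι-+ (paths t J J ℕ.+ paths t I I) 1) (cong (_+ 1ℚ)
      (trans (ι-+ (paths t J J) (paths t I I)) (cong (_+ Powers.v t)
        (trans (cong ι (proj₁ (paths-symmetric t))) (ι-+ (paths t I I) (paths t J I))))))))
    -- At `h = ½` the sum `h + h` computes to 1, so the trace 2 v + u splits evenly between the two
    -- conjugate powers.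
    halve : ∀ h u v → v + (h + h) * u + v + 1ℚ ≡ 1ℚ + (v + h * u) + (v + h * u)
    halve = solve 3 (λ h u v → v :+ (h :+ h) :* u :+ v :+ con 1 := con 1 :+ (v :+ h :* u) :+ (v :+ h :* u)) refl
      where open ℚSolver
    halves : Powers.v t + Powers.u t + Powers.v t + 1ℚ ≡ 1ℚ + (Powers.v t + x) + (Powers.v t + x)
    halves = trans (cong (λ y → Powers.v t + y + Powers.v t + 1ℚ) (sym (ℚ.*-identityˡ (Powers.u t))))
      (halve ½ (Powers.u t) (Powers.v t))
    rational : ι r ≡ 1ℚ + (Powers.v t + x) + (Powers.v t + x) + - p
    rational = trans (sym (trans (ℚ.+-assoc (ι r) p (- p)) (trans (cong (ι r +_) (ℚ.+-inverseʳ p)) (ℚ.+-identityʳ (ι r)))))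
      (cong (_+ - p) (trans ι-eq halves))

-- Linear algebra of functions: finite sums, exchange and echelon form.

module LinearSpans where

  open import Algebra.Bundles using (CommutativeRing)
  import Algebra.Definitions.RawMonoid
  import Algebra.Properties.Semiring.Sum
  import Algebra.Properties.Ring
  import Algebra.Properties.AbelianGroup
  import Algebra.Properties.CommutativeSemigroup
  open import Algebra.Module.Bundles using (LeftModule)
  open import Data.Vec.Functional using (Vector; _∷_)

  private variable
    a b c ℓ i j : Level
    n m : ℕ

  module FiniteSums {c ℓ} (R : CommutativeRing c ℓ) where
    open CommutativeRing R hiding (zero)
    open Algebra.Properties.Semiring.Sum semiring public
    open import Relation.Binary.Reasoning.Setoid setoid

    sum-zero : {g : Vector Carrier n} → (∀ k → g k ≈ 0#) → sum g ≈ 0#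
    sum-zero {n} g≈0 = trans (sum-cong-≋ g≈0) (sum-replicate-zero n)

    sum-single : (g : Vector Carrier n) (k : Fin n) → (∀ i → i ≢ k → g i ≈ 0#) → sum g ≈ g k
    sum-single g zero g≈0 = trans (+-congˡ (sum-zero λ i → g≈0 (suc i) λ ())) (+-identityʳ (g zero))
    sum-single g (suc k) g≈0 = trans (+-cong (g≈0 zero λ ()) (sum-single (g ∘ suc) k λ i i≢k → g≈0 (suc i) (i≢k ∘ Fin.suc-injective)))
      (+-identityˡ (g (suc k)))

    δ : Fin n → Fin n → Carrier
    δ i k with i Fin.≟ k
    ... | yes _ = 1#
    ... | no  _ = 0#

    δ-refl : (k : Fin n) → δ k k ≈ 1#
    δ-refl k with k Fin.≟ k
    ... | yes _ = refl
    ... | no k≢k = contradiction ≡.refl k≢k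

    δ-≢ : {i k : Fin n} → i ≢ k → δ i k ≈ 0#
    δ-≢ {i = i} {k} i≢k with i Fin.≟ k
    ... | yes i≡k = contradiction i≡k i≢k
    ... | no  _   = refl

    sum-δ : (g : Vector Carrier n) (k : Fin n) → sum (λ i → g i * δ i k) ≈ g k
    sum-δ g k = trans (sum-single _ k λ i i≢k → trans (*-congˡ (δ-≢ i≢k)) (zeroʳ (g i)))
      (trans (*-congˡ (δ-refl k)) (*-identityʳ (g k)))

  module FunctionSpan {c ℓ} (R : CommutativeRing c ℓ) {j} (J : Set j) where
    open CommutativeRing R hiding (zero)
    open FiniteSums R
    private module M = LeftModule (functionModule ring J)
    open LinearAlgebra (functionModule ring J) public
    open Algebra.Definitions.RawMonoid M.+ᴹ-rawMonoid using () renaming (sum to sumᴹ)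

    Function : Set (j ⊔ c)
    Function = J → Carrier

    sum-eval : (f : Vector Function n) (x : J) → sumᴹ f x ≡ sum (λ k → f k x)
    sum-eval {zero}  f x = ≡.refl
    sum-eval {suc n} f x = ≡.cong (f zero x +_) (sum-eval (f ∘ suc) x)

    Independent : Vector Function n → Set (j ⊔ c ⊔ ℓ)
    Independent {n} v = (y : Vector Carrier n) → (∀ x → sum (λ k → y k * v k x) ≈ 0#) → ∀ k → y k ≈ 0#

    module _ {i} {I : Set i} {f : I → Function} where

      generated-sum : (y : Vector Carrier n) {g : Vector Function n} → (∀ k → Generated f (g k)) →
                      Generated f (λ x → sum (λ k → y k * g k x))
      generated-sum {zero}  y G = zero
      generated-sum {suc n} y G = add (scale (y zero) (G zero)) (generated-sum (y ∘ suc) (G ∘ suc))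

      generated-cong : ∀ {x y} → (∀ k → f k x ≈ f k y) → ∀ {v} → Generated f v → v x ≈ v y
      generated-cong f≈ (generator k) = f≈ k
      generated-cong f≈ (resp v≈w p)  = trans (sym (v≈w _)) (trans (generated-cong f≈ p) (v≈w _))
      generated-cong f≈ zero          = refl
      generated-cong f≈ (add p q)     = +-cong (generated-cong f≈ p) (generated-cong f≈ q)
      generated-cong f≈ (scale z p)   = *-congˡ (generated-cong f≈ p)

      generated-trans : ∀ {i′} {I′ : Set i′} {g : I′ → Function} →
                        (∀ k → Generated g (f k)) → ∀ {v} → Generated f v → Generated g v
      generated-trans G (generator k) = G k
      generated-trans G (resp v≈w p)  = resp v≈w (generated-trans G p)
      generated-trans G zero          = zero
      generated-trans G (add p q)     = add (generated-trans G p) (generated-trans G q)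
      generated-trans G (scale x p)   = scale x (generated-trans G p)

      generated-* : ∀ (h : Function) {i′} {I′ : Set i′} {g : I′ → Function} →
                    (∀ k → Generated g (λ x → h x * f k x)) → ∀ {v} → Generated f v → Generated g (λ x → h x * v x)
      generated-* h G (generator k) = G k
      generated-* h G (resp v≈w p)  = resp (λ x → *-congˡ (v≈w x)) (generated-* h G p)
      generated-* h G zero          = resp (λ x → sym (zeroʳ (h x))) zero
      generated-* h G (add {v} {w} p q) = resp (λ x → sym (distribˡ (h x) (v x) (w x))) (add (generated-* h G p) (generated-* h G q))
      generated-* h G (scale y {v} p) = resp (λ x → x∙yz≈y∙xz y (h x) (v x)) (scale y (generated-* h G p))
        where open Algebra.Properties.CommutativeSemigroup *-commutativeSemigroup using (x∙yz≈y∙xz)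

    coefficients : (f : Vector Function n) → ∀ {v} → Generated f v → ∃[ y ] (∀ x → v x ≈ sum (λ k → y k * f k x))
    coefficients f (generator k) = (λ i → δ i k) , λ x →
      sym (trans (sum-cong-≋ λ i → *-comm (δ i k) (f i x)) (sum-δ (λ i → f i x) k))
    coefficients f (resp v≈w p) with coefficients f p
    ... | y , v≈ = y , λ x → trans (sym (v≈w x)) (v≈ x)
    coefficients f zero = (λ _ → 0#) , λ x → sym (sum-zero λ k → zeroˡ (f k x))
    coefficients f (add p q) with coefficients f p | coefficients f q
    ... | y , v≈ | z , w≈ = (λ k → y k + z k) , λ x → trans (+-cong (v≈ x) (w≈ x))
      (sym (trans (sum-cong-≋ λ k → distribʳ (f k x) (y k) (z k)) (∑-distrib-+ (λ k → y k * f k x) (λ k → z k * f k x))))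
    coefficients f (scale z p) with coefficients f p
    ... | y , v≈ = (λ k → z * y k) , λ x → trans (*-congˡ (v≈ x))
      (trans (*-distribˡ-sum z (λ k → y k * f k x)) (sum-cong-≋ λ k → sym (*-assoc z (y k) (f k x))))

  module Steinitz {c ℓ} {q : ℕ} (F : FiniteField c ℓ q) where
    open FiniteField F hiding (zero)
    open FiniteSums commutativeRing
    open Algebra.Properties.Ring ring using (-‿distribˡ-*; -‿distribʳ-*)
    open import Relation.Binary.Reasoning.Setoid setoid

    -- Gaussian elimination by the first row. If that row is zero, it is a relation by itself.
    -- Otherwise its entry in column `l₀` clears this column from the other rows; the recursion
    -- gives a relation between them, and `y₀` is chosen to cancel column `l₀` of the original rows.
    dependent : ∀ m (A : Fin (suc n) → Fin m → Carrier) → m ℕ.≤ n →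
                ∃[ y ] (∃[ k ] y k ≉ 0#) × (∀ l → sum (λ k → y k * A k l) ≈ 0#)
    dependent m A m≤n with Fin.all? (λ l → A zero l ≈? 0#)
    dependent m A m≤n | yes A₀≈0 = (1# ∷ λ _ → 0#) , (zero , 1≉0) , λ l →
      trans (+-cong (trans (*-identityˡ _) (A₀≈0 l)) (sum-zero λ k → zeroˡ (A (suc k) l))) (+-identityʳ 0#)
    dependent m A m≤n | no A₀≉0 with Fin.¬∀⟶∃¬ m _ (λ l → A zero l ≈? 0#) A₀≉0
    dependent {suc n} (suc m) A (s≤s m≤n) | no _ | l₀ , p≉0 with invertible (A zero l₀) p≉0
    ... | p⁻¹ , p⁻¹*p , _ with dependent m (λ k l → A (suc k) (punchIn l₀ l) + - (A (suc k) l₀ * p⁻¹ * A zero (punchIn l₀ l))) m≤n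
    ... | y , (k , yk≉0) , eqs = (y₀ ∷ y) , (suc k , yk≉0) , result
      where
      s = sum (λ k → y k * A (suc k) l₀)
      y₀ = - (s * p⁻¹)
      result : ∀ l → sum (λ k → (y₀ ∷ y) k * A k l) ≈ 0#
      result l with l₀ Fin.≟ l
      ... | yes ≡.refl = begin
        - (s * p⁻¹) * A zero l₀ + s   ≈⟨ +-congʳ (-‿distribˡ-* _ _) ⟨
        - (s * p⁻¹ * A zero l₀) + s   ≈⟨ +-congʳ (-‿cong (trans (*-assoc _ _ _) (trans (*-congˡ p⁻¹*p) (*-identityʳ s)))) ⟩
        - s + s                       ≈⟨ -‿inverseˡ s ⟩
        0#                            ∎
      ... | no l₀≢l = begin
        y₀ * A zero l + S  ≈⟨ +-comm _ _ ⟩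
        S + y₀ * A zero l  ≈⟨ +-congˡ (trans (sym (-‿distribˡ-* (s * p⁻¹) (A zero l))) (-‿cong spread)) ⟩
        S + - sum (λ k → y k * E k)
          ≈⟨ +-congˡ (trans (-1*-sum (λ k → y k * E k)) (sum-cong-≋ {x = λ k → - (y k * E k)} {λ k → y k * - E k} λ k → -‿distribʳ-* (y k) (E k))) ⟩
        S + sum (λ k → y k * - E k)
          ≈⟨ ∑-distrib-+ (λ k → y k * A (suc k) l) (λ k → y k * - E k) ⟨
        sum (λ k → y k * A (suc k) l + y k * - E k)
          ≈⟨ sum-cong-≋ {x = λ k → y k * (A (suc k) l + - E k)} {λ k → y k * A (suc k) l + y k * - E k} (λ k → distribˡ (y k) (A (suc k) l) (- E k)) ⟨
        sum (λ k → y k * (A (suc k) l + - E k))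
          ≈⟨ ≡.subst (λ l → sum (λ k → y k * (A (suc k) l + - (A (suc k) l₀ * p⁻¹ * A zero l))) ≈ 0#)
               (Fin.punchIn-punchOut l₀≢l) (eqs (punchOut l₀≢l)) ⟩
        0# ∎
        where
        S = sum (λ k → y k * A (suc k) l)
        E = λ k → A (suc k) l₀ * p⁻¹ * A zero l
        -1*-sum : ∀ {n} (g : Vector Carrier n) → - sum g ≈ sum (λ k → - g k)
        -1*-sum {zero}  g = Algebra.Properties.Ring.-0#≈0# ring
        -1*-sum {suc n} g = trans (sym (Algebra.Properties.AbelianGroup.⁻¹-∙-comm +-abelianGroup _ _)) (+-congˡ (-1*-sum (g ∘ suc)))
        spread : s * p⁻¹ * A zero l ≈ sum (λ k → y k * E k)
        spread = begin
          s * p⁻¹ * A zero l  ≈⟨ *-assoc s p⁻¹ (A zero l) ⟩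
          s * (p⁻¹ * A zero l) ≈⟨ *-distribʳ-sum (p⁻¹ * A zero l) (λ k → y k * A (suc k) l₀) ⟩
          sum (λ k → y k * A (suc k) l₀ * (p⁻¹ * A zero l))
            ≈⟨ sum-cong-≋ {x = λ k → y k * A (suc k) l₀ * (p⁻¹ * A zero l)} {λ k → y k * E k}
                 (λ k → trans (*-assoc (y k) (A (suc k) l₀) _) (*-congˡ (sym (*-assoc (A (suc k) l₀) p⁻¹ (A zero l))))) ⟩
          sum (λ k → y k * E k) ∎

    module _ {j} {J : Set j} where
      open FunctionSpan commutativeRing J

      -- With more vectors than generators, the coefficient matrix has a relation between its rows,
      -- and this relation passes to the vectors.
      independent-≤ : (v : Vector Function n) (w : Vector Function m) → Independent v →
                      (∀ k → Generated w (v k)) → n ℕ.≤ m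
      independent-≤ {zero}      v w ind gen = z≤n
      independent-≤ {suc n} {m} v w ind gen with suc n ℕ.≤? m
      ... | yes p = p
      ... | no ¬p with dependent m (λ k → proj₁ (coefficients w (gen k))) (ℕ.≤-pred (ℕ.≰⇒> ¬p))
      ...   | y , (k , yk≉0) , eqs = contradiction (ind y vanish k) yk≉0
        where
        A = λ k → proj₁ (coefficients w (gen k))
        vanish : ∀ x → sum (λ k → y k * v k x) ≈ 0#
        vanish x = begin
          sum (λ k → y k * v k x)
            ≈⟨ sum-cong-≋ {x = λ k → y k * v k x} (λ k → *-congˡ (proj₂ (coefficients w (gen k)) x)) ⟩
          sum (λ k → y k * sum (λ l → A k l * w l x))
            ≈⟨ sum-cong-≋ (λ k → trans (*-distribˡ-sum (y k) (λ l → A k l * w l x)) (sum-cong-≋ λ l → sym (*-assoc (y k) (A k l) (w l x)))) ⟩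
          sum (λ k → sum (λ l → y k * A k l * w l x))  ≈⟨ ∑-comm (λ k l → y k * A k l * w l x) ⟩
          sum (λ l → sum (λ k → y k * A k l * w l x))  ≈⟨ sum-cong-≋ {x = λ l → sum (λ k → y k * A k l) * w l x} (λ l → *-distribʳ-sum (w l x) (λ k → y k * A k l)) ⟨
          sum (λ l → sum (λ k → y k * A k l) * w l x)  ≈⟨ sum-zero (λ l → trans (*-congʳ (eqs l)) (zeroˡ (w l x))) ⟩
          0# ∎

  -- Reduced row echelon form over 𝔽₂: the basis restricts to the identity on
  -- the pivot columns, so it stays independent over every extension field.
  module Echelon {j} (J : Set j) where
    open CommutativeRing Bool.xor-∧-commutativeRing hiding (zero)
    open FiniteSums Bool.xor-∧-commutativeRing
    open FunctionSpan Bool.xor-∧-commutativeRing J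

    record Echelon {i} {I : Set i} (A : I → Function) : Set (j ⊔ i) where
      field
        rank      : ℕ
        basis     : Vector Function rank
        column    : Vector J rank
        reduced   : ∀ k l → basis k (column l) ≡ δ k l
        contained : ∀ k → Generated A (basis k)
        spanning  : ∀ i → Generated basis (A i)

    module _ {i} {I : Set i} {A₀ : I → Function}
      (search : ∀ {v} → Generated A₀ v → (∀ x → v x ≡ false) ⊎ ∃[ x ] v x ≡ true) where

      -- A new row is reduced by the pivot columns. If the remainder is not zero, a non-zero entry
      -- of it becomes a pivot column, and clearing that column from the old basis keeps the pivot
      -- block the identity. `J` may be infinite, so finding the entry is left to `search`.
      echelon : (A : Fin m → Function) → (∀ k → Generated A₀ (A k)) → Echelon A
      echelon {zero} A A⊆ = record
        { rank = 0 ; basis = λ () ; column = λ () ; reduced = λ () ; contained = λ () ; spanning = λ () }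
      echelon {suc m} A A⊆ with echelon (A ∘ suc) (A⊆ ∘ suc)
      ... | E = extend (search (generated-trans A⊆ remainder-gen))
        where
        open Echelon E
        combination remainder : Function
        combination x = sum (λ k → A zero (column k) ∧ basis k x)
        remainder x = A zero x xor combination x
        lift : ∀ {v} → Generated (A ∘ suc) v → Generated A v
        lift = generated-trans (λ k → generator (suc k))
        remainder-gen : Generated A remainder
        remainder-gen = add (generator zero) (generated-sum (λ k → A zero (column k)) (λ k → lift (contained k)))
        restore : ∀ x → combination x xor remainder x ≡ A zero x
        restore x = begin
          combination x xor (A zero x xor combination x) ≡⟨ ≡.cong (combination x xor_) (Bool.xor-comm (A zero x) (combination x)) ⟩
          combination x xor (combination x xor A zero x) ≡⟨ Bool.xor-assoc (combination x) _ _ ⟨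
          (combination x xor combination x) xor A zero x ≡⟨ ≡.cong (_xor A zero x) (Bool.xor-same (combination x)) ⟩
          A zero x ∎
          where open ≡.≡-Reasoning
        remainder-column : ∀ l → remainder (column l) ≡ false
        remainder-column l = ≡.trans (≡.cong (A zero (column l) xor_)
          (≡.trans (sum-cong-≋ (λ k → ≡.cong (A zero (column k) ∧_) (reduced k l))) (sum-δ (λ k → A zero (column k)) l)))
          (Bool.xor-same (A zero (column l)))
        combination-gen : Generated basis combination
        combination-gen = generated-sum (λ k → A zero (column k)) generator
        extend : (∀ x → remainder x ≡ false) ⊎ ∃[ x ] remainder x ≡ true → Echelon A
        extend (inj₁ vanishes) = record
          { rank = rank ; basis = basis ; column = column ; reduced = reduced
          ; contained = lift ∘ contained
          ; spanning = λ
            { zero    → resp (λ x → ≡.trans (≡.sym (≡.trans (≡.cong (combination x xor_) (vanishes x)) (Bool.xor-identityʳ _))) (restore x)) combination-gen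
            ; (suc k) → spanning k } }
        extend (inj₂ (x₁ , r≡1)) = record
          { rank = suc rank ; basis = basis′ ; column = x₁ ∷ column ; reduced = reduced′
          ; contained = contained′ ; spanning = spanning′ }
          where
          basis′ : Vector Function (suc rank)
          basis′ = remainder ∷ λ k x → basis k x xor (basis k x₁ ∧ remainder x)
          reduced′ : ∀ k l → basis′ k ((x₁ ∷ column) l) ≡ δ k l
          reduced′ zero    zero    = r≡1
          reduced′ zero    (suc l) = ≡.trans (remainder-column l) (≡.sym (δ-≢ {i = zero} {suc l} λ ()))
          reduced′ (suc k) zero    = ≡.trans (≡.cong (λ b → basis k x₁ xor (basis k x₁ ∧ b)) r≡1)
            (≡.trans (≡.cong (basis k x₁ xor_) (Bool.∧-identityʳ _)) (≡.trans (Bool.xor-same (basis k x₁)) (≡.sym (δ-≢ {i = suc k} {zero} λ ()))))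
          reduced′ (suc k) (suc l) = ≡.trans (≡.cong (λ b → basis k (column l) xor (basis k x₁ ∧ b)) (remainder-column l))
            (≡.trans (≡.cong (basis k (column l) xor_) (Bool.∧-zeroʳ _)) (≡.trans (Bool.xor-identityʳ _) (≡.trans (reduced k l) (δ-suc k l))))
            where
            δ-suc : ∀ {n} (k l : Fin n) → δ k l ≡ δ (suc k) (suc l)
            δ-suc k l with k Fin.≟ l
            ... | yes _ = ≡.refl
            ... | no  _ = ≡.refl
          contained′ : ∀ k → Generated A (basis′ k)
          contained′ zero    = remainder-gen
          contained′ (suc k) = add (lift (contained k)) (scale (basis k x₁) remainder-gen)
          old : ∀ k → Generated basis′ (basis k)
          old k = resp (λ x → ≡.trans (Bool.xor-assoc (basis k x) _ _)
              (≡.trans (≡.cong (basis k x xor_) (Bool.xor-same (basis k x₁ ∧ remainder x))) (Bool.xor-identityʳ _)))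
            (add (generator (suc k)) (scale (basis k x₁) (generator zero)))
          spanning′ : ∀ k → Generated basis′ (A k)
          spanning′ zero    = resp restore (add (generated-trans old combination-gen) (generator zero))
          spanning′ (suc k) = generated-trans old (spanning k)

-- Exponents modulo 2^n - 1 by end-around carry.

module CarryAddition where

  open RowWords
  open import Data.Vec.Base using (Vec; []; _∷_; zip)
  open import Relation.Binary.PropositionalEquality using (refl; sym; trans; cong; cong₂)

  private variable n : ℕ

  add : Vec Digit n → Bool → Vec Bool n × Bool
  add []       h = [] , h
  add (d ∷ ds) h =
    let κ , h′ = addDigit d h
        κs , h″ = add ds h′
    in κ ∷ κs , h″

  anyV : Vec Bool n → Bool
  anyV []      = false
  anyV (b ∷ κ) = b ∨ anyV κ

  eqVec : {A : Set} → (A → A → Bool) → Vec A n → Vec A n → Bool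
  eqVec eq []      []       = true
  eqVec eq (a ∷ w) (b ∷ w′) = eq a b ∧ eqVec eq w w′

  eqVec-sound : {A : Set} {eq : A → A → Bool} → (∀ {a b} → eq a b ≡ true → a ≡ b) →
                (w w′ : Vec A n) → eqVec eq w w′ ≡ true → w ≡ w′
  eqVec-sound f []      []       _ = refl
  eqVec-sound {eq = eq} f (a ∷ w) (b ∷ w′) p with ∧-true {eq a b} p
  ... | p₁ , p₂ = cong₂ _∷_ (f p₁) (eqVec-sound f w w′ p₂)

  eqV : Vec Bool n → Vec Bool n → Bool
  eqV = eqVec eqB

  eqV-sound : (κ κ′ : Vec Bool n) → eqV κ κ′ ≡ true → κ ≡ κ′
  eqV-sound = eqVec-sound eqB-sound

  eqVec-refl : {A : Set} {eq : A → A → Bool} → (∀ a → eq a a ≡ true) → (w : Vec A n) → eqVec eq w w ≡ true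
  eqVec-refl f []      = refl
  eqVec-refl f (a ∷ w) = ∧-intro (f a) (eqVec-refl f w)

  eqVec-sym : {A : Set} {eq : A → A → Bool} → (∀ a b → eq a b ≡ eq b a) →
              (w w′ : Vec A n) → eqVec eq w w′ ≡ eqVec eq w′ w
  eqVec-sym f []      []       = refl
  eqVec-sym f (a ∷ w) (b ∷ w′) = cong₂ _∧_ (f a b) (eqVec-sym f w w′)

  data Exponents : Vec Factor n → Vec Letter n → Vec Digit n → Set where
    []  : Exponents [] [] []
    _∷_ : ∀ {τ w d} {τs : Vec Factor n} {ws ds} → exponent τ w ≡ just d → Exponents τs ws ds →
          Exponents (τ ∷ τs) (w ∷ ws) (d ∷ ds)

  data Incompatible : Vec Factor n → Vec Letter n → Set where
    here  : ∀ {τ w} {τs : Vec Factor n} {ws} → exponent τ w ≡ nothing → Incompatible (τ ∷ τs) (w ∷ ws)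
    there : ∀ {τ w} {τs : Vec Factor n} {ws} → Incompatible τs ws → Incompatible (τ ∷ τs) (w ∷ ws)

  compatible? : (τ : Vec Factor n) (w : Vec Letter n) → Incompatible τ w ⊎ ∃ (Exponents τ w)
  compatible? [] [] = inj₂ ([] , [])
  compatible? (τ ∷ τs) (w ∷ ws) with exponent τ w in eq | compatible? τs ws
  ... | nothing | _              = inj₁ (here eq)
  ... | just d  | inj₁ p         = inj₁ (there p)
  ... | just d  | inj₂ (ds , p) = inj₂ (d ∷ ds , eq ∷ p)

  run-incompatible : {τ : Vec Factor n} {w : Vec Letter n} → Incompatible τ w → ∀ κ h → run (zip τ κ) w h ≡ nothing
  run-incompatible (here eq) (κ ∷ κs) h rewrite eq = refl
  run-incompatible (there {τ = τ} {w} p) (κ ∷ κs) h with step (τ , κ) w h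
  ... | nothing = refl
  ... | just h′ = run-incompatible p κs h′

  run-add : {τ : Vec Factor n} {w : Vec Letter n} {ds : Vec Digit n} → Exponents τ w ds → ∀ κ h →
            run (zip τ κ) w h ≡ (if eqV κ (proj₁ (add ds h)) then just (proj₂ (add ds h)) else nothing)
  run-add [] [] h = refl
  run-add (_∷_ {d = d} eq p) (κ ∷ κs) h rewrite eq with eqB κ (proj₁ (addDigit d h))
  ... | false = refl
  ... | true  = run-add p κs (proj₂ (addDigit d h))

  hasκ-zip : (τ : Vec Factor n) (κ : Vec Bool n) → hasκ (zip τ κ) ≡ anyV κ
  hasκ-zip []      []      = refl
  hasκ-zip (_ ∷ τ) (b ∷ κ) = cong (b ∨_) (hasκ-zip τ κ)

  -- If D is the number with digits `ds`, the hypotheses say D < 2^n ≤ D + 1, so D + 1 = 2^n leaves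
  -- only zeros. This is the run that `hasκ` removes from `occurs`.
  add-critical : (ds : Vec Digit n) → proj₂ (add ds false) ≡ false → proj₂ (add ds true) ≡ true →
                 anyV (proj₁ (add ds true)) ≡ false
  add-critical []        _ _ = refl
  add-critical (0d ∷ ds) p q = contradiction (trans (sym p) q) λ ()
  add-critical (1d ∷ ds) p q = add-critical ds p q
  add-critical (2d ∷ ds) p q = contradiction (trans (sym p) q) λ ()

  -- Here 2^n ≤ D ≤ 2^(n+1) - 2, so D + 1 lies strictly between 2^n and 2^(n+1).
  add-overflow : (ds : Vec Digit n) → proj₂ (add ds false) ≡ true →
                 proj₂ (add ds true) ≡ true × anyV (proj₁ (add ds true)) ≡ true
  add-overflow (0d ∷ ds) p = p , refl
  add-overflow (1d ∷ ds) p = add-overflow ds p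
  add-overflow (2d ∷ ds) p = p , refl

  is-if : ∀ e c b → ((if e then just c else nothing) is b) ≡ e ∧ eqB c b
  is-if true  c b = refl
  is-if false c b = refl

  -- Reduction of the exponent with digits ds modulo 2^n - 1.
  reduce : Vec Digit n → Vec Bool n
  reduce ds = if proj₂ (add ds false) then proj₁ (add ds true) else proj₁ (add ds false)

  occurs-incompatible : {τ : Vec Factor n} {w : Vec Letter n} → Incompatible τ w → ∀ κ → occurs (zip τ κ) w ≡ false
  occurs-incompatible p κ rewrite run-incompatible p κ false | run-incompatible p κ true = refl

  -- The two disjuncts of `occurs` are the additions with initial carry 0 and 1. Without overflow
  -- the first one decides, and a match of the second needs D = 2^n - 1, where `hasκ` rejects it.
  -- With overflow only the second one can match.
  occurs-reduce : {τ : Vec Factor n} {w : Vec Letter n} {ds : Vec Digit n} → Exponents τ w ds → ∀ κ →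
                  occurs (zip τ κ) w ≡ eqV κ (reduce ds)
  occurs-reduce {τ = τ} {w} {ds} p κ
    rewrite run-add p κ false | run-add p κ true | hasκ-zip τ κ
          | is-if (eqV κ (proj₁ (add ds false))) (proj₂ (add ds false)) false
          | is-if (eqV κ (proj₁ (add ds true))) (proj₂ (add ds true)) true
    with proj₂ (add ds false) in eq₀ | proj₂ (add ds true) in eq₁
  ... | false | false = trans (cong₂ _∨_ (Bool.∧-identityʳ _) (cong (_∧ anyV κ) (Bool.∧-zeroʳ (eqV κ _)))) (Bool.∨-identityʳ _)
  ... | false | true  = trans (cong₂ _∨_ (Bool.∧-identityʳ _) second) (Bool.∨-identityʳ _)
    where
    second : (eqV κ (proj₁ (add ds true)) ∧ true) ∧ anyV κ ≡ false
    second with eqV κ (proj₁ (add ds true)) in eq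
    ... | false = refl
    ... | true rewrite eqV-sound κ _ eq = add-critical ds eq₀ eq₁
  ... | true  | false = contradiction (trans (sym eq₁) (proj₁ (add-overflow ds eq₀))) λ ()
  ... | true  | true  = trans (cong (_∨ ((eqV κ (proj₁ (add ds true)) ∧ true) ∧ anyV κ)) (Bool.∧-zeroʳ (eqV κ (proj₁ (add ds false))))) second
    where
    second : (eqV κ (proj₁ (add ds true)) ∧ true) ∧ anyV κ ≡ eqV κ (proj₁ (add ds true))
    second with eqV κ (proj₁ (add ds true)) in eq
    ... | false = refl
    ... | true rewrite eqV-sound κ _ eq = proj₂ (add-overflow ds eq₀)

-- Finite fields of even order and the independence of powers.

module FieldPowers where

  open LinearSpans
  open RowWords using (elements; complete; bool-finite)
  open BasicRows using (wordsOver; ∈-wordsOver)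
  open import Algebra.Bundles using (CommutativeRing)
  import Algebra.Properties.CommutativeMonoid.Mult
  import Algebra.Properties.CommutativeMonoid.Sum
  import Algebra.Properties.CommutativeSemigroup
  import Data.Fin.Permutation as Perm
  open import Data.List.Base as List using (List; []; _∷_; _++_; length; map; cartesianProductWith)
  import Data.List.Properties as List
  import Data.List.Relation.Unary.Any as Any
  import Data.List.Relation.Unary.Any.Properties as Any
  open import Data.Nat.Base using (_^_)
  open import Data.Vec.Base using (Vec; []; _∷_)
  open import Data.Vec.Functional using (Vector; replicate)

  private variable
    a b j : Level
    A : Set
    n : ℕ

  module ListSums {c ℓ} (R : CommutativeRing c ℓ) where
    open CommutativeRing R hiding (zero)
    open import Relation.Binary.Reasoning.Setoid setoid
    private module + = Algebra.Properties.CommutativeSemigroup +-commutativeSemigroup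

    ∑ : List A → (A → Carrier) → Carrier
    ∑ []       f = 0#
    ∑ (x ∷ xs) f = f x + ∑ xs f

    ∑-cong : (xs : List A) {f g : A → Carrier} → (∀ x → f x ≈ g x) → ∑ xs f ≈ ∑ xs g
    ∑-cong []       f≈g = refl
    ∑-cong (x ∷ xs) f≈g = +-cong (f≈g x) (∑-cong xs f≈g)

    ∑-zero : (xs : List A) {f : A → Carrier} → (∀ x → f x ≈ 0#) → ∑ xs f ≈ 0#
    ∑-zero []       f≈0 = refl
    ∑-zero (x ∷ xs) f≈0 = trans (+-cong (f≈0 x) (∑-zero xs f≈0)) (+-identityʳ 0#)

    ∑-+ : (xs : List A) (f g : A → Carrier) → ∑ xs (λ x → f x + g x) ≈ ∑ xs f + ∑ xs g
    ∑-+ []       f g = sym (+-identityʳ 0#)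
    ∑-+ (x ∷ xs) f g = trans (+-congˡ (∑-+ xs f g)) (+.interchange (f x) (g x) (∑ xs f) (∑ xs g))

    *-distribˡ-∑ : ∀ y (xs : List A) (f : A → Carrier) → y * ∑ xs f ≈ ∑ xs (λ x → y * f x)
    *-distribˡ-∑ y []       f = zeroʳ y
    *-distribˡ-∑ y (x ∷ xs) f = trans (distribˡ y (f x) (∑ xs f)) (+-congˡ (*-distribˡ-∑ y xs f))

    *-distribʳ-∑ : ∀ y (xs : List A) (f : A → Carrier) → ∑ xs f * y ≈ ∑ xs (λ x → f x * y)
    *-distribʳ-∑ y xs f = trans (*-comm (∑ xs f) y) (trans (*-distribˡ-∑ y xs f) (∑-cong xs λ x → *-comm y (f x)))

    ∑-comm : ∀ {B : Set} (xs : List A) (ys : List B) (f : A → B → Carrier) →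
             ∑ xs (λ x → ∑ ys (f x)) ≈ ∑ ys (λ y → ∑ xs (λ x → f x y))
    ∑-comm []       ys f = sym (∑-zero ys λ _ → refl)
    ∑-comm (x ∷ xs) ys f = trans (+-congˡ (∑-comm xs ys f)) (sym (∑-+ ys (f x) _))

    ∑-++ : (xs ys : List A) (f : A → Carrier) → ∑ (xs ++ ys) f ≈ ∑ xs f + ∑ ys f
    ∑-++ []       ys f = sym (+-identityˡ _)
    ∑-++ (x ∷ xs) ys f = trans (+-congˡ (∑-++ xs ys f)) (sym (+-assoc (f x) (∑ xs f) (∑ ys f)))

    ∑-map : ∀ {B : Set} (h : A → B) (xs : List A) (f : B → Carrier) → ∑ (map h xs) f ≈ ∑ xs (f ∘ h)
    ∑-map h []       f = refl
    ∑-map h (x ∷ xs) f = +-congˡ (∑-map h xs f)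

    ∑-words : ∀ n (as : List A) (f : Vec A (suc n) → Carrier) →
              ∑ (wordsOver as (suc n)) f ≈ ∑ as (λ a → ∑ (wordsOver as n) (λ w → f (a ∷ w)))
    ∑-words n as f = go as
      where
      go : ∀ bs → ∑ (cartesianProductWith _∷_ bs (wordsOver as n)) f ≈ ∑ bs (λ a → ∑ (wordsOver as n) (λ w → f (a ∷ w)))
      go []       = refl
      go (b ∷ bs) = trans (∑-++ (map (b ∷_) (wordsOver as n)) _ f) (+-cong (∑-map (b ∷_) (wordsOver as n) f) (go bs))

    ∑-lookup : (xs : List A) (f : A → Carrier) → ∑ xs f ≡ FiniteSums.sum R (λ k → f (List.lookup xs k))
    ∑-lookup []       f = ≡.refl
    ∑-lookup (x ∷ xs) f = ≡.cong (f x +_) (∑-lookup xs f)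

    ∑-sum : (xs : List A) {m : ℕ} (f : A → Fin m → Carrier) →
            ∑ xs (λ x → FiniteSums.sum R (f x)) ≈ FiniteSums.sum R (λ k → ∑ xs (λ x → f x k))
    ∑-sum xs {zero}  f = ∑-zero xs λ _ → refl
    ∑-sum xs {suc m} f = trans (∑-+ xs (λ x → f x zero) (λ x → FiniteSums.sum R (f x ∘ suc))) (+-congˡ (∑-sum xs (λ x → f x ∘ suc)))

    -- Products whose s-th factor is taken at the s-th iterate of next.
    module Iterated {s} {S : Set s} (next : S → S) where

      product : (S → Carrier) → ℕ → S → Carrier
      product h zero    s = 1#
      product h (suc n) s = h s * product h n (next s)

      word : (S → A → Carrier) → Vec A n → S → Carrier
      word g []      s = 1#
      word g (a ∷ w) s = g s a * word g w (next s)

      expand : (as : List A) (h : S → Carrier) (g : S → A → Carrier) → (∀ s → h s ≈ ∑ as (g s)) →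
               ∀ n s → product h n s ≈ ∑ (wordsOver as n) (λ w → word g w s)
      expand as h g h≈ zero    s = sym (+-identityʳ 1#)
      expand as h g h≈ (suc n) s = begin
        h s * product h n (next s)  ≈⟨ *-cong (h≈ s) (expand as h g h≈ n (next s)) ⟩
        ∑ as (g s) * W              ≈⟨ *-distribʳ-∑ W as (g s) ⟩
        ∑ as (λ a → g s a * W)      ≈⟨ ∑-cong as (λ a → *-distribˡ-∑ (g s a) (wordsOver as n) _) ⟩
        ∑ as (λ a → ∑ (wordsOver as n) (λ w → g s a * word g w (next s))) ≈⟨ ∑-words n as (λ w → word g w s) ⟨
        ∑ (wordsOver as (suc n)) (λ w → word g w s) ∎
        where W = ∑ (wordsOver as n) (λ w → word g w (next s))

  module ListSpan {c ℓ} (R : CommutativeRing c ℓ) {j} (J : Set j) where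
    open CommutativeRing R hiding (zero)
    open ListSums R
    open FunctionSpan R J

    generated-∑ : ∀ {i} {I : Set i} {f : I → Function} (xs : List A) (y : A → Carrier) {g : A → Function} →
                  (∀ x → Generated f (g x)) → Generated f (λ z → ∑ xs (λ x → y x * g x z))
    generated-∑ []       y G = zero
    generated-∑ (x ∷ xs) y G = add (scale (y x) (G x)) (generated-∑ xs y G)

  module FiniteFieldProperties {c ℓ} {t : ℕ} (1≤t : 1 ≤ t) (F : FiniteField c ℓ (2 ^ t)) where
    open FiniteField F hiding (zero)
    open Inverse enumeration using (to; from; strictlyInverseˡ; strictlyInverseʳ; to-cong)
    open FiniteSums commutativeRing
    open ListSums commutativeRing hiding (∑-comm)
    open import Relation.Binary.Reasoning.Setoid setoid
    open import Algebra.Solver.Ring.NaturalCoefficients.Default commutativeSemiring using (solve; _:=_; _:+_; _:*_; con)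
    private
      q = 2 ^ t
      module Product = Algebra.Properties.CommutativeMonoid.Sum *-commutativeMonoid
      module Power = Algebra.Properties.CommutativeMonoid.Mult *-commutativeMonoid
      module Multiple = Algebra.Properties.CommutativeMonoid.Mult +-commutativeMonoid

    cancel-zero : ∀ {x y} → x ≉ 0# → x * y ≈ 0# → y ≈ 0#
    cancel-zero {x} {y} x≉0 xy≈0 with invertible x x≉0
    ... | x⁻¹ , x⁻¹x≈1 , _ = begin
      y               ≈⟨ *-identityˡ y ⟨
      1# * y          ≈⟨ *-congʳ x⁻¹x≈1 ⟨
      x⁻¹ * x * y     ≈⟨ *-assoc x⁻¹ x y ⟩
      x⁻¹ * (x * y)   ≈⟨ *-congˡ xy≈0 ⟩
      x⁻¹ * 0#        ≈⟨ zeroʳ x⁻¹ ⟩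
      0#              ∎

    *-≉0 : ∀ {x y} → x ≉ 0# → y ≉ 0# → x * y ≉ 0#
    *-≉0 x≉0 y≉0 xy≈0 = y≉0 (cancel-zero x≉0 xy≈0)

    cancel : ∀ {x y z} → x ≉ 0# → x * y ≈ x * z → y ≈ z
    cancel {x} {y} {z} x≉0 xy≈xz with invertible x x≉0
    ... | x⁻¹ , x⁻¹x≈1 , _ = trans (sym (strip y)) (trans (*-congˡ xy≈xz) (strip z))
      where
      strip : ∀ y → x⁻¹ * (x * y) ≈ y
      strip y = trans (sym (*-assoc x⁻¹ x y)) (trans (*-congʳ x⁻¹x≈1) (*-identityˡ y))

    permute : (f g : Carrier → Carrier) → (∀ {x y} → x ≈ y → f x ≈ f y) → (∀ {x y} → x ≈ y → g x ≈ g y) →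
              (∀ x → f (g x) ≈ x) → (∀ x → g (f x) ≈ x) → Perm.Permutation q q
    permute f g f-cong g-cong fg gf = Perm.permutation (λ k → to (f (from k))) (λ k → to (g (from k)))
      (λ k → ≡.trans (to-cong (trans (f-cong (strictlyInverseʳ _)) (fg _))) (strictlyInverseˡ k))
      (λ k → ≡.trans (to-cong (trans (g-cong (strictlyInverseʳ _)) (gf _))) (strictlyInverseˡ k))

    -- Translation by 1 permutes the field, so the sum of its elements does not
    -- change when q · 1 is added.
    q·1≈0 : q Multiple.× 1# ≈ 0#
    q·1≈0 = begin
      q Multiple.× 1#                ≈⟨ sum-replicate q ⟨
      sum (replicate q 1#)           ≈⟨ +-identityˡ _ ⟨
      0# + sum (replicate q 1#)      ≈⟨ +-congʳ (-‿inverseˡ total) ⟨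
      - total + total + sum (replicate q 1#)    ≈⟨ +-assoc _ _ _ ⟩
      - total + (total + sum (replicate q 1#))  ≈⟨ +-congˡ (∑-distrib-+ from (λ _ → 1#)) ⟨
      - total + sum (λ k → from k + 1#)         ≈⟨ +-congˡ (sum-cong-≋ λ k → strictlyInverseʳ (from k + 1#)) ⟨
      - total + sum (λ k → from (to (from k + 1#)))  ≈⟨ +-congˡ (sum-permute from π) ⟨
      - total + total                ≈⟨ -‿inverseˡ total ⟩
      0# ∎
      where
      total = sum from
      π = permute (_+ 1#) (_+ - 1#) +-congʳ +-congʳ
        (λ x → trans (+-assoc x _ _) (trans (+-congˡ (-‿inverseˡ 1#)) (+-identityʳ x)))
        (λ x → trans (+-assoc x _ _) (trans (+-congˡ (-‿inverseʳ 1#)) (+-identityʳ x)))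

    2^n·1 : ∀ n → 1# + 1# ≉ 0# → (2 ^ n) Multiple.× 1# ≉ 0#
    2^n·1 zero    2≉0 eq = 1≉0 (trans (sym (+-identityʳ 1#)) eq)
    2^n·1 (suc n) 2≉0 eq = *-≉0 (2^n·1 n 2≉0) 2≉0 (begin
      m * (1# + 1#)  ≈⟨ distribˡ m 1# 1# ⟩
      m * 1# + m * 1# ≈⟨ +-cong (*-identityʳ m) (trans (*-identityʳ m) (sym (trans (Multiple.×-homo-+ 1# (2 ^ n) 0) (+-identityʳ m)))) ⟩
      m + (2 ^ n ℕ.+ 0) Multiple.× 1#  ≈⟨ Multiple.×-homo-+ 1# (2 ^ n) (2 ^ n ℕ.+ 0) ⟨
      (2 ^ suc n) Multiple.× 1#  ≈⟨ eq ⟩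
      0# ∎)
      where m = (2 ^ n) Multiple.× 1#

    -- If 2 were not zero in the field, no power of 2 would be, against `q·1≈0`.
    1+1≈0 : 1# + 1# ≈ 0#
    1+1≈0 with (1# + 1#) ≈? 0#
    ... | yes eq = eq
    ... | no  ne = contradiction q·1≈0 (2^n·1 t ne)

    x+x≈0 : ∀ x → x + x ≈ 0#
    x+x≈0 x = trans (+-cong (sym (*-identityʳ x)) (sym (*-identityʳ x)))
      (trans (sym (distribˡ x 1# 1#)) (trans (*-congˡ 1+1≈0) (zeroʳ x)))

    sum-zero⇒≈ : ∀ {x y} → x + y ≈ 0# → x ≈ y
    sum-zero⇒≈ {x} {y} eq = begin
      x           ≈⟨ +-identityʳ x ⟨
      x + 0#      ≈⟨ +-congˡ (x+x≈0 y) ⟨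
      x + (y + y) ≈⟨ +-assoc x y y ⟨
      x + y + y   ≈⟨ +-congʳ eq ⟩
      0# + y      ≈⟨ +-identityˡ y ⟩
      y           ∎

    ≈⇒sum-zero : ∀ {x y} → x ≈ y → x + y ≈ 0#
    ≈⇒sum-zero {x} {y} eq = trans (+-congʳ eq) (x+x≈0 y)

    square-+ : ∀ x y → (x + y) * (x + y) ≈ x * x + y * y
    square-+ x y = begin
      (x + y) * (x + y)                   ≈⟨ solve 2 (λ x y → (x :+ y) :* (x :+ y) := (x :* x :+ y :* y) :+ (x :* y :+ x :* y)) refl x y ⟩
      (x * x + y * y) + (x * y + x * y)   ≈⟨ +-congˡ (x+x≈0 (x * y)) ⟩
      (x * x + y * y) + 0#                ≈⟨ +-identityʳ _ ⟩
      x * x + y * y                       ∎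

    frobenius : ℕ → Carrier → Carrier
    frobenius zero    x = x
    frobenius (suc n) x = frobenius n (x * x)

    frobenius-power : ∀ n x → (2 ^ n) Power.× x ≈ frobenius n x
    frobenius-power zero    x = *-identityʳ x
    frobenius-power (suc n) x = begin
      (2 ^ n ℕ.+ (2 ^ n ℕ.+ 0)) Power.× x        ≈⟨ Power.×-homo-+ x (2 ^ n) (2 ^ n ℕ.+ 0) ⟩
      (2 ^ n) Power.× x * (2 ^ n ℕ.+ 0) Power.× x ≈⟨ *-congˡ (trans (Power.×-homo-+ x (2 ^ n) 0) (*-identityʳ _)) ⟩
      (2 ^ n) Power.× x * (2 ^ n) Power.× x       ≈⟨ Power.×-distrib-+ x x (2 ^ n) ⟨
      (2 ^ n) Power.× (x * x)                     ≈⟨ frobenius-power n (x * x) ⟩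
      frobenius n (x * x)                         ∎

    unit : Carrier → Carrier → Carrier
    unit d x with x ≈? 0#
    ... | yes _ = 1#
    ... | no  _ = d

    unit-yes : ∀ {d x} → x ≈ 0# → unit d x ≈ 1#
    unit-yes {d} {x} x≈0 with x ≈? 0#
    ... | yes _ = refl
    ... | no ne = contradiction x≈0 ne

    unit-no : ∀ {d x} → x ≉ 0# → unit d x ≈ d
    unit-no {d} {x} x≉0 with x ≈? 0#
    ... | yes eq = contradiction eq x≉0
    ... | no _ = refl

    product-≉0 : ∀ {n} (g : Vector Carrier n) → (∀ k → g k ≉ 0#) → Product.sum g ≉ 0#
    product-≉0 {zero}  g g≉0 = 1≉0
    product-≉0 {suc n} g g≉0 = *-≉0 (g≉0 zero) (product-≉0 (g ∘ suc) (g≉0 ∘ suc))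

    product-single : ∀ {n} (g : Vector Carrier n) k → (∀ i → i ≢ k → g i ≈ 1#) → Product.sum g ≈ g k
    product-single {suc n} g zero g≈1 = trans (*-congˡ (trans (Product.sum-cong-≋ λ i → g≈1 (suc i) λ ()) (Product.sum-replicate-zero n))) (*-identityʳ _)
    product-single g (suc k) g≈1 = trans (*-cong (g≈1 zero λ ()) (product-single (g ∘ suc) k λ i i≢k → g≈1 (suc i) (i≢k ∘ Fin.suc-injective)))
      (*-identityˡ _)

    -- Multiplication by x permutes the field, so the product of x over the
    -- non-zero elements is 1; the zero element contributes the last factor x.
    fermat-≉0 : ∀ x → x ≉ 0# → frobenius t x ≈ x
    fermat-≉0 x x≉0 with invertible x x≉0
    ... | x⁻¹ , x⁻¹x≈1 , xx⁻¹≈1 = begin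
      frobenius t x                             ≈⟨ frobenius-power t x ⟨
      q Power.× x                               ≈⟨ Product.sum-replicate q ⟨
      Product.sum (replicate q x)               ≈⟨ Product.sum-cong-≋ split ⟨
      Product.sum (λ k → h k * e k)             ≈⟨ Product.∑-distrib-+ h e ⟩
      Product.sum h * Product.sum e             ≈⟨ *-cong ∏h≈1 ∏e≈x ⟩
      1# * x                                    ≈⟨ *-identityˡ x ⟩
      x                                         ∎
      where
      g h e : Fin q → Carrier
      g k = unit (from k) (from k)
      h k = unit x (from k)
      e k with from k ≈? 0#
      ... | yes _ = x
      ... | no  _ = 1#
      split : ∀ k → h k * e k ≈ x
      split k with from k ≈? 0#
      ... | yes _ = *-identityˡ x
      ... | no  _ = *-identityʳ x
      e-zero : e (to 0#) ≈ x
      e-zero with from (to 0#) ≈? 0#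
      ... | yes _ = refl
      ... | no ne = contradiction (strictlyInverseʳ 0#) ne
      e-other : ∀ k → k ≢ to 0# → e k ≈ 1#
      e-other k k≢0 with from k ≈? 0#
      ... | yes eq = contradiction (≡.trans (≡.sym (strictlyInverseˡ k)) (to-cong eq)) k≢0
      ... | no _ = refl
      ∏e≈x : Product.sum e ≈ x
      ∏e≈x = trans (product-single e (to 0#) e-other) e-zero
      π = permute (x *_) (x⁻¹ *_) *-congˡ *-congˡ
        (λ y → trans (sym (*-assoc x x⁻¹ y)) (trans (*-congʳ xx⁻¹≈1) (*-identityˡ y)))
        (λ y → trans (sym (*-assoc x⁻¹ x y)) (trans (*-congʳ x⁻¹x≈1) (*-identityˡ y)))
      g-scale : ∀ k → g (to (x * from k)) ≈ g k * h k
      g-scale k with from k ≈? 0#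
      ... | yes eq = trans (unit-yes (trans (strictlyInverseʳ _) (trans (*-congˡ eq) (zeroʳ x)))) (sym (*-identityʳ 1#))
      ... | no  ne = trans (unit-no (λ eq → *-≉0 x≉0 ne (trans (sym (strictlyInverseʳ _)) eq)))
                       (trans (strictlyInverseʳ (x * from k)) (*-comm x (from k)))
      g≉0 : ∀ k → g k ≉ 0#
      g≉0 k with from k ≈? 0#
      ... | yes _ = 1≉0
      ... | no ne = ne
      ∏h≈1 : Product.sum h ≈ 1#
      ∏h≈1 = cancel (product-≉0 g g≉0) (begin
        Product.sum g * Product.sum h          ≈⟨ Product.∑-distrib-+ g h ⟨
        Product.sum (λ k → g k * h k)          ≈⟨ Product.sum-cong-≋ g-scale ⟨
        Product.sum (λ k → g (to (x * from k))) ≈⟨ Product.sum-permute g π ⟨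
        Product.sum g                          ≈⟨ *-identityʳ _ ⟨
        Product.sum g * 1#                     ∎)

    frobenius-cong : ∀ n {x y} → x ≈ y → frobenius n x ≈ frobenius n y
    frobenius-cong zero    x≈y = x≈y
    frobenius-cong (suc n) x≈y = frobenius-cong n (*-cong x≈y x≈y)

    frobenius-0 : ∀ n → frobenius n 0# ≈ 0#
    frobenius-0 zero    = refl
    frobenius-0 (suc n) = trans (frobenius-cong n (zeroˡ 0#)) (frobenius-0 n)

    fermat : ∀ x → frobenius t x ≈ x
    fermat x with x ≈? 0#
    ... | yes eq = trans (frobenius-cong t eq) (trans (frobenius-0 t) (sym eq))
    ... | no  ne = fermat-≉0 x ne

    square : Carrier → Carrier
    square x = x * x

    -- norm n x = x^(2^n - 1).
    norm : ℕ → Carrier → Carrier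
    norm = Iterated.product square λ x → x

    norm-cong : ∀ n {x y} → x ≈ y → norm n x ≈ norm n y
    norm-cong zero    x≈y = refl
    norm-cong (suc n) x≈y = *-cong x≈y (norm-cong n (*-cong x≈y x≈y))

    *-norm : ∀ n x → x * norm n x ≈ frobenius n x
    *-norm zero    x = *-identityʳ x
    *-norm (suc n) x = trans (sym (*-assoc x x _)) (*-norm n (x * x))

    norm-≉0 : ∀ {x} → x ≉ 0# → norm t x ≈ 1#
    norm-≉0 {x} x≉0 = cancel x≉0 (trans (*-norm t x) (trans (fermat x) (sym (*-identityʳ x))))

    -- This relies on `1 ≤ t`: the empty product `norm 0` is 1 even at 0.
    norm-≈0 : ∀ {x} → x ≈ 0# → norm t x ≈ 0#
    norm-≈0 {x} = go 1≤t
      where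
      go : ∀ {n} → 1 ≤ n → x ≈ 0# → norm n x ≈ 0#
      go (s≤s _) x≈0 = trans (*-congʳ x≈0) (zeroˡ _)

    bits : List Bool
    bits = elements

    exponents : ∀ n → List (Vec Bool n)
    exponents = wordsOver bits

    raise : Carrier → Bool → Carrier
    raise x b = if b then x else 1#

    power : Vec Bool n → Carrier → Carrier
    power κ x = Iterated.word square raise κ x

    power-cong : ∀ (κ : Vec Bool n) {x y} → x ≈ y → power κ x ≈ power κ y
    power-cong []          x≈y = refl
    power-cong (true  ∷ κ) x≈y = *-cong x≈y (power-cong κ (*-cong x≈y x≈y))
    power-cong (false ∷ κ) x≈y = *-congˡ (power-cong κ (*-cong x≈y x≈y))

    copower : Vec Bool n → Carrier → Carrier
    copower κ x = Iterated.word square (λ x b → raise x (if b then false else true)) κ x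

    -- All binomial coefficients of exponent 2^n - 1 are odd, because the power is the product of
    -- the sums x^(2^s) + y^(2^s).
    norm-+ : ∀ n x y → norm n (x + y) ≈ ∑ (exponents n) (λ κ → copower κ y * power κ x)
    norm-+ zero    x y = sym (trans (+-identityʳ _) (*-identityˡ 1#))
    norm-+ (suc n) x y = begin
      (x + y) * norm n ((x + y) * (x + y))
        ≈⟨ *-congˡ (trans (norm-cong n (square-+ x y)) (norm-+ n (x * x) (y * y))) ⟩
      (x + y) * S
        ≈⟨ solve 3 (λ x y s → (x :+ y) :* s := y :* s :+ (x :* s :+ con 0)) refl x y S ⟩
      y * S + (x * S + 0#)
        ≈⟨ +-cong (trans (*-distribˡ-∑ y (exponents n) _) (∑-cong (exponents n) λ κ →
               solve 3 (λ y c p → y :* (c :* p) := (y :* c) :* (con 1 :* p)) refl y (copower κ (y * y)) (power κ (x * x))))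
             (+-congʳ (trans (*-distribˡ-∑ x (exponents n) _) (∑-cong (exponents n) λ κ →
               solve 3 (λ x c p → x :* (c :* p) := (con 1 :* c) :* (x :* p)) refl x (copower κ (y * y)) (power κ (x * x))))) ⟩
      ∑ bits (λ b → ∑ (exponents n) (λ κ → copower (b ∷ κ) y * power (b ∷ κ) x)) ≈⟨ ∑-words n bits (λ κ → copower κ y * power κ x) ⟨
      ∑ (exponents (suc n)) (λ κ → copower κ y * power κ x) ∎
      where S = ∑ (exponents n) (λ κ → copower κ (y * y) * power κ (x * x))

    module Independence where
      open FunctionSpan commutativeRing (Fin q)
      open ListSpan commutativeRing (Fin q)
      open Steinitz F using (independent-≤)

      powers : Vec Bool t → Function
      powers κ k = power κ (from k)

      index-powers : Fin (length (exponents t)) → Function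
      index-powers = powers ∘ List.lookup (exponents t)

      δ-functions : Fin q → Function
      δ-functions x k = δ x k

      δ-independent : Independent δ-functions
      δ-independent y eq k = trans (sym (sum-δ y k)) (eq k)

      zeros : ∀ n → Vec Bool n
      zeros zero    = []
      zeros (suc n) = false ∷ zeros n

      power-zeros : ∀ n x → power (zeros n) x ≈ 1#
      power-zeros zero    x = refl
      power-zeros (suc n) x = trans (*-identityˡ _) (power-zeros n (x * x))

      listed : ∀ κ → Generated index-powers (powers κ)
      listed κ = ≡.subst (Generated index-powers ∘ powers) (≡.sym (Any.lookup-index κ∈)) (generator (Any.index κ∈))
        where κ∈ = ∈-wordsOver complete κ

      -- By Fermat's theorem 1 + (x + y)^(q-1) is the indicator of x = y, and `norm-+` expands it in
      -- powers of one variable.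
      δ-generated : ∀ x → Generated index-powers (δ-functions x)
      δ-generated x = resp indicator (add (listed (zeros t))
        (generated-∑ (exponents t) (λ κ → copower κ (from x)) {powers} listed))
        where
        indicator : ∀ k → power (zeros t) (from k) + ∑ (exponents t) (λ κ → copower κ (from x) * power κ (from k)) ≈ δ x k
        indicator k = trans (+-cong (power-zeros t (from k)) (sym (norm-+ t (from k) (from x)))) (value k)
          where
          value : ∀ k → 1# + norm t (from k + from x) ≈ δ x k
          value k with x Fin.≟ k
          ... | yes ≡.refl = trans (+-congˡ (norm-≈0 (x+x≈0 _))) (+-identityʳ 1#)
          ... | no x≢k = trans (+-congˡ (norm-≉0 λ eq → x≢k (≡.sym (≡.trans (≡.sym (strictlyInverseˡ k))
                (≡.trans (to-cong (sum-zero⇒≈ eq)) (strictlyInverseˡ x)))))) 1+1≈0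

      -- A spanning family of at most q functions is independent: a dependent one
      -- would span with fewer than q members.
      spanning⇒independent : ∀ {m} (v : Vector Function m) → m ≤ q → (∀ x → Generated v (δ-functions x)) → Independent v
      spanning⇒independent {suc m} v m<q spans y eq k with y k ≈? 0#
      ... | yes p = p
      ... | no yk≉0 = contradiction (independent-≤ δ-functions (v ∘ punchIn k) δ-independent
                        (λ x → generated-trans rest (spans x))) (ℕ.<⇒≱ m<q)
        where
        y⁻¹ = proj₁ (invertible (y k) yk≉0)
        vk : ∀ x → y k * v k x ≈ sum (λ i → y (punchIn k i) * v (punchIn k i) x)
        vk x = sum-zero⇒≈ (trans (sym (sum-remove {i = k} (λ i → y i * v i x))) (eq x))
        rest : ∀ i → Generated (v ∘ punchIn k) (v i)
        rest i with k Fin.≟ i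
        ... | no k≢i = ≡.subst (Generated (v ∘ punchIn k) ∘ v) (Fin.punchIn-punchOut k≢i) (generator (Fin.punchOut k≢i))
        ... | yes ≡.refl = resp (λ x → trans (*-congˡ (sym (vk x))) (trans (sym (*-assoc y⁻¹ (y k) (v k x)))
              (trans (*-congʳ (proj₁ (proj₂ (invertible (y k) yk≉0)))) (*-identityˡ _))))
            (scale y⁻¹ (generated-sum (y ∘ punchIn k) {v ∘ punchIn k} generator))

      length-exponents : ∀ n → length (exponents n) ≡ 2 ^ n
      length-exponents zero    = ≡.refl
      length-exponents (suc n) = ≡.trans (List.length-++ (map (false ∷_) (exponents n)))
        (≡.cong₂ ℕ._+_ (≡.trans (List.length-map (false ∷_) (exponents n)) (length-exponents n))
          (≡.trans (List.length-++ (map (true ∷_) (exponents n)))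
            (≡.cong₂ ℕ._+_ (≡.trans (List.length-map (true ∷_) (exponents n)) (length-exponents n)) ≡.refl)))

      -- There are q powers, and they span the q-dimensional space of all functions on `F`.
      powers-independent : (y : Vec Bool t → Carrier) → (∀ x → ∑ (exponents t) (λ κ → y κ * power κ x) ≈ 0#) → ∀ κ → y κ ≈ 0#
      powers-independent y eq κ = ≡.subst (λ κ → y κ ≈ 0#) (≡.sym (Any.lookup-index κ∈))
        (spanning⇒independent index-powers (ℕ.≤-reflexive (length-exponents t)) δ-generated
          (y ∘ List.lookup (exponents t))
          (λ k → trans (reflexive (≡.sym (∑-lookup (exponents t) (λ κ → y κ * power κ (from k))))) (eq (from k)))
          (Any.index κ∈))
        where κ∈ = ∈-wordsOver complete κ

    open Independence public using (powers-independent; zeros; power-zeros)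

-- The functions of a line spanned by points, products, rows and words.

module LineFunctions where

  open LinearSpans
  open FieldPowers
  open RowWords
  open CarryAddition
  open BasicRows
  import Algebra.Properties.CommutativeSemigroup
  open import Data.List.Base as List using (List; []; _∷_; length)
  open import Data.Nat.Base using (_^_)
  open import Data.Nat.Induction using (<-wellFounded)
  open import Data.Vec.Base as Vec using (Vec; []; _∷_; zip)
  import Data.Vec.Properties as Vec
  open import Induction.WellFounded using (Acc; acc)

  private variable
    A : Set
    n : ℕ

  letters : List Letter
  letters = elements

  eqL : Letter → Letter → Bool
  eqL 𝟙 𝟙 = true
  eqL X X = true
  eqL Y Y = true
  eqL Z Z = true
  eqL P P = true
  eqL N N = true
  eqL Q Q = true
  eqL _ _ = false

  eqL-sound : ∀ {a b} → eqL a b ≡ true → a ≡ b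
  eqL-sound {𝟙} {𝟙} _ = ≡.refl
  eqL-sound {X} {X} _ = ≡.refl
  eqL-sound {Y} {Y} _ = ≡.refl
  eqL-sound {Z} {Z} _ = ≡.refl
  eqL-sound {P} {P} _ = ≡.refl
  eqL-sound {N} {N} _ = ≡.refl
  eqL-sound {Q} {Q} _ = ≡.refl

  eqW : Vec Letter n → Vec Letter n → Bool
  eqW = eqVec eqL

  eqW-sound : (w w′ : Vec Letter n) → eqW w w′ ≡ true → w ≡ w′
  eqW-sound = eqVec-sound eqL-sound

  eqW-refl : (w : Vec Letter n) → eqW w w ≡ true
  eqW-refl = eqVec-refl (sound (λ a → eqL a a) ≡.refl)

  hasX hasY hasZ isN : Letter → Bool
  hasX X = true
  hasX P = true
  hasX Q = true
  hasX _ = false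
  hasY Y = true
  hasY P = true
  hasY N = true
  hasY _ = false
  hasZ Z = true
  hasZ Q = true
  hasZ N = true
  hasZ _ = false
  isN N = true
  isN _ = false

  -- Induction measure for the independence of words. The second monomial x² of `N` can interfere
  -- only opposite a letter other than `N`, so a word interfering through it has fewer such letters.
  nonN : Vec Letter n → ℕ
  nonN []      = 0
  nonN (a ∷ w) = (if isN a then 0 else 1) ℕ.+ nonN w

  matches : Letter → Bool → Bool → Bool
  matches a j k = eqB j (hasY a) ∧ eqB k (hasZ a)

  nonN-head : ∀ {a b} {w w₀ : Vec Letter n} → isN a ≡ true → isN b ≡ false → nonN w ≤ nonN w₀ →
              nonN (a ∷ w) < nonN (b ∷ w₀)
  nonN-head p q le rewrite p | q = s≤s le

  combine : Bool → Bool → Factor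
  combine false false = one
  combine true  false = ξ
  combine false true  = η
  combine true  true  = ξη

  module WordFunctions {c ℓ} {t : ℕ} (1≤t : 1 ≤ t) (F : FiniteField c ℓ (2 ^ t)) where
    open FiniteField F hiding (zero)
    open Inverse enumeration using (to; from; strictlyInverseˡ; strictlyInverseʳ; to-cong)
    open FiniteSums commutativeRing
    open ListSums commutativeRing renaming (∑-comm to ∑-swap)
    open FiniteFieldProperties 1≤t F
    open import Relation.Binary.Reasoning.Setoid setoid
    open import Algebra.Solver.Ring.NaturalCoefficients.Default commutativeSemiring using (Polynomial; solve; _:=_; _:+_; _:*_; con)
    open Algebra.Properties.CommutativeSemigroup *-commutativeSemigroup using (x∙yz≈y∙xz)

    ⟦_⟧ : Bool → Carrier
    ⟦ true ⟧  = 1#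
    ⟦ false ⟧ = 0#

    ⟦∧⟧ : ∀ a b → ⟦ a ∧ b ⟧ ≈ ⟦ a ⟧ * ⟦ b ⟧
    ⟦∧⟧ true  b = sym (*-identityˡ _)
    ⟦∧⟧ false b = sym (zeroˡ _)

    -- The functions on Carrier³ below are functions of a line [α, β, γ], with
    -- X = α, Y = β and Z = γ.
    Triple : Set c
    Triple = Carrier × Carrier × Carrier

    infix 4 _≈³_
    record _≈³_ (x y : Triple) : Set ℓ where
      constructor [_,_,_]
      field
        first  : proj₁ x ≈ proj₁ y
        second : proj₁ (proj₂ x) ≈ proj₁ (proj₂ y)
        third  : proj₂ (proj₂ x) ≈ proj₂ (proj₂ y)

    squares : Triple → Triple
    squares (x , y , z) = square x , square y , square z

    letterValue : Triple → Letter → Carrier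
    letterValue (x , y , z) 𝟙 = 1#
    letterValue (x , y , z) X = x
    letterValue (x , y , z) Y = y
    letterValue (x , y , z) Z = z
    letterValue (x , y , z) P = x * y
    letterValue (x , y , z) N = x * x + y * z
    letterValue (x , y , z) Q = x * z

    wordValue : Vec Letter n → Triple → Carrier
    wordValue = Iterated.word squares letterValue

    form₁ form₂ : Carrier → Triple → Carrier
    form₁ c (x , y , z) = x + c * z
    form₂ c (x , y , z) = y + c * x

    factorValue : Carrier → Triple → Factor → Carrier
    factorValue c l one = 1#
    factorValue c l ξ   = form₁ c l
    factorValue c l η   = form₂ c l
    factorValue c l ξη  = form₁ c l * form₂ c l

    product : Vec Factor n → Carrier → Triple → Carrier
    product []      c l = 1#
    product (τ ∷ τs) c l = factorValue c l τ * product τs (square c) (squares l)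

    digitPower : Carrier → Digit → Carrier
    digitPower c 0d = 1#
    digitPower c 1d = c
    digitPower c 2d = c * c

    coefficient : Carrier → Factor → Letter → Carrier
    coefficient c τ w with exponent τ w
    ... | just d  = digitPower c d
    ... | nothing = 0#

    coefficients-word : Vec Factor n → Vec Letter n → Carrier → Carrier
    coefficients-word []       []       c = 1#
    coefficients-word (τ ∷ τs) (w ∷ ws) c = coefficient c τ w * coefficients-word τs ws (square c)

    factor-expand : ∀ c l τ → factorValue c l τ ≈ ∑ letters (λ w → coefficient c τ w * letterValue l w)
    factor-expand c (x , y , z) one = solve 3 (λ x y z → con 1 := con 1 :* con 1 :+ (con 0 :* x :+ (con 0 :* y :+ (con 0 :* z :+
      (con 0 :* (x :* y) :+ (con 0 :* (x :* x :+ y :* z) :+ (con 0 :* (x :* z) :+ con 0))))))) refl x y z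
    factor-expand c (x , y , z) ξ = solve 4 (λ c x y z → x :+ c :* z := con 0 :* con 1 :+ (con 1 :* x :+ (con 0 :* y :+ (c :* z :+
      (con 0 :* (x :* y) :+ (con 0 :* (x :* x :+ y :* z) :+ (con 0 :* (x :* z) :+ con 0))))))) refl c x y z
    factor-expand c (x , y , z) η = solve 4 (λ c x y z → y :+ c :* x := con 0 :* con 1 :+ (c :* x :+ (con 1 :* y :+ (con 0 :* z :+
      (con 0 :* (x :* y) :+ (con 0 :* (x :* x :+ y :* z) :+ (con 0 :* (x :* z) :+ con 0))))))) refl c x y z
    factor-expand c (x , y , z) ξη = solve 4 (λ c x y z → (x :+ c :* z) :* (y :+ c :* x) := con 0 :* con 1 :+ (con 0 :* x :+ (con 0 :* y :+ (con 0 :* z :+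
      (con 1 :* (x :* y) :+ (c :* (x :* x :+ y :* z) :+ ((c :* c) :* (x :* z) :+ con 0))))))) refl c x y z

    words : ∀ n → List (Vec Letter n)
    words = wordsOver letters

    product-expand : ∀ (τ : Vec Factor n) c l → product τ c l ≈ ∑ (words n) (λ w → coefficients-word τ w c * wordValue w l)
    product-expand []                c l = sym (trans (+-identityʳ _) (*-identityʳ 1#))
    product-expand {suc n} (τ ∷ τs) c l = begin
      factorValue c l τ * product τs (square c) (squares l)
        ≈⟨ *-cong (factor-expand c l τ) (product-expand τs (square c) (squares l)) ⟩
      ∑ letters g * S   ≈⟨ *-distribʳ-∑ S letters g ⟩
      ∑ letters (λ a → g a * S) ≈⟨ ∑-cong letters (λ a → trans (*-distribˡ-∑ (g a) (words n) h) (∑-cong (words n) λ w →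
          solve 4 (λ a b c d → (a :* b) :* (c :* d) := (a :* c) :* (b :* d)) refl (coefficient c τ a) (letterValue l a)
            (coefficients-word τs w (square c)) (wordValue w (squares l)))) ⟩
      ∑ letters (λ a → ∑ (words n) (λ w → coefficients-word (τ ∷ τs) (a ∷ w) c * wordValue (a ∷ w) l))
        ≈⟨ ∑-words n letters (λ w → coefficients-word (τ ∷ τs) w c * wordValue w l) ⟨
      ∑ (words (suc n)) (λ w → coefficients-word (τ ∷ τs) w c * wordValue w l) ∎
      where
      g = λ a → coefficient c τ a * letterValue l a
      h = λ w → coefficients-word τs w (square c) * wordValue w (squares l)
      S = ∑ (words n) h

    digitsPower : Vec Digit n → Carrier → Carrier
    digitsPower []       c = 1#
    digitsPower (d ∷ ds) c = digitPower c d * digitsPower ds (square c)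

    coefficients-compatible : {τ : Vec Factor n} {w : Vec Letter n} {ds : Vec Digit n} → Exponents τ w ds →
                              ∀ c → coefficients-word τ w c ≈ digitsPower ds c
    coefficients-compatible [] c = refl
    coefficients-compatible (_∷_ {τ = τ} {w} {d} eq p) c = *-cong head (coefficients-compatible p (square c))
      where
      head : coefficient c τ w ≈ digitPower c d
      head with exponent τ w
      head | just d′ with ≡.refl ← just-inj eq = refl
      head | nothing = contradiction eq λ ()

    coefficients-incompatible : {τ : Vec Factor n} {w : Vec Letter n} → Incompatible τ w → ∀ c → coefficients-word τ w c ≈ 0#
    coefficients-incompatible (here {τ = τ} {w} eq) c = trans (*-congʳ head) (zeroˡ _)
      where
      head : coefficient c τ w ≈ 0#
      head with exponent τ w
      head | nothing = refl
      head | just d′ = contradiction eq λ ()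
    coefficients-incompatible (there p) c = trans (*-congˡ (coefficients-incompatible p (square c))) (zeroʳ _)

    addDigit-power : ∀ c d h → digitPower c d * raise c h ≈ raise c (proj₁ (addDigit d h)) * raise (square c) (proj₂ (addDigit d h))
    addDigit-power c 0d h     = *-comm 1# (raise c h)
    addDigit-power c 1d false = refl
    addDigit-power c 1d true  = sym (*-identityˡ _)
    addDigit-power c 2d h     = *-comm (c * c) (raise c h)

    -- A carry out of the last of the `n` places is worth c^(2^n).
    add-power : ∀ (ds : Vec Digit n) h c → digitsPower ds c * raise c h ≈
                power (proj₁ (add ds h)) c * raise (frobenius n c) (proj₂ (add ds h))
    add-power []       h c = refl
    add-power (d ∷ ds) h c = begin
      digitPower c d * D * raise c h           ≈⟨ solve 3 (λ a b c → a :* b :* c := (a :* c) :* b) refl (digitPower c d) D (raise c h) ⟩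
      digitPower c d * raise c h * D           ≈⟨ *-congʳ (addDigit-power c d h) ⟩
      raise c κ * raise (square c) h′ * D      ≈⟨ solve 3 (λ a b c → a :* b :* c := a :* (c :* b)) refl (raise c κ) (raise (square c) h′) D ⟩
      raise c κ * (D * raise (square c) h′)    ≈⟨ *-congˡ (add-power ds h′ (square c)) ⟩
      raise c κ * (power (proj₁ (add ds h′)) (square c) * _)  ≈⟨ *-assoc (raise c κ) _ _ ⟨
      raise c κ * power (proj₁ (add ds h′)) (square c) * _    ∎
      where
      D = digitsPower ds (square c)
      κ = proj₁ (addDigit d h)
      h′ = proj₂ (addDigit d h)

    power-any : ∀ (κ : Vec Bool n) {c} → c ≈ 0# → anyV κ ≡ true → power κ c ≈ 0#
    power-any (true  ∷ κ) c≈0 _ = trans (*-congʳ c≈0) (zeroˡ _)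
    power-any (false ∷ κ) c≈0 p = trans (*-identityˡ _) (power-any κ (trans (*-congʳ c≈0) (zeroˡ _)) p)

    -- By `fermat` the carry out is worth c, as much as the carry fed in, so for c ≠ 0 the factor c
    -- cancels. At c = 0 both sides vanish, because a reduced exponent after overflow is not 0.
    digits-reduce : ∀ (ds : Vec Digit t) c → digitsPower ds c ≈ power (reduce ds) c
    digits-reduce ds c with proj₂ (add ds false) in eq | add-power ds false c | add-power ds true c
    ... | false | p | _ = trans (sym (*-identityʳ _)) (trans p (*-identityʳ _))
    ... | true  | p | p′ with add-overflow ds eq
    ...   | carry , any rewrite carry with c ≈? 0#
    ...     | yes c≈0 = trans (trans (sym (*-identityʳ _)) (trans p (trans (*-congˡ (trans (fermat c) c≈0)) (zeroʳ _))))
                          (sym (power-any (proj₁ (add ds true)) c≈0 any))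
    ...     | no  c≉0 = cancel c≉0 (trans (*-comm c _) (trans p′ (trans (*-congˡ (fermat c)) (*-comm _ c))))

    module Indicator {A : Set} (as : List A) (eq : A → A → Bool)
      (select : ∀ a (f : A → Carrier) → ∑ as (λ a′ → ⟦ eq a′ a ⟧ * f a′) ≈ f a) where

      private
        eqs : ∀ {n} → Vec A n → Vec A n → Bool
        eqs = eqVec eq

      ∑-select : ∀ (w : Vec A n) (f : Vec A n → Carrier) → ∑ (wordsOver as n) (λ w′ → ⟦ eqs w′ w ⟧ * f w′) ≈ f w
      ∑-select [] f = trans (+-identityʳ _) (*-identityˡ _)
      ∑-select {suc n} (b ∷ w) f = trans (∑-words n as (λ w′ → ⟦ eqs w′ (b ∷ w) ⟧ * f w′))
        (trans (∑-cong as inner) (select b (λ a → f (a ∷ w))))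
        where
        inner : ∀ a → ∑ (wordsOver as n) (λ w′ → ⟦ eq a b ∧ eqs w′ w ⟧ * f (a ∷ w′)) ≈ ⟦ eq a b ⟧ * f (a ∷ w)
        inner a = begin
          ∑ (wordsOver as n) (λ w′ → ⟦ eq a b ∧ eqs w′ w ⟧ * f (a ∷ w′))
            ≈⟨ ∑-cong (wordsOver as n) (λ w′ → trans (*-congʳ (⟦∧⟧ (eq a b) (eqs w′ w))) (*-assoc ⟦ eq a b ⟧ ⟦ eqs w′ w ⟧ (f (a ∷ w′)))) ⟩
          ∑ (wordsOver as n) (λ w′ → ⟦ eq a b ⟧ * (⟦ eqs w′ w ⟧ * f (a ∷ w′)))
            ≈⟨ *-distribˡ-∑ ⟦ eq a b ⟧ (wordsOver as n) (λ w′ → ⟦ eqs w′ w ⟧ * f (a ∷ w′)) ⟨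
          ⟦ eq a b ⟧ * ∑ (wordsOver as n) (λ w′ → ⟦ eqs w′ w ⟧ * f (a ∷ w′))
            ≈⟨ *-congˡ (∑-select w (λ w′ → f (a ∷ w′))) ⟩
          ⟦ eq a b ⟧ * f (a ∷ w) ∎


    select-bits : ∀ a (f : Bool → Carrier) → ∑ bits (λ a′ → ⟦ eqB a′ a ⟧ * f a′) ≈ f a
    select-bits false f = solve 2 (λ a b → con 1 :* a :+ (con 0 :* b :+ con 0) := a) refl (f false) (f true)
    select-bits true  f = solve 2 (λ a b → con 0 :* a :+ (con 1 :* b :+ con 0) := b) refl (f false) (f true)

    select-letters : ∀ a (f : Letter → Carrier) → ∑ letters (λ a′ → ⟦ eqL a′ a ⟧ * f a′) ≈ f a
    select-letters a f = trans (∑-cong letters (λ a′ → reorder a′)) (go a)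
      where
      reorder : ∀ a′ → ⟦ eqL a′ a ⟧ * f a′ ≈ ⟦ eqL a′ a ⟧ * f a
      reorder a′ with eqL a′ a in eq
      ... | true  = *-congˡ (reflexive (≡.cong f (eqL-sound eq)))
      ... | false = trans (zeroˡ _) (sym (zeroˡ _))
      go : ∀ a → ∑ letters (λ a′ → ⟦ eqL a′ a ⟧ * f a) ≈ f a
      go a = trans (sym (*-distribʳ-∑ (f a) letters (λ a′ → ⟦ eqL a′ a ⟧))) (trans (*-congʳ (total a)) (*-identityˡ (f a)))
        where
        total : ∀ a → ∑ letters (λ a′ → ⟦ eqL a′ a ⟧) ≈ 1#
        total 𝟙 = solve 0 (con 1 :+ (con 0 :+ (con 0 :+ (con 0 :+ (con 0 :+ (con 0 :+ (con 0 :+ con 0)))))) := con 1) refl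
        total X = solve 0 (con 0 :+ (con 1 :+ (con 0 :+ (con 0 :+ (con 0 :+ (con 0 :+ (con 0 :+ con 0)))))) := con 1) refl
        total Y = solve 0 (con 0 :+ (con 0 :+ (con 1 :+ (con 0 :+ (con 0 :+ (con 0 :+ (con 0 :+ con 0)))))) := con 1) refl
        total Z = solve 0 (con 0 :+ (con 0 :+ (con 0 :+ (con 1 :+ (con 0 :+ (con 0 :+ (con 0 :+ con 0)))))) := con 1) refl
        total P = solve 0 (con 0 :+ (con 0 :+ (con 0 :+ (con 0 :+ (con 1 :+ (con 0 :+ (con 0 :+ con 0)))))) := con 1) refl
        total N = solve 0 (con 0 :+ (con 0 :+ (con 0 :+ (con 0 :+ (con 0 :+ (con 1 :+ (con 0 :+ con 0)))))) := con 1) refl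
        total Q = solve 0 (con 0 :+ (con 0 :+ (con 0 :+ (con 0 :+ (con 0 :+ (con 0 :+ (con 1 :+ con 0)))))) := con 1) refl

    module Exponent = Indicator bits eqB select-bits
    module Word = Indicator letters eqL select-letters

    rowValue : Vec Row t → Triple → Carrier
    rowValue x l = ∑ (words t) (λ w → ⟦ occurs x w ⟧ * wordValue w l)

    -- A compatible word has a single reduced exponent of `c`; grouping the words by it gives the
    -- coefficients `rowValue`.
    product-rows : ∀ (τ : Vec Factor t) c l → product τ c l ≈ ∑ (exponents t) (λ κ → power κ c * rowValue (zip τ κ) l)
    product-rows τ c l = begin
      product τ c l                                                     ≈⟨ product-expand τ c l ⟩
      ∑ (words t) (λ w → coefficients-word τ w c * wordValue w l)        ≈⟨ ∑-cong (words t) (λ w → trans (*-congʳ (spread w)) (*-distribʳ-∑ (wordValue w l) (exponents t) _)) ⟩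
      ∑ (words t) (λ w → ∑ (exponents t) (λ κ → ⟦ occurs (zip τ κ) w ⟧ * power κ c * wordValue w l))
        ≈⟨ ∑-swap (words t) (exponents t) _ ⟩
      ∑ (exponents t) (λ κ → ∑ (words t) (λ w → ⟦ occurs (zip τ κ) w ⟧ * power κ c * wordValue w l))
        ≈⟨ ∑-cong (exponents t) (λ κ → trans (∑-cong (words t) λ w → solve 3 (λ a b c → a :* b :* c := b :* (a :* c)) refl ⟦ occurs (zip τ κ) w ⟧ (power κ c) (wordValue w l))
             (sym (*-distribˡ-∑ (power κ c) (words t) (λ w → ⟦ occurs (zip τ κ) w ⟧ * wordValue w l)))) ⟩
      ∑ (exponents t) (λ κ → power κ c * rowValue (zip τ κ) l) ∎
      where
      spread : ∀ w → coefficients-word τ w c ≈ ∑ (exponents t) (λ κ → ⟦ occurs (zip τ κ) w ⟧ * power κ c)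
      spread w with compatible? τ w
      ... | inj₁ p = trans (coefficients-incompatible p c)
        (sym (∑-zero (exponents t) λ κ → trans (*-congʳ (reflexive (≡.cong ⟦_⟧ (occurs-incompatible p κ)))) (zeroˡ (power κ c))))
      ... | inj₂ (ds , p) = trans (coefficients-compatible p c) (trans (digits-reduce ds c)
        (sym (trans (∑-cong (exponents t) λ κ → *-congʳ (reflexive (≡.cong ⟦_⟧ (occurs-reduce p κ))))
          (Exponent.∑-select (reduce ds) (λ κ → power κ c)))))

    -- Functionals on F dual to the powers, from norm-+ and powers-independent.
    dual : Vec Bool t → Fin (2 ^ t) → Carrier
    dual κ k = copower κ (from k) + ⟦ eqV κ (zeros t) ⟧

    indicator : Carrier → Carrier
    indicator x = 1# + norm t x

    indicator-≈0 : ∀ {x} → x ≈ 0# → indicator x ≈ 1#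
    indicator-≈0 x≈0 = trans (+-congˡ (norm-≈0 x≈0)) (+-identityʳ 1#)

    indicator-≉0 : ∀ {x} → x ≉ 0# → indicator x ≈ 0#
    indicator-≉0 x≉0 = trans (+-congˡ (norm-≉0 x≉0)) 1+1≈0

    indicator-expand : ∀ x y → indicator (x + y) ≈ ∑ (exponents t) (λ κ → (copower κ y + ⟦ eqV κ (zeros t) ⟧) * power κ x)
    indicator-expand x y = sym (begin
      ∑ (exponents t) (λ κ → (copower κ y + ⟦ eqV κ (zeros t) ⟧) * power κ x)
        ≈⟨ ∑-cong (exponents t) (λ κ → trans (distribʳ (power κ x) _ _) (+-comm _ _)) ⟩
      ∑ (exponents t) (λ κ → ⟦ eqV κ (zeros t) ⟧ * power κ x + copower κ y * power κ x)
        ≈⟨ ∑-+ (exponents t) (λ κ → ⟦ eqV κ (zeros t) ⟧ * power κ x) _ ⟩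
      ∑ (exponents t) (λ κ → ⟦ eqV κ (zeros t) ⟧ * power κ x) + ∑ (exponents t) (λ κ → copower κ y * power κ x)
        ≈⟨ +-cong (trans (Exponent.∑-select (zeros t) (λ κ → power κ x)) (power-zeros t x)) (sym (norm-+ t x y)) ⟩
      indicator (x + y) ∎)

    -- Lagrange interpolation at all elements of `F`; in characteristic 2 the difference of two
    -- elements is their sum.
    sum-indicator : (g : Carrier → Carrier) → (∀ {x y} → x ≈ y → g x ≈ g y) → ∀ x →
                    sum (λ k → g (from k) * indicator (x + from k)) ≈ g x
    sum-indicator g g-cong x = begin
      sum (λ k → g (from k) * indicator (x + from k))
        ≈⟨ sum-single (λ k → g (from k) * indicator (x + from k)) (to x) other ⟩
      g (from (to x)) * indicator (x + from (to x))
        ≈⟨ *-cong (g-cong (strictlyInverseʳ x)) (indicator-≈0 (≈⇒sum-zero (sym (strictlyInverseʳ x)))) ⟩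
      g x * 1#  ≈⟨ *-identityʳ (g x) ⟩
      g x       ∎
      where
      other : ∀ k → k ≢ to x → g (from k) * indicator (x + from k) ≈ 0#
      other k k≢ = trans (*-congˡ (indicator-≉0 λ eq → k≢ (≡.trans (≡.sym (strictlyInverseˡ k)) (to-cong (sym (sum-zero⇒≈ eq))))))
        (zeroʳ _)

    -- Interpolating `power κ′` and expanding the indicators writes it as a combination of powers
    -- whose coefficients are these sums. Independence of the powers identifies them.
    dual-power : ∀ κ κ′ → sum (λ k → dual κ k * power κ′ (from k)) ≈ ⟦ eqV κ κ′ ⟧
    dual-power κ κ′ = sum-zero⇒≈ (powers-independent y vanish κ)
      where
      y : Vec Bool t → Carrier
      y κ = sum (λ k → dual κ k * power κ′ (from k)) + ⟦ eqV κ κ′ ⟧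
      vanish : ∀ x → ∑ (exponents t) (λ κ → y κ * power κ x) ≈ 0#
      vanish x = trans (∑-cong (exponents t) (λ κ → distribʳ (power κ x) _ _))
        (trans (∑-+ (exponents t) (λ κ → sum (λ k → dual κ k * power κ′ (from k)) * power κ x) _)
          (≈⇒sum-zero (trans first (sym (Exponent.∑-select κ′ (λ κ → power κ x))))))
        where
        first : ∑ (exponents t) (λ κ → sum (λ k → dual κ k * power κ′ (from k)) * power κ x) ≈ power κ′ x
        first = begin
          ∑ (exponents t) (λ κ → sum (λ k → dual κ k * power κ′ (from k)) * power κ x)
            ≈⟨ ∑-cong (exponents t) (λ κ → *-distribʳ-sum (power κ x) (λ k → dual κ k * power κ′ (from k))) ⟩
          ∑ (exponents t) (λ κ → sum (λ k → dual κ k * power κ′ (from k) * power κ x))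
            ≈⟨ ∑-sum (exponents t) (λ κ k → dual κ k * power κ′ (from k) * power κ x) ⟩
          sum (λ k → ∑ (exponents t) (λ κ → dual κ k * power κ′ (from k) * power κ x))
            ≈⟨ sum-cong-≋ (λ k → trans (∑-cong (exponents t) λ κ → solve 3 (λ a b c → a :* b :* c := b :* (a :* c)) refl (dual κ k) (power κ′ (from k)) (power κ x))
                 (trans (sym (*-distribˡ-∑ (power κ′ (from k)) (exponents t) (λ κ → dual κ k * power κ x))) (*-congˡ (sym (indicator-expand x (from k)))))) ⟩
          sum (λ k → power κ′ (from k) * indicator (x + from k))
            ≈⟨ sum-indicator (power κ′) (power-cong κ′) x ⟩
          power κ′ x ∎

    open FunctionSpan commutativeRing Triple
    open ListSpan commutativeRing Triple

    product-generated : ∀ τ c → Generated rowValue (product τ c)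
    product-generated τ c = resp (λ l → sym (product-rows τ c l))
      (generated-∑ (exponents t) (λ κ → power κ c) {λ κ → rowValue (zip τ κ)} (λ κ → generator (zip τ κ)))

    products : Vec Factor t × Carrier → Function
    products (τ , c) = product τ c

    zip-unzip : (x : Vec Row n) → x ≡ zip (Vec.map proj₁ x) (Vec.map proj₂ x)
    zip-unzip []      = ≡.refl
    zip-unzip (a ∷ x) = ≡.cong (a ∷_) (zip-unzip x)

    eqV-sym : (κ κ′ : Vec Bool n) → eqV κ κ′ ≡ eqV κ′ κ
    eqV-sym = eqVec-sym λ { false false → ≡.refl ; false true → ≡.refl ; true false → ≡.refl ; true true → ≡.refl }

    -- A row is the coefficient of one power of `c` in a product, so the dual functional recovers it
    -- from the values at all `c`.
    rowValue-generated : ∀ x → Generated products (rowValue x)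
    rowValue-generated x = ≡.subst (Generated products ∘ rowValue) (≡.sym (zip-unzip x))
      (resp value (generated-sum (dual κ) {λ k → product τ (from k)} (λ k → generator (τ , from k))))
      where
      τ = Vec.map proj₁ x
      κ = Vec.map proj₂ x
      value : ∀ l → sum (λ k → dual κ k * product τ (from k) l) ≈ rowValue (zip τ κ) l
      value l = begin
        sum (λ k → dual κ k * product τ (from k) l)
          ≈⟨ sum-cong-≋ (λ k → trans (*-congˡ (product-rows τ (from k) l)) (*-distribˡ-∑ (dual κ k) (exponents t) (λ κ′ → power κ′ (from k) * R κ′))) ⟩
        sum (λ k → ∑ (exponents t) (λ κ′ → dual κ k * (power κ′ (from k) * R κ′)))
          ≈⟨ ∑-sum (exponents t) (λ κ′ k → dual κ k * (power κ′ (from k) * R κ′)) ⟨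
        ∑ (exponents t) (λ κ′ → sum (λ k → dual κ k * (power κ′ (from k) * R κ′)))
          ≈⟨ ∑-cong (exponents t) (λ κ′ → trans (sum-cong-≋ λ k → sym (*-assoc (dual κ k) (power κ′ (from k)) (R κ′)))
               (trans (sym (*-distribʳ-sum (R κ′) (λ k → dual κ k * power κ′ (from k))))
                 (*-congʳ (trans (dual-power κ κ′) (reflexive (≡.cong ⟦_⟧ (eqV-sym κ κ′))))))) ⟩
        ∑ (exponents t) (λ κ′ → ⟦ eqV κ′ κ ⟧ * R κ′)  ≈⟨ Exponent.∑-select κ R ⟩
        R κ ∎
        where R = λ κ′ → rowValue (zip τ κ′) l

    -- The function on lines of the point (a : b : c : 1).
    pointValue : Triple → Function
    pointValue (a , b , c) l = indicator (form₁ c l + b) * indicator (form₂ c l + a)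

    square-cong : ∀ {x y} → x ≈ y → square x ≈ square y
    square-cong x≈y = *-cong x≈y x≈y

    square-form : ∀ x c z → square x + square c * square z ≈ square (x + c * z)
    square-form x c z = sym (trans (square-+ x (c * z)) (+-congˡ (solve 2 (λ c z → (c :* z) :* (c :* z) := (c :* c) :* (z :* z)) refl c z)))

    factorPower : Carrier → Carrier → Factor → Carrier
    factorPower u v one = 1#
    factorPower u v ξ   = u
    factorPower u v η   = v
    factorPower u v ξη  = u * v

    monomial : Vec Factor n → Carrier → Carrier → Carrier
    monomial []       u v = 1#
    monomial (τ ∷ τs) u v = factorPower u v τ * monomial τs (square u) (square v)

    factorPower-cong : ∀ τ {u u′ v v′} → u ≈ u′ → v ≈ v′ → factorPower u v τ ≈ factorPower u′ v′ τ
    factorPower-cong one u≈ v≈ = refl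
    factorPower-cong ξ   u≈ v≈ = u≈
    factorPower-cong η   u≈ v≈ = v≈
    factorPower-cong ξη  u≈ v≈ = *-cong u≈ v≈

    monomial-cong : ∀ (τ : Vec Factor n) {u u′ v v′} → u ≈ u′ → v ≈ v′ → monomial τ u v ≈ monomial τ u′ v′
    monomial-cong []       u≈ v≈ = refl
    monomial-cong (τ ∷ τs) u≈ v≈ = *-cong (factorPower-cong τ u≈ v≈) (monomial-cong τs (square-cong u≈) (square-cong v≈))

    -- Squaring is additive, so squaring `c` and the line squares both forms. The product therefore
    -- depends on the line only through the values of the two forms.
    product-monomial : ∀ (τ : Vec Factor n) c l → product τ c l ≈ monomial τ (form₁ c l) (form₂ c l)
    product-monomial []       c l = refl
    product-monomial (τ ∷ τs) c l@(x , y , z) = *-cong (head τ) (trans (product-monomial τs (square c) (squares l))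
      (monomial-cong τs (square-form x c z) (square-form y c x)))
      where
      head : ∀ τ → factorValue c l τ ≈ factorPower (form₁ c l) (form₂ c l) τ
      head one = refl
      head ξ   = refl
      head η   = refl
      head ξη  = refl

    -- For fixed `c` the points (a : b : c : 1) are the indicators of all pairs of values of the two
    -- forms, so every function of that pair is a combination of them.
    products-generated : ∀ (τ : Vec Factor t) c → Generated pointValue (product τ c)
    products-generated τ c = resp value
      (generated-sum (λ _ → 1#) {λ i l → sum (λ k → monomial τ (from i) (from k) * pointValue (from k , from i , c) l)} λ i →
        generated-sum (λ k → monomial τ (from i) (from k)) (λ k → generator (from k , from i , c)))
      where
      value : ∀ l → sum (λ i → 1# * sum (λ k → monomial τ (from i) (from k) * pointValue (from k , from i , c) l)) ≈ product τ c l
      value l = begin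
        sum (λ i → 1# * sum (λ k → monomial τ (from i) (from k) * (at-b i * at-a k)))
          ≈⟨ sum-cong-≋ (λ i → trans (*-identityˡ _) (trans (sum-cong-≋ λ k →
               solve 3 (λ m a b → m :* (a :* b) := (m :* b) :* a) refl (monomial τ (from i) (from k)) (at-b i) (at-a k))
               (trans (sym (*-distribʳ-sum (at-b i) (λ k → monomial τ (from i) (from k) * at-a k)))
                 (*-congʳ (sum-indicator (monomial τ (from i)) (monomial-cong τ refl) (form₂ c l)))))) ⟩
        sum (λ i → monomial τ (from i) (form₂ c l) * at-b i)
          ≈⟨ sum-indicator (λ u → monomial τ u (form₂ c l)) (λ u≈ → monomial-cong τ u≈ refl) (form₁ c l) ⟩
        monomial τ (form₁ c l) (form₂ c l)  ≈⟨ product-monomial τ c l ⟨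
        product τ c l ∎
        where
        at-b at-a : Fin (2 ^ t) → Carrier
        at-b i = indicator (form₁ c l + from i)
        at-a k = indicator (form₂ c l + from k)

    combine-power : ∀ (κ κ′ : Vec Bool n) u v → monomial (Vec.zipWith combine κ κ′) u v ≈ power κ u * power κ′ v
    combine-power []      []        u v = sym (*-identityʳ 1#)
    combine-power (a ∷ κ) (b ∷ κ′) u v = trans (*-cong (head a b) (combine-power κ κ′ (square u) (square v)))
      (solve 4 (λ a b c d → (a :* b) :* (c :* d) := (a :* c) :* (b :* d)) refl (raise u a) (raise v b) _ _)
      where
      head : ∀ a b → factorPower u v (combine a b) ≈ raise u a * raise v b
      head false false = sym (*-identityʳ 1#)
      head true  false = sym (*-identityʳ u)
      head false true  = sym (*-identityˡ v)
      head true  true  = refl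

    -- Each indicator is a combination of powers of its form, and a power of ξ times a power of η is
    -- a product of factors, read off digit by digit by `combine`.
    pointValue-generated : ∀ p → Generated products (pointValue p)
    pointValue-generated (a , b , c) =
      resp (λ l → trans (∑-cong (exponents t) λ κ → sym (*-assoc (d b κ) (power κ (form₁ c l)) (indicator (form₂ c l + a))))
               (trans (sym (*-distribʳ-∑ (indicator (form₂ c l + a)) (exponents t) (λ κ → d b κ * power κ (form₁ c l))))
                 (*-congʳ (sym (indicator-expand (form₁ c l) b)))))
        (generated-∑ (exponents t) (d b) {λ κ l → power κ (form₁ c l) * indicator (form₂ c l + a)} outer)
      where
      d : Carrier → Vec Bool t → Carrier
      d y κ = copower κ y + ⟦ eqV κ (zeros t) ⟧
      inner : ∀ κ κ′ → Generated products (λ l → power κ (form₁ c l) * power κ′ (form₂ c l))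
      inner κ κ′ = resp (λ l → trans (product-monomial (Vec.zipWith combine κ κ′) c l) (combine-power κ κ′ (form₁ c l) (form₂ c l)))
        (generator (Vec.zipWith combine κ κ′ , c))
      outer : ∀ κ → Generated products (λ l → power κ (form₁ c l) * indicator (form₂ c l + a))
      outer κ = resp (λ l → trans (∑-cong (exponents t) λ κ′ → x∙yz≈y∙xz (d a κ′) (power κ (form₁ c l)) (power κ′ (form₂ c l)))
               (trans (sym (*-distribˡ-∑ (power κ (form₁ c l)) (exponents t) (λ κ′ → d a κ′ * power κ′ (form₂ c l))))
                 (*-congˡ (sym (indicator-expand (form₂ c l) a)))))
        (generated-∑ (exponents t) (d a) {λ κ′ l → power κ (form₁ c l) * power κ′ (form₂ c l)} (inner κ))

    -- Basic rows and points span the same functions.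

    rank : ℕ
    rank = length (basicRows t)

    basicValue : Fin rank → Function
    basicValue k = rowValue (proj₂ (basicRow {t} k))

    rowValue-basic : ∀ x → Generated basicValue (rowValue x)
    rowValue-basic x with canonical x
    ... | inj₁ never = resp (λ l → sym (∑-zero (words t) λ w → trans (*-congʳ (reflexive (≡.cong ⟦_⟧ (never w)))) (zeroˡ _))) zero
    ... | inj₂ (s , y , p , same) with basicRow-surjective s y p
    ...   | k , eq = resp (λ l → ∑-cong (words t) λ w → *-congʳ (reflexive (≡.cong ⟦_⟧
              (≡.trans (≡.cong (λ b → occurs (proj₂ b) w) eq) (≡.sym (same w)))))) (generator k)

    points⊆basic : ∀ p → Generated basicValue (pointValue p)
    points⊆basic p = generated-trans rowValue-basic
      (generated-trans (λ p → product-generated (proj₁ p) (proj₂ p)) (pointValue-generated p))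

    basic⊆points : ∀ k → Generated pointValue (basicValue k)
    basic⊆points k = generated-trans (λ p → products-generated (proj₁ p) (proj₂ p)) (rowValue-generated (proj₂ (basicRow {t} k)))

    -- Linear independence of words and of basic rows.

    -- The coefficient of y^j z^k in a letter.  Only N has a second monomial, x².
    core : Letter → Bool → Bool → Carrier → Carrier
    core a j k x = ⟦ matches a j k ⟧ * raise x (hasX a) + ⟦ isN a ∧ not j ∧ not k ⟧ * (x * x)

    cores : Vec Letter n → Vec Bool n → Vec Bool n → Carrier → Carrier
    cores []      []      []      x = 1#
    cores (a ∷ w) (j ∷ κ) (k ∷ κ′) x = core a j k x * cores w κ κ′ (square x)

    private
      monomials : ∀ {n} → ℕ → Polynomial n → ℕ → Polynomial n → Polynomial n
      monomials p m q x = con p :* m :+ con q :* (x :* x)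

    letter-core : ∀ x y z a → letterValue (x , y , z) a ≈ ∑ bits (λ j → ∑ bits (λ k → core a j k x * (raise y j * raise z k)))
    letter-core x y z 𝟙 = solve 3 (λ x y z → con 1 :=
      (monomials 1 (con 1) 0 x :* (con 1 :* con 1) :+ (monomials 0 (con 1) 0 x :* (con 1 :* z) :+ con 0)) :+ ((monomials 0 (con 1) 0 x :* (y :* con 1) :+ (monomials 0 (con 1) 0 x :* (y :* z) :+ con 0)) :+ con 0)) refl x y z
    letter-core x y z X = solve 3 (λ x y z → x :=
      (monomials 1 x 0 x :* (con 1 :* con 1) :+ (monomials 0 x 0 x :* (con 1 :* z) :+ con 0)) :+ ((monomials 0 x 0 x :* (y :* con 1) :+ (monomials 0 x 0 x :* (y :* z) :+ con 0)) :+ con 0)) refl x y z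
    letter-core x y z Y = solve 3 (λ x y z → y :=
      (monomials 0 (con 1) 0 x :* (con 1 :* con 1) :+ (monomials 0 (con 1) 0 x :* (con 1 :* z) :+ con 0)) :+ ((monomials 1 (con 1) 0 x :* (y :* con 1) :+ (monomials 0 (con 1) 0 x :* (y :* z) :+ con 0)) :+ con 0)) refl x y z
    letter-core x y z Z = solve 3 (λ x y z → z :=
      (monomials 0 (con 1) 0 x :* (con 1 :* con 1) :+ (monomials 1 (con 1) 0 x :* (con 1 :* z) :+ con 0)) :+ ((monomials 0 (con 1) 0 x :* (y :* con 1) :+ (monomials 0 (con 1) 0 x :* (y :* z) :+ con 0)) :+ con 0)) refl x y z
    letter-core x y z P = solve 3 (λ x y z → x :* y :=
      (monomials 0 x 0 x :* (con 1 :* con 1) :+ (monomials 0 x 0 x :* (con 1 :* z) :+ con 0)) :+ ((monomials 1 x 0 x :* (y :* con 1) :+ (monomials 0 x 0 x :* (y :* z) :+ con 0)) :+ con 0)) refl x y z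
    letter-core x y z N = solve 3 (λ x y z → x :* x :+ y :* z :=
      (monomials 0 (con 1) 1 x :* (con 1 :* con 1) :+ (monomials 0 (con 1) 0 x :* (con 1 :* z) :+ con 0)) :+ ((monomials 0 (con 1) 0 x :* (y :* con 1) :+ (monomials 1 (con 1) 0 x :* (y :* z) :+ con 0)) :+ con 0)) refl x y z
    letter-core x y z Q = solve 3 (λ x y z → x :* z :=
      (monomials 0 x 0 x :* (con 1 :* con 1) :+ (monomials 1 x 0 x :* (con 1 :* z) :+ con 0)) :+ ((monomials 0 x 0 x :* (y :* con 1) :+ (monomials 0 x 0 x :* (y :* z) :+ con 0)) :+ con 0)) refl x y z

    word-core : ∀ (w : Vec Letter n) x y z → wordValue w (x , y , z) ≈
                ∑ (exponents n) (λ κ → ∑ (exponents n) (λ κ′ → cores w κ κ′ x * (power κ y * power κ′ z)))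
    word-core []      x y z = sym (trans (+-identityʳ _) (trans (+-identityʳ _) (trans (*-identityˡ _) (*-identityʳ _))))
    word-core {suc n} (a ∷ w) x y z = begin
      letterValue (x , y , z) a * wordValue w (square x , square y , square z)
        ≈⟨ *-cong (letter-core x y z a) (word-core w (square x) (square y) (square z)) ⟩
      ∑ bits (λ j → ∑ bits (g j)) * ∑ E (λ κ → ∑ E (h κ))
        ≈⟨ *-distribʳ-∑ _ bits (λ j → ∑ bits (g j)) ⟩
      ∑ bits (λ j → ∑ bits (g j) * ∑ E (λ κ → ∑ E (h κ)))
        ≈⟨ ∑-cong bits (λ j → trans (*-distribˡ-∑ (∑ bits (g j)) E (λ κ → ∑ E (h κ))) (∑-cong E λ κ → inner j κ)) ⟩
      ∑ bits (λ j → ∑ E (λ κ → ∑ (exponents (suc n)) (λ κ′ → f (j ∷ κ) κ′)))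
        ≈⟨ ∑-words n bits (λ κ → ∑ (exponents (suc n)) (f κ)) ⟨
      ∑ (exponents (suc n)) (λ κ → ∑ (exponents (suc n)) (f κ)) ∎
      where
      E = exponents n
      f : Vec Bool (suc n) → Vec Bool (suc n) → Carrier
      f κ κ′ = cores (a ∷ w) κ κ′ x * (power κ y * power κ′ z)
      g : Bool → Bool → Carrier
      g j k = core a j k x * (raise y j * raise z k)
      h : Vec Bool n → Vec Bool n → Carrier
      h κ κ′ = cores w κ κ′ (square x) * (power κ (square y) * power κ′ (square z))
      inner : ∀ j κ → ∑ bits (g j) * ∑ E (h κ) ≈ ∑ (exponents (suc n)) (f (j ∷ κ))
      inner j κ = trans (*-distribʳ-∑ (∑ E (h κ)) bits (g j))
        (trans (∑-cong bits λ k → trans (*-distribˡ-∑ (g j k) E (h κ)) (∑-cong E λ κ′ →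
            solve 6 (λ a b c d e f → (a :* (b :* c)) :* (d :* (e :* f)) := (a :* d) :* ((b :* e) :* (c :* f))) refl
              (core a j k x) (raise y j) (raise z k) (cores w κ κ′ (square x)) (power κ (square y)) (power κ′ (square z))))
          (sym (∑-words n bits (f (j ∷ κ)))))

    core-value : ∀ a j k x {m} → matches a j k ≡ m → (isN a ∧ not j ∧ not k) ≡ false →
                 core a j k x ≈ ⟦ m ⟧ * raise x (hasX a)
    core-value a j k x eq no-square rewrite eq | no-square = trans (+-congˡ (zeroˡ (x * x))) (+-identityʳ _)

    cores-diagonal : ∀ (w : Vec Letter n) x → cores w (Vec.map hasY w) (Vec.map hasZ w) x ≈ power (Vec.map hasX w) x
    cores-diagonal []      x = refl
    cores-diagonal (a ∷ w) x = *-cong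
      (trans (core-value a (hasY a) (hasZ a) x (sound (λ a → matches a (hasY a) (hasZ a)) ≡.refl a)
          (eqB-sound (sound (λ a → eqB (isN a ∧ not (hasY a) ∧ not (hasZ a)) false) ≡.refl a)))
        (*-identityˡ _))
      (cores-diagonal w (square x))

    -- What `w` contributes to the leading power of y and z of `w₀`: `fewer` is settled by induction
    -- on `nonN`, `absent` words contribute nothing, and the `leading` words are told apart by their
    -- power of x.
    data Outcome (w₀ w : Vec Letter n) : Set (c ⊔ ℓ) where
      fewer : nonN w < nonN w₀ → Outcome w₀ w
      absent : (∀ x → cores w (Vec.map hasY w₀) (Vec.map hasZ w₀) x ≈ 0#) → Outcome w₀ w
      leading : nonN w ≡ nonN w₀ → (∀ x → cores w (Vec.map hasY w₀) (Vec.map hasZ w₀) x ≈ power (Vec.map hasX w) x) →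
             (Vec.map hasX w ≡ Vec.map hasX w₀ → w ≡ w₀) → Outcome w₀ w

    data LetterOutcome (b a : Letter) : Set (c ⊔ ℓ) where
      fewer : isN a ≡ true → isN b ≡ false → LetterOutcome b a
      absent : (∀ x → core a (hasY b) (hasZ b) x ≈ 0#) → LetterOutcome b a
      leading : isN a ≡ isN b → (∀ x → core a (hasY b) (hasZ b) x ≈ raise x (hasX a)) →
             (hasX a ≡ hasX b → a ≡ b) → LetterOutcome b a

    letter-outcome : ∀ b a → LetterOutcome b a
    letter-outcome b a with true-or-false (isN a ∧ not (isN b)) | true-or-false (matches a (hasY b) (hasZ b))
    ... | inj₁ p | _ with ∧-true {isN a} p
    ...   | p₁ , p₂ = fewer p₁ (≡.trans (≡.sym (Bool.not-involutive (isN b))) (≡.cong not p₂))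
    letter-outcome b a | inj₂ p | m = go m
      where
      -- The x² of `N` has neither y nor z, so it could contribute only opposite a letter other than
      -- `N`, and that case is already settled as `fewer`.
      no-square : (isN a ∧ not (hasY b) ∧ not (hasZ b)) ≡ false
      no-square = ≡.trans (≡.sym (Bool.not-involutive _)) (≡.cong not (mp
        (sound (λ (a , b) → not (isN a ∧ not (isN b)) ⇒ not (isN a ∧ not (hasY b) ∧ not (hasZ b))) ≡.refl (a , b))
        (≡.cong not p)))
      core≈ : ∀ {m} → matches a (hasY b) (hasZ b) ≡ m → ∀ x → core a (hasY b) (hasZ b) x ≈ ⟦ m ⟧ * raise x (hasX a)
      core≈ eq x = core-value a (hasY b) (hasZ b) x eq no-square
      go : matches a (hasY b) (hasZ b) ≡ true ⊎ matches a (hasY b) (hasZ b) ≡ false → LetterOutcome b a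
      go (inj₂ eq) = absent λ x → trans (core≈ eq x) (zeroˡ _)
      go (inj₁ eq) = leading
        (eqB-sound (mp (sound (λ (a , b) → matches a (hasY b) (hasZ b) ⇒ eqB (isN a) (isN b)) ≡.refl (a , b)) eq))
        (λ x → trans (core≈ eq x) (*-identityˡ _))
        (λ e → eqL-sound (mp (mp (sound (λ (a , b) → matches a (hasY b) (hasZ b) ⇒ eqB (hasX a) (hasX b) ⇒ eqL a b) ≡.refl (a , b)) eq)
          (≡.subst (λ h → eqB (hasX a) h ≡ true) e (eqB-refl (hasX a)))))

    outcome : (w₀ w : Vec Letter n) → Outcome w₀ w
    outcome [] [] = leading ≡.refl (λ _ → refl) (λ _ → ≡.refl)
    outcome (b ∷ w₀) (a ∷ w) with letter-outcome b a | outcome w₀ w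
    ... | absent d     | _          = absent λ x → trans (*-congʳ (d x)) (zeroˡ _)
    ... | _          | absent d     = absent λ x → trans (*-congˡ (d (square x))) (zeroʳ _)
    ... | fewer p q   | fewer lt    = fewer (nonN-head {a = a} {b} {w} {w₀} p q (ℕ.<⇒≤ lt))
    ... | fewer p q   | leading e _ _ = fewer (nonN-head {a = a} {b} {w} {w₀} p q (ℕ.≤-reflexive e))
    ... | leading i _ _ | fewer lt    = fewer (≡.subst (λ i → (if isN a then 0 else 1) ℕ.+ nonN w < (if i then 0 else 1) ℕ.+ nonN w₀) i
                                      (ℕ.+-monoʳ-< (if isN a then 0 else 1) lt))
    ... | leading i f g | leading e f′ g′ = leading (≡.cong₂ (λ i m → (if i then 0 else 1) ℕ.+ m) i e)
      (λ x → *-cong (f x) (f′ (square x)))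
      (λ eq → ≡.cong₂ _∷_ (g (Vec.∷-injectiveˡ eq)) (g′ (Vec.∷-injectiveʳ eq)))

    module WordsIndependent (y : Vec Letter t → Carrier)
      (vanish : ∀ l → ∑ (words t) (λ w → y w * wordValue w l) ≈ 0#) where

      E = exponents t

      -- Independence of the powers is applied once in z and once in y. The coefficient stays a
      -- function of x, since x² from `N` takes the exponents of x beyond the digits 0 and 1.
      coefficient-zero : ∀ κ κ′ x → ∑ (words t) (λ w → y w * cores w κ κ′ x) ≈ 0#
      coefficient-zero κ κ′ x = powers-independent (u κ) (λ z →
          powers-independent (λ κ → ∑ E (λ κ′ → u κ κ′ * power κ′ z)) (λ y′ → trans (rearrange y′ z) (vanish (x , y′ , z))) κ) κ′
        where
        u : Vec Bool t → Vec Bool t → Carrier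
        u κ κ′ = ∑ (words t) (λ w → y w * cores w κ κ′ x)
        rearrange : ∀ y′ z → ∑ E (λ κ → ∑ E (λ κ′ → u κ κ′ * power κ′ z) * power κ y′) ≈
                             ∑ (words t) (λ w → y w * wordValue w (x , y′ , z))
        rearrange y′ z = begin
          ∑ E (λ κ → ∑ E (λ κ′ → u κ κ′ * power κ′ z) * power κ y′)
            ≈⟨ ∑-cong E (λ κ → trans (*-distribʳ-∑ (power κ y′) E (λ κ′ → u κ κ′ * power κ′ z)) (∑-cong E λ κ′ → term κ κ′)) ⟩
          ∑ E (λ κ → ∑ E (λ κ′ → ∑ (words t) (λ w → y w * g w κ κ′)))
            ≈⟨ ∑-cong E (λ κ → ∑-swap E (words t) (λ κ′ w → y w * g w κ κ′)) ⟩
          ∑ E (λ κ → ∑ (words t) (λ w → ∑ E (λ κ′ → y w * g w κ κ′)))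
            ≈⟨ ∑-swap E (words t) (λ κ w → ∑ E (λ κ′ → y w * g w κ κ′)) ⟩
          ∑ (words t) (λ w → ∑ E (λ κ → ∑ E (λ κ′ → y w * g w κ κ′)))
            ≈⟨ ∑-cong (words t) (λ w → trans (∑-cong E λ κ → sym (*-distribˡ-∑ (y w) E (g w κ)))
                 (trans (sym (*-distribˡ-∑ (y w) E (λ κ → ∑ E (g w κ)))) (*-congˡ (sym (word-core w x y′ z))))) ⟩
          ∑ (words t) (λ w → y w * wordValue w (x , y′ , z)) ∎
          where
          g : Vec Letter t → Vec Bool t → Vec Bool t → Carrier
          g w κ κ′ = cores w κ κ′ x * (power κ y′ * power κ′ z)
          term : ∀ κ κ′ → u κ κ′ * power κ′ z * power κ y′ ≈ ∑ (words t) (λ w → y w * g w κ κ′)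
          term κ κ′ = trans (*-assoc (u κ κ′) (power κ′ z) (power κ y′))
            (trans (*-distribʳ-∑ (power κ′ z * power κ y′) (words t) (λ w → y w * cores w κ κ′ x))
              (∑-cong (words t) λ w → solve 4 (λ a b c d → (a :* b) :* (c :* d) := a :* (b :* (d :* c))) refl
                (y w) (cores w κ κ′ x) (power κ′ z) (power κ y′)))

      -- The functional dual to the x-exponent of `w₀` leaves only `w₀`, apart from words of smaller
      -- measure, whose coefficients vanish by induction.
      zero-words : ∀ w → Acc _<_ (nonN w) → y w ≈ 0#
      zero-words w₀ (acc rs) = begin
        y w₀                                         ≈⟨ Word.∑-select w₀ y ⟨
        ∑ (words t) (λ w → ⟦ eqW w w₀ ⟧ * y w)       ≈⟨ ∑-cong (words t) term ⟨
        ∑ (words t) (λ w → sum (λ k → dual ι k * (y w * C w (from k))))  ≈⟨ ∑-sum (words t) (λ w k → dual ι k * (y w * C w (from k))) ⟩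
        sum (λ k → ∑ (words t) (λ w → dual ι k * (y w * C w (from k))))
          ≈⟨ sum-zero (λ k → trans (sym (*-distribˡ-∑ (dual ι k) (words t) (λ w → y w * C w (from k))))
               (trans (*-congˡ (coefficient-zero _ _ (from k))) (zeroʳ _))) ⟩
        0# ∎
        where
        ι = Vec.map hasX w₀
        C : Vec Letter t → Carrier → Carrier
        C w = cores w (Vec.map hasY w₀) (Vec.map hasZ w₀)
        term : ∀ w → sum (λ k → dual ι k * (y w * C w (from k))) ≈ ⟦ eqW w w₀ ⟧ * y w
        extract : ∀ w → (∀ x → C w x ≈ power (Vec.map hasX w) x) →
                  sum (λ k → dual ι k * (y w * C w (from k))) ≈ ⟦ eqV ι (Vec.map hasX w) ⟧ * y w
        extract w f = trans (sum-cong-≋ {y = λ k → dual ι k * power (Vec.map hasX w) (from k) * y w} λ k →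
            trans (*-congˡ (*-congˡ (f (from k)))) (solve 3 (λ a b c → a :* (b :* c) := (a :* c) :* b) refl (dual ι k) (y w) (power (Vec.map hasX w) (from k))))
          (trans (sym (*-distribʳ-sum (y w) (λ k → dual ι k * power (Vec.map hasX w) (from k)))) (*-congʳ (dual-power ι (Vec.map hasX w))))
        vanishes : ∀ w → (∀ k → y w * C w (from k) ≈ 0#) → sum (λ k → dual ι k * (y w * C w (from k))) ≈ 0# * y w
        vanishes w f = trans (sum-zero λ k → trans (*-congˡ (f k)) (zeroʳ (dual ι k))) (sym (zeroˡ (y w)))
        term w with eqW w w₀ in eq
        ... | true with ≡.refl ← eqW-sound w w₀ eq =
          trans (extract w (cores-diagonal w)) (*-congʳ (reflexive (≡.cong ⟦_⟧ (eqVec-refl eqB-refl ι))))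
        ... | false with outcome w₀ w
        ...   | fewer lt = vanishes w λ k → trans (*-congʳ (zero-words w (rs lt))) (zeroˡ _)
        ...   | absent d  = vanishes w λ k → trans (*-congˡ (d (from k))) (zeroʳ (y w))
        ...   | leading e f g with eqV ι (Vec.map hasX w) in eqι
        ...     | false = trans (extract w f) (*-congʳ (reflexive (≡.cong ⟦_⟧ eqι)))
        ...     | true  = contradiction (≡.trans (≡.sym eq) (≡.trans (≡.cong (λ v → eqW v w₀) (g (≡.sym (eqV-sound ι (Vec.map hasX w) eqι)))) (eqW-refl w₀))) λ ()

    words-independent : (y : Vec Letter t → Carrier) → (∀ l → ∑ (words t) (λ w → y w * wordValue w l) ≈ 0#) → ∀ w → y w ≈ 0#
    words-independent y vanish w = WordsIndependent.zero-words y vanish w (<-wellFounded (nonN w))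

    -- By independence of the words, the coefficients of the rows containing a given word sum to
    -- zero. At the pivot word of row `k` every other row involved has smaller size by `triangular`,
    -- so induction leaves only `y k`.
    basic-independent : Independent basicValue
    basic-independent y vanish k = go k (<-wellFounded (measure k))
      where
      row : Fin rank → Vec Row t
      row k = proj₂ (basicRow {t} k)
      measure : Fin rank → ℕ
      measure k = size (proj₁ (basicRow {t} k)) (row k)
      u : Vec Letter t → Carrier
      u w = sum (λ k → y k * ⟦ occurs (row k) w ⟧)
      u-zero : ∀ w → u w ≈ 0#
      u-zero = words-independent u λ l → trans (∑-cong (words t) (λ w → *-distribʳ-sum (wordValue w l) (λ k → y k * ⟦ occurs (row k) w ⟧)))
        (trans (∑-sum (words t) (λ w k → y k * ⟦ occurs (row k) w ⟧ * wordValue w l))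
          (trans (sum-cong-≋ λ k → trans (∑-cong (words t) λ w → *-assoc (y k) ⟦ occurs (row k) w ⟧ (wordValue w l))
              (sym (*-distribˡ-∑ (y k) (words t) (λ w → ⟦ occurs (row k) w ⟧ * wordValue w l))))
            (vanish l)))
      go : ∀ k → Acc _<_ (measure k) → y k ≈ 0#
      go k (acc rs) = begin
        y k                                 ≈⟨ *-identityʳ (y k) ⟨
        y k * 1#                            ≈⟨ *-congˡ (reflexive (≡.cong ⟦_⟧ (Closed.occurs-pivot {s = s} {x = row k} (basic-path s (row k) (basicRow-basic {t} k))))) ⟨
        y k * ⟦ occurs (row k) w ⟧          ≈⟨ sum-single (λ i → y i * ⟦ occurs (row i) w ⟧) k other ⟨
        u w                                 ≈⟨ u-zero w ⟩
        0#                                  ∎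
        where
        s = proj₁ (basicRow {t} k)
        w = pivot s (row k)
        other : ∀ i → i ≢ k → y i * ⟦ occurs (row i) w ⟧ ≈ 0#
        other i i≢k with occurs (row i) w in o
        ... | false = zeroʳ (y i)
        ... | true  = trans (*-congʳ (go i (rs (triangular s (row k) (proj₁ (basicRow {t} i)) (row i)
                (basicRow-basic {t} k) (basicRow-basic {t} i) o λ eq → i≢k (basicRow-injective {t} i k eq))))) (zeroˡ 1#)

-- Coordinates of points, lines and incidence.

module Coordinates where

  open FieldPowers
  open LineFunctions
  open import Algebra.Bundles using (CommutativeMonoid)
  open import Algebra.Module.Morphism.Structures using (module IsLeftModuleHomomorphism)
  open import Data.Fin.Patterns using (0F; 1F; 2F; 3F)
  open import Data.Nat.Base using (_^_)
  open import Data.Vec.Functional using (Vector; []; _∷_)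

  private variable n : ℕ

  module Quadrangle {c ℓ m ℓm} {t : ℕ} (1≤t : 1 ≤ t) {F : FiniteField c ℓ (2 ^ t)} {S : SymplecticSpace F m ℓm}
    (B : SymplecticBasis F S) where

    open FiniteField F hiding (zero)
    open FiniteFieldProperties 1≤t F using (1+1≈0; x+x≈0; sum-zero⇒≈; ≈⇒sum-zero; cancel-zero)
    open WordFunctions 1≤t F using (Triple; _≈³_; [_,_,_]; ⟦_⟧; pointValue; indicator-≈0; indicator-≉0)
    open SymplecticSpace S
    open SymplecticBasis B
    open SymplecticQuadrangle B
    open import Relation.Binary.Reasoning.Setoid setoid
    open import Algebra.Solver.Ring.NaturalCoefficients.Default commutativeSemiring using (solve; _:=_; _:+_; _:*_; con)
    import Algebra.Properties.CommutativeSemigroup (CommutativeMonoid.commutativeSemigroup +ᴹ-commutativeMonoid) as +ᴹ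

    combination-+ : ∀ (x y : Vector Carrier n) v →
                    linearCombination x v +ᴹ linearCombination y v ≈ᴹ linearCombination (λ k → x k + y k) v
    combination-+ {zero}  x y v = +ᴹ-identityˡ 0ᴹ
    combination-+ {suc n} x y v = ≈ᴹ-trans (+ᴹ.interchange _ _ _ _)
      (+ᴹ-cong (≈ᴹ-sym (*ₗ-distribʳ (v 0F) (x 0F) (y 0F))) (combination-+ (x ∘ suc) (y ∘ suc) (v ∘ suc)))

    combination-* : ∀ s (x : Vector Carrier n) v → s *ₗ linearCombination x v ≈ᴹ linearCombination (λ k → s * x k) v
    combination-* {zero}  s x v = *ₗ-zeroʳ s
    combination-* {suc n} s x v = ≈ᴹ-trans (*ₗ-distribˡ s _ _)
      (+ᴹ-cong (≈ᴹ-sym (*ₗ-assoc s (x 0F) (v 0F))) (combination-* s (x ∘ suc) (v ∘ suc)))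

    unit : Fin n → Vector Carrier n
    unit zero    zero    = 1#
    unit zero    (suc _) = 0#
    unit (suc k) zero    = 0#
    unit (suc k) (suc i) = unit k i

    combination-unit : ∀ (k : Fin n) v → linearCombination (unit k) v ≈ᴹ v k
    combination-unit zero    v = ≈ᴹ-trans (+ᴹ-cong (*ₗ-identityˡ (v zero)) (combination-zeroˡ (v ∘ suc) λ _ → refl)) (+ᴹ-identityʳ _)
    combination-unit (suc k) v = ≈ᴹ-trans (+ᴹ-cong (*ₗ-zeroˡ (v zero)) (combination-unit k (v ∘ suc))) (+ᴹ-identityˡ _)

    generated-combination : (v : Vector Carrierᴹ n) → ∀ {w} → Generated v w → ∃[ x ] w ≈ᴹ linearCombination x v
    generated-combination v (generator k) = unit k , ≈ᴹ-sym (combination-unit k v)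
    generated-combination v (resp u≈w p) with generated-combination v p
    ... | x , eq = x , ≈ᴹ-trans (≈ᴹ-sym u≈w) eq
    generated-combination v zero = (λ _ → 0#) , ≈ᴹ-sym (combination-zeroˡ v λ _ → refl)
    generated-combination v (add p q) with generated-combination v p | generated-combination v q
    ... | x , eq | y , eq′ = (λ k → x k + y k) , ≈ᴹ-trans (+ᴹ-cong eq eq′) (combination-+ x y v)
    generated-combination v (scale s p) with generated-combination v p
    ... | x , eq = (λ k → s * x k) , ≈ᴹ-trans (*ₗ-cong refl eq) (combination-* s x v)

    span-⊆ : ∀ {s i} {I : Set i} {f : I → Carrierᴹ} (W : Subspace s) → (∀ k → f k ∈ W) → span f ⊆ W
    span-⊆ W f∈W (generator k) = f∈W k
    span-⊆ W f∈W (resp u≈w p)  = Subspace.resp W u≈w (span-⊆ W f∈W p)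
    span-⊆ W f∈W zero          = Subspace.0-closed W
    span-⊆ W f∈W (add p q)     = Subspace.+-closed W (span-⊆ W f∈W p) (span-⊆ W f∈W q)
    span-⊆ W f∈W (scale s p)   = Subspace.*ₗ-closed W s (span-⊆ W f∈W p)

    v+v≈0 : ∀ v → v +ᴹ v ≈ᴹ 0ᴹ
    v+v≈0 v = ≈ᴹ-trans (+ᴹ-cong (≈ᴹ-sym (*ₗ-identityˡ v)) (≈ᴹ-sym (*ₗ-identityˡ v)))
      (≈ᴹ-trans (≈ᴹ-sym (*ₗ-distribʳ v 1# 1#)) (≈ᴹ-trans (*ₗ-cong 1+1≈0 ≈ᴹ-refl) (*ₗ-zeroˡ v)))

    coord : Carrierᴹ → Vector Carrier 4
    coord v = proj₁ (IsBasis.spanning isBasis v)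

    coord-spec : ∀ v → v ≈ᴹ linearCombination (coord v) e
    coord-spec v = proj₂ (IsBasis.spanning isBasis v)

    coord-unique : ∀ {v x} → v ≈ᴹ linearCombination x e → ∀ k → coord v k ≈ x k
    coord-unique {v} {x} eq k = sum-zero⇒≈ (IsBasis.independent isBasis (λ k → coord v k + x k)
      (≈ᴹ-trans (≈ᴹ-sym (combination-+ (coord v) x e))
        (≈ᴹ-trans (+ᴹ-cong (≈ᴹ-sym (coord-spec v)) (≈ᴹ-sym eq)) (v+v≈0 v))) k)

    coord-cong : ∀ {v w} → v ≈ᴹ w → ∀ k → coord v k ≈ coord w k
    coord-cong {v} {w} v≈w = coord-unique (≈ᴹ-trans v≈w (coord-spec w))

    coord-+ : ∀ v w k → coord (v +ᴹ w) k ≈ coord v k + coord w k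
    coord-+ v w = coord-unique (≈ᴹ-trans (+ᴹ-cong (coord-spec v) (coord-spec w)) (combination-+ (coord v) (coord w) e))

    coord-* : ∀ s v k → coord (s *ₗ v) k ≈ s * coord v k
    coord-* s v = coord-unique (≈ᴹ-trans (*ₗ-cong refl (coord-spec v)) (combination-* s (coord v) e))

    coord-0 : ∀ k → coord 0ᴹ k ≈ 0#
    coord-0 = coord-unique (≈ᴹ-sym (combination-zeroˡ e λ _ → refl))

    coord-e : ∀ i k → coord (e i) k ≈ unit i k
    coord-e i = coord-unique (≈ᴹ-sym (combination-unit i e))

    coord-injective : ∀ {v w} → (∀ k → coord v k ≈ coord w k) → v ≈ᴹ w
    coord-injective {v} {w} eq = ≈ᴹ-trans (coord-spec v) (≈ᴹ-trans (combination-congˡ e eq) (≈ᴹ-sym (coord-spec w)))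

    coord-zero : ∀ {v} → (∀ k → coord v k ≈ 0#) → v ≈ᴹ 0ᴹ
    coord-zero eq = coord-injective λ k → trans (eq k) (sym (coord-0 k))

    vector : Carrier → Carrier → Carrier → Carrier → Carrierᴹ
    vector x₀ x₁ x₂ x₃ = linearCombination (x₀ ∷ x₁ ∷ x₂ ∷ x₃ ∷ []) e

    coord-vector : ∀ x₀ x₁ x₂ x₃ k → coord (vector x₀ x₁ x₂ x₃) k ≈ (x₀ ∷ x₁ ∷ x₂ ∷ x₃ ∷ []) k
    coord-vector x₀ x₁ x₂ x₃ = coord-unique ≈ᴹ-refl

    all₄ : {x y : Vector Carrier 4} → x 0F ≈ y 0F → x 1F ≈ y 1F → x 2F ≈ y 2F → x 3F ≈ y 3F → ∀ k → x k ≈ y k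
    all₄ p₀ p₁ p₂ p₃ 0F = p₀
    all₄ p₀ p₁ p₂ p₃ 1F = p₁
    all₄ p₀ p₁ p₂ p₃ 2F = p₂
    all₄ p₀ p₁ p₂ p₃ 3F = p₃

    module Formˡ w = IsLeftModuleHomomorphism (linearˡ w)
    module Formʳ v = IsLeftModuleHomomorphism (linearʳ v)

    form-cong : ∀ {v v′ w w′} → v ≈ᴹ v′ → w ≈ᴹ w′ → form v w ≈ form v′ w′
    form-cong {v} {v′} {w} v≈ w≈ = trans (Formˡ.⟦⟧-cong w v≈) (Formʳ.⟦⟧-cong v′ w≈)

    -- An alternating form is antisymmetric, and signs vanish in characteristic 2.
    form-sym : ∀ v w → form v w ≈ form w v
    form-sym v w = sum-zero⇒≈ (begin
      form v w + form w v                                    ≈⟨ +-cong (+-identityˡ _) (+-identityʳ _) ⟨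
      (0# + form v w) + (form w v + 0#)                      ≈⟨ +-cong (+-congʳ (alternating v)) (+-congˡ (alternating w)) ⟨
      (form v v + form v w) + (form w v + form w w)          ≈⟨ +-cong (Formʳ.+ᴹ-homo v v w) (Formʳ.+ᴹ-homo w v w) ⟨
      form v (v +ᴹ w) + form w (v +ᴹ w)                      ≈⟨ Formˡ.+ᴹ-homo (v +ᴹ w) v w ⟨
      form (v +ᴹ w) (v +ᴹ w)                                 ≈⟨ alternating (v +ᴹ w) ⟩
      0#                                                     ∎)

    form-vector : ∀ (x : Vector Carrier 4) w → form (linearCombination x e) w ≈
                  x 0F * form (e 0F) w + (x 1F * form (e 1F) w + (x 2F * form (e 2F) w + (x 3F * form (e 3F) w + 0#)))
    form-vector x w = step (step (step (step (Formˡ.0ᴹ-homo w))))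
      where
      step : ∀ {s v u r} → form u w ≈ r → form (s *ₗ v +ᴹ u) w ≈ s * form v w + r
      step {s} {v} {u} eq = trans (Formˡ.+ᴹ-homo w (s *ₗ v) u) (+-cong (Formˡ.*ₗ-homo w s v) eq)

    form-e : ∀ w → (form w (e 0F) ≈ coord w 3F) × (form w (e 1F) ≈ coord w 2F) ×
                   (form w (e 2F) ≈ coord w 1F) × (form w (e 3F) ≈ coord w 0F)
    form-e w =
      column (alternating _) (flip e₀e₁) (flip e₀e₂) (flip e₀e₃) (solve 4 (λ a b c d → a :* con 0 :+ (b :* con 0 :+ (c :* con 0 :+ (d :* con 1 :+ con 0))) := d) refl (x 0F) (x 1F) (x 2F) (x 3F)) ,
      column e₀e₁ (alternating _) (flip e₁e₂) (flip e₁e₃) (solve 4 (λ a b c d → a :* con 0 :+ (b :* con 0 :+ (c :* con 1 :+ (d :* con 0 :+ con 0))) := c) refl (x 0F) (x 1F) (x 2F) (x 3F)) ,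
      column e₀e₂ e₁e₂ (alternating _) (flip e₂e₃) (solve 4 (λ a b c d → a :* con 0 :+ (b :* con 1 :+ (c :* con 0 :+ (d :* con 0 :+ con 0))) := b) refl (x 0F) (x 1F) (x 2F) (x 3F)) ,
      column e₀e₃ e₁e₃ e₂e₃ (alternating _) (solve 4 (λ a b c d → a :* con 1 :+ (b :* con 0 :+ (c :* con 0 :+ (d :* con 0 :+ con 0))) := a) refl (x 0F) (x 1F) (x 2F) (x 3F))
      where
      x = coord w
      flip : ∀ {v w r} → form v w ≈ r → form w v ≈ r
      flip {v} {w} eq = trans (form-sym w v) eq
      column : ∀ {v r₀ r₁ r₂ r₃ r} → form (e 0F) v ≈ r₀ → form (e 1F) v ≈ r₁ → form (e 2F) v ≈ r₂ → form (e 3F) v ≈ r₃ →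
               x 0F * r₀ + (x 1F * r₁ + (x 2F * r₂ + (x 3F * r₃ + 0#))) ≈ r → form w v ≈ r
      column {v} p₀ p₁ p₂ p₃ eq = trans (form-cong (coord-spec w) ≈ᴹ-refl) (trans (form-vector x v)
        (trans (+-cong (*-congˡ p₀) (+-cong (*-congˡ p₁) (+-cong (*-congˡ p₂) (+-congʳ (*-congˡ p₃))))) eq))

    pairing : Vector Carrier 4 → Vector Carrier 4 → Carrier
    pairing x y = y 0F * x 3F + (y 1F * x 2F + (y 2F * x 1F + (y 3F * x 0F + 0#)))

    form-pairing : ∀ v w → form v w ≈ pairing (coord v) (coord w)
    form-pairing v w = trans (form-sym v w) (trans (form-cong (coord-spec w) ≈ᴹ-refl) (trans (form-vector (coord w) v)
      (+-cong (*-congˡ (flip (proj₁ f))) (+-cong (*-congˡ (flip (proj₁ (proj₂ f)))) (+-cong (*-congˡ (flip (proj₁ (proj₂ (proj₂ f)))))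
        (+-congʳ (*-congˡ (flip (proj₂ (proj₂ (proj₂ f)))))))))))
      where
      f = form-e v
      flip : ∀ {v w r} → form v w ≈ r → form w v ≈ r
      flip {v} {w} eq = trans (form-sym w v) eq

    nonzero-coord : ∀ {v} → ¬ v ≈ᴹ 0ᴹ → ∃[ k ] coord v k ≉ 0#
    nonzero-coord {v} v≉0 = Fin.¬∀⟶∃¬ 4 _ (λ k → coord v k ≈? 0#) (v≉0 ∘ coord-zero)

    combination₂ : ∀ x (v : Vector Carrierᴹ 2) k → coord (linearCombination x v) k ≈ x 0F * coord (v 0F) k + x 1F * coord (v 1F) k
    combination₂ x v k = trans (coord-+ _ _ k) (+-cong (coord-* _ _ k) (trans (coord-+ _ _ k)
      (trans (+-cong (coord-* _ _ k) (coord-0 k)) (+-identityʳ _))))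

    combination₁ : ∀ x (v : Vector Carrierᴹ 1) k → coord (linearCombination x v) k ≈ x 0F * coord (v 0F) k
    combination₁ x v k = trans (coord-+ _ _ k) (trans (+-cong (coord-* _ _ k) (coord-0 k)) (+-identityʳ _))

    point : ∀ v → ¬ v ≈ᴹ 0ᴹ → Point
    point v v≉0 = record { subspace = span (v ∷ []) ; dimension = (v ∷ []) , record
      { contained   = generator
      ; independent = λ { x eq 0F → independent x eq }
      ; spanning    = generated-combination (v ∷ []) } }
      where
      independent : ∀ x → linearCombination x (v ∷ []) ≈ᴹ 0ᴹ → x 0F ≈ 0#
      independent x eq with nonzero-coord v≉0
      ... | k , vk≉0 = cancel-zero vk≉0 (trans (*-comm _ _)
        (trans (sym (combination₁ x (v ∷ []) k)) (trans (coord-cong eq k) (coord-0 k))))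

    line : ∀ v w → form v w ≈ 0# → (∀ s r → (∀ k → s * coord v k + r * coord w k ≈ 0#) → s ≈ 0# × r ≈ 0#) → Line
    line v w vw≈0 ind = record { subspace = span vs ; dimension = vs , record
        { contained   = generator
        ; independent = independent
        ; spanning    = generated-combination vs }
      ; isotropic = isotropic }
      where
      vs : Vector Carrierᴹ 2
      vs = v ∷ w ∷ []
      independent : LinearlyIndependent vs
      independent x eq k with ind (x 0F) (x 1F) (λ k → trans (sym (combination₂ x vs k)) (trans (coord-cong eq k) (coord-0 k)))
      independent x eq 0F | p , q = p
      independent x eq 1F | p , q = q
      expandʳ : ∀ u (y : Vector Carrier 2) → form u v ≈ 0# → form u w ≈ 0# → form u (linearCombination y vs) ≈ 0#
      expandʳ u y p q = trans (Formʳ.+ᴹ-homo u _ _) (trans (+-cong (trans (Formʳ.*ₗ-homo u _ _) (trans (*-congˡ p) (zeroʳ _)))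
        (trans (Formʳ.+ᴹ-homo u _ _) (trans (+-cong (trans (Formʳ.*ₗ-homo u _ _) (trans (*-congˡ q) (zeroʳ _))) (Formʳ.0ᴹ-homo u)) (+-identityʳ 0#))))
        (+-identityʳ 0#))
      isotropic : IsTotallyIsotropic (span vs)
      isotropic {a} {b} a∈ b∈ with generated-combination vs a∈ | generated-combination vs b∈
      ... | x , a≈ | y , b≈ = trans (form-cong a≈ b≈) (expandʳ _ y
        (trans (form-sym _ _) (expandʳ v x (alternating v) vw≈0))
        (trans (form-sym _ _) (expandʳ w x (trans (form-sym w v) vw≈0) (alternating w))))

    span₂-∈ : ∀ {s} (W : Subspace s) {v w} → v ∈ W → w ∈ W → ∀ x y → x *ₗ v +ᴹ y *ₗ w ∈ W
    span₂-∈ W v∈ w∈ x y = Subspace.+-closed W (Subspace.*ₗ-closed W x v∈) (Subspace.*ₗ-closed W y w∈)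

    coord₂ : ∀ x y v w k → coord (x *ₗ v +ᴹ y *ₗ w) k ≈ x * coord v k + y * coord w k
    coord₂ x y v w k = trans (coord-+ _ _ k) (+-cong (coord-* x v k) (coord-* y w k))

    ∈-pair : ∀ {u} {v w : Carrierᴹ} x y → (∀ k → coord u k ≈ x * coord v k + y * coord w k) → u ∈ span (v ∷ w ∷ [])
    ∈-pair x y eq = resp (coord-injective λ k → trans (coord₂ x y _ _ k) (sym (eq k)))
      (add (scale x (generator 0F)) (scale y (generator 1F)))

    0-1 : ∀ {x y} → x * 0# + y * 0# ≈ 0#
    0-1 {x} {y} = trans (+-cong (zeroʳ x) (zeroʳ y)) (+-identityʳ 0#)

    -- Points off p₀^⊥: the last coordinate of a generator is its form with e₀.
    module PointCoordinates (𝕡 : P₁) where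
      private
        p = proj₁ 𝕡
        p∉p₀⊥ = proj₂ 𝕡
      open Point p renaming (subspace to W)

      generates : Carrierᴹ
      generates = proj₁ dimension 0F

      open IsBasisOf (proj₂ dimension)

      multiple : ∀ {v} → v ∈ W → ∃[ s ] v ≈ᴹ s *ₗ generates
      multiple v∈ with spanning v∈
      ... | x , eq = x 0F , ≈ᴹ-trans eq (+ᴹ-identityʳ _)

      x : Vector Carrier 4
      x = coord generates

      on-line : ∀ l → e 0F ∈ Line.subspace l → generates ∈ Line.subspace l → ⊥
      on-line l e₀∈l g∈l = p∉p₀⊥ (l , span-⊆ (Line.subspace l) (λ { 0F → e₀∈l }) ,
        λ v∈ → let s , eq = multiple v∈ in Subspace.resp (Line.subspace l) (≈ᴹ-sym eq) (Subspace.*ₗ-closed (Line.subspace l) s g∈l))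

      -- Last coordinate 0 means orthogonal to `e 0F`; the coordinate `k`, where `e 0F` vanishes and
      -- the generator does not, shows that the two are not proportional.
      join : ∀ k → x k ≉ 0# → coord (e 0F) k ≈ 0# → x 3F ≈ 0# → Line
      join k xk≉0 e≈0 x₃≈0 = line (e 0F) generates (trans (form-sym (e 0F) generates) (trans (proj₁ (form-e generates)) x₃≈0)) independent₂
        where
        independent₂ : ∀ s r → (∀ k → s * coord (e 0F) k + r * x k ≈ 0#) → s ≈ 0# × r ≈ 0#
        independent₂ s r eq = s≈0 , r≈0
          where
          r≈0 : r ≈ 0#
          r≈0 = cancel-zero xk≉0 (trans (*-comm (x k) r) (trans (sym (trans (+-congʳ (trans (*-congˡ e≈0) (zeroʳ s))) (+-identityˡ (r * x k)))) (eq k)))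
          s≈0 : s ≈ 0#
          s≈0 = trans (sym (trans (+-cong (trans (*-congˡ (coord-e 0F 0F)) (*-identityʳ s)) (trans (*-congʳ r≈0) (zeroˡ (x 0F)))) (+-identityʳ s))) (eq 0F)

      -- Otherwise the point would be on a line through `p₀`: its join with `p₀` or, if it is `p₀`
      -- itself, the line of `e 0F` and `e 1F`.
      x₃≉0 : x 3F ≉ 0#
      x₃≉0 x₃≈0 with x 1F ≈? 0# | x 2F ≈? 0#
      ... | yes x₁≈0 | yes x₂≈0 = on-line
        (line (e 0F) (e 1F) e₀e₁ λ s r eq →
          (trans (sym (trans (+-cong (trans (*-congˡ (coord-e 0F 0F)) (*-identityʳ s)) (trans (*-congˡ (coord-e 1F 0F)) (zeroʳ r))) (+-identityʳ s))) (eq 0F)) ,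
          (trans (sym (trans (+-cong (trans (*-congˡ (coord-e 0F 1F)) (zeroʳ s)) (trans (*-congˡ (coord-e 1F 1F)) (*-identityʳ r))) (+-identityˡ r))) (eq 1F)))
        (generator 0F)
        (resp (coord-injective (all₄
            (trans (coord-* _ _ 0F) (trans (*-congˡ (coord-e 0F 0F)) (*-identityʳ _)))
            (trans (coord-* _ _ 1F) (trans (*-congˡ (coord-e 0F 1F)) (trans (zeroʳ _) (sym x₁≈0))))
            (trans (coord-* _ _ 2F) (trans (*-congˡ (coord-e 0F 2F)) (trans (zeroʳ _) (sym x₂≈0))))
            (trans (coord-* _ _ 3F) (trans (*-congˡ (coord-e 0F 3F)) (trans (zeroʳ _) (sym x₃≈0))))))
          (scale (x 0F) (generator 0F)))
      ... | no x₁≉0 | _ = on-line (join 1F x₁≉0 (coord-e 0F 1F) x₃≈0) (generator 0F) (generator 1F)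
      ... | yes _ | no x₂≉0 = on-line (join 2F x₂≉0 (coord-e 0F 2F) x₃≈0) (generator 0F) (generator 1F)

      x₃⁻¹ : Carrier
      x₃⁻¹ = proj₁ (invertible (x 3F) x₃≉0)

      x₃⁻¹*x₃ : x₃⁻¹ * x 3F ≈ 1#
      x₃⁻¹*x₃ = proj₁ (proj₂ (invertible (x 3F) x₃≉0))

      u : Carrierᴹ
      u = x₃⁻¹ *ₗ generates

      u∈W : u ∈ W
      u∈W = Subspace.*ₗ-closed W x₃⁻¹ (contained 0F)

      u₃≈1 : coord u 3F ≈ 1#
      u₃≈1 = trans (coord-* x₃⁻¹ generates 3F) x₃⁻¹*x₃

      coordinates : Triple
      coordinates = coord u 0F , coord u 1F , coord u 2F

      incident : ∀ l → u ∈ Line.subspace l → p I l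
      incident l u∈l v∈ = let s , eq = multiple v∈ in
        Subspace.resp (Line.subspace l) (≈ᴹ-trans (*ₗ-cong refl g≈) (≈ᴹ-sym eq))
          (Subspace.*ₗ-closed (Line.subspace l) s (Subspace.*ₗ-closed (Line.subspace l) (x 3F) u∈l))
        where
        g≈ : x 3F *ₗ u ≈ᴹ generates
        g≈ = ≈ᴹ-trans (≈ᴹ-sym (*ₗ-assoc _ _ _)) (≈ᴹ-trans (*ₗ-cong (trans (*-comm _ _) x₃⁻¹*x₃) ≈ᴹ-refl) (*ₗ-identityˡ _))

    -- Lines disjoint from ℓ₀ project isomorphically to the last two coordinates.
    module LineCoordinates (𝕝 : L₁) where
      private
        l = proj₁ 𝕝
        disjoint = proj₂ 𝕝
      open Line l renaming (subspace to W)
      open IsBasisOf (proj₂ dimension)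

      kernel : ∀ {z} → z ∈ W → coord z 2F ≈ 0# → coord z 3F ≈ 0# → z ≈ᴹ 0ᴹ
      kernel {z} z∈W z₂≈0 z₃≈0 with 0ᴹ? z
      ... | yes z≈0 = z≈0
      ... | no  z≉0 = ⊥-elim (disjoint (point z z≉0) (span-⊆ W (λ { 0F → z∈W }) , span-⊆ ℓ₀ (λ { 0F → z∈ℓ₀ })))
        where
        z∈ℓ₀ : z ∈ ℓ₀
        z∈ℓ₀ = ∈-pair (coord z 0F) (coord z 1F) (all₄
          (sym (trans (+-cong (trans (*-congˡ (coord-e 0F 0F)) (*-identityʳ _)) (trans (*-congˡ (coord-e 1F 0F)) (zeroʳ _))) (+-identityʳ _)))
          (sym (trans (+-cong (trans (*-congˡ (coord-e 0F 1F)) (zeroʳ _)) (trans (*-congˡ (coord-e 1F 1F)) (*-identityʳ _))) (+-identityˡ _)))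
          (trans z₂≈0 (sym (trans (+-cong (*-congˡ (coord-e 0F 2F)) (*-congˡ (coord-e 1F 2F))) 0-1)))
          (trans z₃≈0 (sym (trans (+-cong (*-congˡ (coord-e 0F 3F)) (*-congˡ (coord-e 1F 3F))) 0-1))))

      determined : ∀ {z z′} → z ∈ W → z′ ∈ W → coord z 2F ≈ coord z′ 2F → coord z 3F ≈ coord z′ 3F → ∀ k → coord z k ≈ coord z′ k
      determined {z} {z′} z∈ z′∈ eq₂ eq₃ k = sum-zero⇒≈ (trans (sym (coord-+ z z′ k)) (trans (coord-cong (kernel (Subspace.+-closed W z∈ z′∈)
        (trans (coord-+ z z′ 2F) (≈⇒sum-zero eq₂)) (trans (coord-+ z z′ 3F) (≈⇒sum-zero eq₃))) k) (coord-0 k)))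

      v w : Carrierᴹ
      v = proj₁ dimension 0F
      w = proj₁ dimension 1F
      x y : Vector Carrier 4
      x = coord v
      y = coord w

      independent₂ : ∀ s r → s *ₗ v +ᴹ r *ₗ w ≈ᴹ 0ᴹ → s ≈ 0# × r ≈ 0#
      independent₂ s r eq = both 0F , both 1F
        where both = independent (s ∷ r ∷ []) (≈ᴹ-trans (+ᴹ-cong ≈ᴹ-refl (+ᴹ-identityʳ _)) eq)

      pair∈W : ∀ s r → s *ₗ v +ᴹ r *ₗ w ∈ W
      pair∈W = span₂-∈ W (contained 0F) (contained 1F)

      D : Carrier
      D = x 2F * y 3F + x 3F * y 2F

      kernel-pair : ∀ s r → s * x 2F + r * y 2F ≈ 0# → s * x 3F + r * y 3F ≈ 0# → s ≈ 0# × r ≈ 0#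
      kernel-pair s r p q = independent₂ s r (kernel (pair∈W s r) (trans (coord₂ s r v w 2F) p) (trans (coord₂ s r v w 3F) q))

      -- If the determinant vanished, its two columns would be coefficients of vectors in the kernel
      -- of the projection, so all its entries would be 0 and `v` itself would be in the kernel.
      D≉0 : D ≉ 0#
      D≉0 D≈0 = 1≉0 (proj₁ (kernel-pair 1# 0# (trivial (proj₂ first)) (trivial (proj₂ second))))
        where
        first : y 2F ≈ 0# × x 2F ≈ 0#
        first = kernel-pair (y 2F) (x 2F) (trans (+-congʳ (*-comm _ _)) (x+x≈0 _))
          (trans (trans (+-comm _ _) (+-congˡ (*-comm _ _))) D≈0)
        second : y 3F ≈ 0# × x 3F ≈ 0#
        second = kernel-pair (y 3F) (x 3F) (trans (+-congʳ (*-comm _ _)) D≈0) (trans (+-congʳ (*-comm _ _)) (x+x≈0 _))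
        trivial : ∀ {a b} → a ≈ 0# → 1# * a + 0# * b ≈ 0#
        trivial a≈0 = trans (+-cong (trans (*-identityˡ _) a≈0) (zeroˡ _)) (+-identityʳ 0#)

      D⁻¹ : Carrier
      D⁻¹ = proj₁ (invertible D D≉0)

      D⁻¹*D : D⁻¹ * D ≈ 1#
      D⁻¹*D = proj₁ (proj₂ (invertible D D≉0))

      solution : Carrier → Carrier → Carrierᴹ
      solution s r = D⁻¹ *ₗ (s *ₗ v +ᴹ r *ₗ w)

      solution-coord : ∀ s r k → coord (solution s r) k ≈ D⁻¹ * (s * x k + r * y k)
      solution-coord s r k = trans (coord-* D⁻¹ _ k) (*-congˡ (coord₂ s r v w k))

      solution∈W : ∀ s r → solution s r ∈ W
      solution∈W s r = Subspace.*ₗ-closed W D⁻¹ (pair∈W s r)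

      -- Cramer's rule without signs: the basis of the line whose last two coordinates are (1, 0)
      -- and (0, 1).
      g h : Carrierᴹ
      g = solution (y 3F) (x 3F)
      h = solution (y 2F) (x 2F)

      g₂ : coord g 2F ≈ 1#
      g₂ = trans (solution-coord _ _ 2F) (trans (*-congˡ (+-congʳ (*-comm _ _))) D⁻¹*D)
      g₃ : coord g 3F ≈ 0#
      g₃ = trans (solution-coord _ _ 3F) (trans (*-congˡ (trans (+-congʳ (*-comm _ _)) (x+x≈0 _))) (zeroʳ _))
      h₂ : coord h 2F ≈ 0#
      h₂ = trans (solution-coord _ _ 2F) (trans (*-congˡ (trans (+-congʳ (*-comm _ _)) (x+x≈0 _))) (zeroʳ _))
      h₃ : coord h 3F ≈ 1#
      h₃ = trans (solution-coord _ _ 3F) (trans (*-congˡ (trans (+-comm _ _) (+-congˡ (*-comm _ _)))) D⁻¹*D)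

      coordinates : Triple
      coordinates = coord g 0F , coord h 0F , coord g 1F

      -- Isotropy of the line ties two of its four remaining coordinates together, which leaves
      -- three parameters.
      α≈δ : coord h 1F ≈ coord g 0F
      α≈δ = sum-zero⇒≈ (begin
        coord h 1F + coord g 0F
          ≈⟨ solve 4 (λ b d a c → d :+ a := b :* con 0 :+ (d :* con 1 :+ (con 0 :* c :+ (con 1 :* a :+ con 0)))) refl (coord h 0F) (coord h 1F) (coord g 0F) (coord g 1F) ⟩
        coord h 0F * 0# + (coord h 1F * 1# + (0# * coord g 1F + (1# * coord g 0F + 0#)))
          ≈⟨ +-cong (*-congˡ g₃) (+-cong (*-congˡ g₂) (+-cong (*-congʳ h₂) (+-congʳ (*-congʳ h₃)))) ⟨
        pairing (coord g) (coord h)   ≈⟨ form-pairing g h ⟨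
        form g h                      ≈⟨ isotropic (solution∈W _ _) (solution∈W _ _) ⟩
        0# ∎)

      on-line : ∀ {u} → coord u 3F ≈ 1# → u ∈ W → ∀ k → coord u k ≈ coord u 2F * coord g k + 1# * coord h k
      on-line {u} u₃ u∈W k = trans (determined u∈W (span₂-∈ W (solution∈W _ _) (solution∈W _ _) (coord u 2F) 1#)
          (sym (trans (coord₂ _ _ g h 2F) (trans (+-cong (trans (*-congˡ g₂) (*-identityʳ _)) (trans (*-congˡ h₂) (zeroʳ _))) (+-identityʳ _))))
          (trans u₃ (sym (trans (coord₂ _ _ g h 3F) (trans (+-cong (trans (*-congˡ g₃) (zeroʳ _)) (trans (*-congˡ h₃) (*-identityʳ _))) (+-identityˡ _)))))
          k)
        (coord₂ _ _ g h k)

      off-line : ∀ {u} → coord u 3F ≈ 1# → coord u 0F ≈ coord u 2F * coord g 0F + coord h 0F →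
                 coord u 1F ≈ coord u 2F * coord g 1F + coord g 0F → u ∈ W
      off-line {u} u₃ p₀ p₁ = Subspace.resp W (coord-injective λ k → sym (trans (eq k) (sym (coord₂ _ _ g h k))))
        (span₂-∈ W (solution∈W _ _) (solution∈W _ _) (coord u 2F) 1#)
        where
        eq : ∀ k → coord u k ≈ coord u 2F * coord g k + 1# * coord h k
        eq = all₄
          (trans p₀ (+-congˡ (sym (*-identityˡ _))))
          (trans p₁ (+-congˡ (trans (sym α≈δ) (sym (*-identityˡ _)))))
          (sym (trans (+-cong (trans (*-congˡ g₂) (*-identityʳ _)) (trans (*-congˡ h₂) (zeroʳ _))) (+-identityʳ _)))
          (trans u₃ (sym (trans (+-cong (trans (*-congˡ g₃) (zeroʳ _)) (trans (*-congˡ h₃) (*-identityʳ _))) (+-identityˡ _))))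

    ⟦does⟧ : ∀ {a} {A : Set a} (d : Dec A) {x} → (A → 1# ≈ x) → (¬ A → 0# ≈ x) → ⟦ does d ⟧ ≈ x
    ⟦does⟧ (yes p) f g = f p
    ⟦does⟧ (no ¬p) f g = g ¬p

    module Incidence (p : P₁) (l : L₁) where
      module P = PointCoordinates p
      module L = LineCoordinates l

      a b c′ α β γ : Carrier
      a  = coord P.u 0F
      b  = coord P.u 1F
      c′ = coord P.u 2F
      α  = coord L.g 0F
      β  = coord L.h 0F
      γ  = coord L.g 1F

      on : proj₁ p I proj₁ l → 1# ≈ pointValue (a , b , c′) (α , β , γ)
      on pIl = sym (trans (*-cong (indicator-≈0 (≈⇒sum-zero b≈)) (indicator-≈0 (≈⇒sum-zero a≈))) (*-identityʳ 1#))
        where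
        eq : ∀ k → coord P.u k ≈ c′ * coord L.g k + 1# * coord L.h k
        eq = L.on-line P.u₃≈1 (pIl P.u∈W)
        a≈ : β + c′ * α ≈ a
        a≈ = trans (+-comm β (c′ * α)) (trans (+-congˡ (sym (*-identityˡ β))) (sym (eq 0F)))
        b≈ : α + c′ * γ ≈ b
        b≈ = trans (+-comm α (c′ * γ)) (trans (+-congˡ (trans (sym L.α≈δ) (sym (*-identityˡ (coord L.h 1F))))) (sym (eq 1F)))

      off : ¬ proj₁ p I proj₁ l → 0# ≈ pointValue (a , b , c′) (α , β , γ)
      off ¬pIl = sym (value ((α + c′ * γ + b) ≈? 0#) ((β + c′ * α + a) ≈? 0#))
        where
        value : Dec (α + c′ * γ + b ≈ 0#) → Dec (β + c′ * α + a ≈ 0#) → pointValue (a , b , c′) (α , β , γ) ≈ 0#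
        value (no ≉0) _       = trans (*-congʳ (indicator-≉0 ≉0)) (zeroˡ _)
        value (yes _) (no ≉0) = trans (*-congˡ (indicator-≉0 ≉0)) (zeroʳ _)
        value (yes q) (yes p) = contradiction (λ {v} → P.incident (proj₁ l) (L.off-line P.u₃≈1
              (trans (sym (sum-zero⇒≈ p)) (+-comm β (c′ * α))) (trans (sym (sum-zero⇒≈ q)) (+-comm α (c′ * γ)))) {v}) ¬pIl

    incidence : ∀ p l → ⟦ incidenceMatrix p l ⟧ ≈ pointValue (PointCoordinates.coordinates p) (LineCoordinates.coordinates l)
    incidence p l = ⟦does⟧ (proj₁ p I? proj₁ l) (Incidence.on p l) (Incidence.off p l)

    makePoint : Triple → P₁
    makePoint (a , b , c′) = point u u≉0 , λ (l , p₀⊆l , p⊆l) → 1≉0 (begin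
        1#              ≈⟨ coord-vector a b c′ 1# 3F ⟨
        coord u 3F      ≈⟨ proj₁ (form-e u) ⟨
        form u (e 0F)   ≈⟨ Line.isotropic l (p⊆l (generator 0F)) (p₀⊆l (generator 0F)) ⟩
        0#              ∎)
      where
      u = vector a b c′ 1#
      u≉0 : ¬ u ≈ᴹ 0ᴹ
      u≉0 u≈0 = 1≉0 (trans (sym (coord-vector a b c′ 1# 3F)) (trans (coord-cong u≈0 3F) (coord-0 3F)))

    makePoint-coordinates : ∀ p → PointCoordinates.coordinates (makePoint p) ≈³ p
    makePoint-coordinates p@(a , b , c′) = [ same 0F , same 1F , same 2F ]
      where
      open PointCoordinates (makePoint p)
      x₃⁻¹≈1 : x₃⁻¹ ≈ 1#
      x₃⁻¹≈1 = trans (sym (trans (*-congˡ (coord-vector a b c′ 1# 3F)) (*-identityʳ _))) x₃⁻¹*x₃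
      same : ∀ k → coord u k ≈ (a ∷ b ∷ c′ ∷ 1# ∷ []) k
      same k = trans (coord-* x₃⁻¹ generates k) (trans (*-congʳ x₃⁻¹≈1) (trans (*-identityˡ _) (coord-vector a b c′ 1# k)))

    -- The normal form (α γ 1 0), (β α 0 1) to which `g` and `h` bring every line; the repeated α
    -- makes it isotropic.
    module MakeLine (abc : Triple) where
      α β γ : Carrier
      α = proj₁ abc
      β = proj₁ (proj₂ abc)
      γ = proj₂ (proj₂ abc)
      g₀ h₀ : Carrierᴹ
      g₀ = vector α γ 1# 0#
      h₀ = vector β α 0# 1#
      cg : ∀ k → coord g₀ k ≈ (α ∷ γ ∷ 1# ∷ 0# ∷ []) k
      cg = coord-vector α γ 1# 0#
      ch : ∀ k → coord h₀ k ≈ (β ∷ α ∷ 0# ∷ 1# ∷ []) k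
      ch = coord-vector β α 0# 1#

      isotropic₀ : form g₀ h₀ ≈ 0#
      isotropic₀ = begin
        form g₀ h₀                    ≈⟨ form-pairing g₀ h₀ ⟩
        pairing (coord g₀) (coord h₀)
          ≈⟨ +-cong (*-cong (ch 0F) (cg 3F)) (+-cong (*-cong (ch 1F) (cg 2F)) (+-cong (*-cong (ch 2F) (cg 1F)) (+-congʳ (*-cong (ch 3F) (cg 0F))))) ⟩
        β * 0# + (α * 1# + (0# * γ + (1# * α + 0#)))
          ≈⟨ solve 3 (λ a b c → b :* con 0 :+ (a :* con 1 :+ (con 0 :* c :+ (con 1 :* a :+ con 0))) := a :+ a) refl α β γ ⟩
        α + α                         ≈⟨ x+x≈0 α ⟩
        0# ∎

      last₂ : ∀ s r → s * coord g₀ 2F + r * coord h₀ 2F ≈ s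
      last₂ s r = trans (+-cong (trans (*-congˡ (cg 2F)) (*-identityʳ s)) (trans (*-congˡ (ch 2F)) (zeroʳ r))) (+-identityʳ s)
      last₃ : ∀ s r → s * coord g₀ 3F + r * coord h₀ 3F ≈ r
      last₃ s r = trans (+-cong (trans (*-congˡ (cg 3F)) (zeroʳ s)) (trans (*-congˡ (ch 3F)) (*-identityʳ r))) (+-identityˡ r)

      theLine : Line
      theLine = line g₀ h₀ isotropic₀ λ s r eq → trans (sym (last₂ s r)) (eq 2F) , trans (sym (last₃ s r)) (eq 3F)

      disjoint : ∀ p → ¬ (p I theLine × Point.subspace p ⊆ ℓ₀)
      disjoint p (p⊆l , p⊆ℓ₀) = v≉0 v≈0
        where
        v = proj₁ (Point.dimension p) 0F
        open IsBasisOf (proj₂ (Point.dimension p))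
        v≉0 : ¬ v ≈ᴹ 0ᴹ
        v≉0 v≈0 = 1≉0 (independent (λ _ → 1#) (≈ᴹ-trans (+ᴹ-identityʳ _) (≈ᴹ-trans (*ₗ-identityˡ _) v≈0)) 0F)
        in-l = generated-combination (g₀ ∷ h₀ ∷ []) (p⊆l (contained 0F))
        in-ℓ₀ = generated-combination (e 0F ∷ e 1F ∷ []) (p⊆ℓ₀ (contained 0F))
        s r : Carrier
        s = proj₁ in-l 0F
        r = proj₁ in-l 1F
        expansion : ∀ k → coord v k ≈ s * coord g₀ k + r * coord h₀ k
        expansion k = trans (coord-cong (proj₂ in-l) k) (combination₂ (proj₁ in-l) (g₀ ∷ h₀ ∷ []) k)
        vanish : ∀ k → unit 0F k ≈ 0# → unit 1F k ≈ 0# → coord v k ≈ 0#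
        vanish k p q = trans (coord-cong (proj₂ in-ℓ₀) k) (trans (combination₂ (proj₁ in-ℓ₀) (e 0F ∷ e 1F ∷ []) k)
          (trans (+-cong (*-congˡ (trans (coord-e 0F k) p)) (*-congˡ (trans (coord-e 1F k) q))) 0-1))
        s≈0 : s ≈ 0#
        s≈0 = trans (sym (trans (expansion 2F) (last₂ s r))) (vanish 2F refl refl)
        r≈0 : r ≈ 0#
        r≈0 = trans (sym (trans (expansion 3F) (last₃ s r))) (vanish 3F refl refl)
        v≈0 : v ≈ᴹ 0ᴹ
        v≈0 = coord-zero λ k → trans (expansion k) (trans (+-cong (trans (*-congʳ s≈0) (zeroˡ _)) (trans (*-congʳ r≈0) (zeroˡ _))) (+-identityʳ 0#))

    makeLine : Triple → L₁
    makeLine l = MakeLine.theLine l , MakeLine.disjoint l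

    makeLine-coordinates : ∀ l → LineCoordinates.coordinates (makeLine l) ≈³ l
    makeLine-coordinates l@(α , β , γ) = [ g≈ 0F , h≈ 0F , g≈ 1F ]
      where
      open LineCoordinates (makeLine l)
      open MakeLine l using (cg; ch)
      g≈ : ∀ k → coord g k ≈ (α ∷ γ ∷ 1# ∷ 0# ∷ []) k
      g≈ k = trans (determined (solution∈W _ _) (generator 0F) (trans g₂ (sym (cg 2F))) (trans g₃ (sym (cg 3F))) k) (cg k)
      h≈ : ∀ k → coord h k ≈ (β ∷ α ∷ 0# ∷ 1# ∷ []) k
      h≈ k = trans (determined (solution∈W _ _) (generator 1F) (trans h₂ (sym (ch 2F))) (trans h₃ (sym (ch 3F))) k) (ch k)

-- The rank over 𝔽₂ computed over the extension field.

module RankOverExtension where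

  open LinearSpans
  open FieldPowers
  open LineFunctions
  open BasicRows using (length-basicRows)
  open RankFormula using (rankFormula-paths)
  open import Data.Fin.Patterns using (0F; 1F; 2F)
  open import Data.Nat.Base using (_^_)
  open import Data.Vec.Functional using (Vector)

  module Rank {c ℓ} {t : ℕ} (1≤t : 1 ≤ t) (F : FiniteField c ℓ (2 ^ t)) where

    open FiniteField F hiding (zero)
    open Inverse enumeration using (to; from; strictlyInverseʳ)
    open FiniteFieldProperties 1≤t F using (1+1≈0; norm-cong)
    open WordFunctions 1≤t F
    open Steinitz F using (independent-≤)
    indicator-cong : ∀ {x y} → x ≈ y → indicator x ≈ indicator y
    indicator-cong x≈y = +-congˡ (norm-cong t x≈y)

    pointValue-cong : ∀ {p p′ l l′} → p ≈³ p′ → l ≈³ l′ → pointValue p l ≈ pointValue p′ l′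
    pointValue-cong [ a≈ , b≈ , c≈ ] [ α≈ , β≈ , γ≈ ] = *-cong
      (indicator-cong (+-cong (+-cong α≈ (*-cong c≈ γ≈)) b≈))
      (indicator-cong (+-cong (+-cong β≈ (*-cong c≈ α≈)) a≈))

    ≈³-refl : ∀ {x} → x ≈³ x
    ≈³-refl = [ refl , refl , refl ]

    ≈³-sym : ∀ {x y} → x ≈³ y → y ≈³ x
    ≈³-sym [ p , q , r ] = [ sym p , sym q , sym r ]

    ≈³-trans : ∀ {x y z} → x ≈³ y → y ≈³ z → x ≈³ z
    ≈³-trans [ p , q , r ] [ p′ , q′ , r′ ] = [ trans p p′ , trans q q′ , trans r r′ ]

    ⟦⟧-injective : ∀ {a b} → ⟦ a ⟧ ≈ ⟦ b ⟧ → a ≡ b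
    ⟦⟧-injective {false} {false} _ = ≡.refl
    ⟦⟧-injective {true}  {true}  _ = ≡.refl
    ⟦⟧-injective {true}  {false} p = contradiction p 1≉0
    ⟦⟧-injective {false} {true}  p = contradiction (sym p) 1≉0

    ⟦⟧-cong : ∀ {a b} → a ≡ b → ⟦ a ⟧ ≈ ⟦ b ⟧
    ⟦⟧-cong = reflexive ∘ ≡.cong ⟦_⟧

    ⟦xor⟧ : ∀ a b → ⟦ a xor b ⟧ ≈ ⟦ a ⟧ + ⟦ b ⟧
    ⟦xor⟧ false b     = sym (+-identityˡ _)
    ⟦xor⟧ true  false = sym (+-identityʳ _)
    ⟦xor⟧ true  true  = sym 1+1≈0

    -- Points and lines are subspaces with chosen bases, so the index types need be neither finite
    -- nor free of repetitions. What is used is that entries depend on coordinates only and that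
    -- every triple is attained.
    module Matrix {p l} {Pt : Set p} {Ln : Set l} (M : Pt → Ln → Bool)
      (pointCoords : Pt → Triple) (lineCoords : Ln → Triple) (makePoint : Triple → Pt) (makeLine : Triple → Ln)
      (makePoint-coords : ∀ x → pointCoords (makePoint x) ≈³ x) (makeLine-coords : ∀ x → lineCoords (makeLine x) ≈³ x)
      (incidence : ∀ x y → ⟦ M x y ⟧ ≈ pointValue (pointCoords x) (lineCoords y)) where

      private
        𝔽₂ᶜ = Bool.xor-∧-commutativeRing
        module 𝔹 = FunctionSpan 𝔽₂ᶜ Ln
        module 𝔽 = FunctionSpan commutativeRing Triple
        module Σ𝔹 = FiniteSums 𝔽₂ᶜ
        module Σ𝔽 = FiniteSums commutativeRing

      incidence-cong : ∀ {p p′ l l′} → pointCoords p ≈³ pointCoords p′ →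
                       lineCoords l ≈³ lineCoords l′ → M p l ≡ M p′ l′
      incidence-cong {p} {p′} {l} {l′} p≈ l≈ = ⟦⟧-injective {M p l} {M p′ l′} (trans (incidence p l)
        (trans (pointValue-cong {pointCoords p} {pointCoords p′} {lineCoords l} {lineCoords l′} p≈ l≈)
          (sym (incidence p′ l′))))

      row-cong : ∀ {v} → 𝔹.Generated M v → ∀ {l l′} → lineCoords l ≈³ lineCoords l′ → v l ≡ v l′
      row-cong g {l} {l′} l≈ = 𝔹.generated-cong (λ p → incidence-cong {p} {p} {l} {l′} ≈³-refl l≈) g

      digit : Fin ((2 ^ t) ^ 3) → Fin 3 → Fin (2 ^ t)
      digit = finToFun

      triple : Fin ((2 ^ t) ^ 3) → Triple
      triple k = from (digit k 0F) , from (digit k 1F) , from (digit k 2F)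

      digits : Triple → Fin 3 → Fin (2 ^ t)
      digits (x , y , z) = λ { 0F → to x ; 1F → to y ; 2F → to z }

      index : Triple → Fin ((2 ^ t) ^ 3)
      index l = funToFin (digits l)

      triple-index : ∀ l → triple (index l) ≈³ l
      triple-index l@(x , y , z) = [ at 0F x ≡.refl , at 1F y ≡.refl , at 2F z ≡.refl ]
        where
        at : ∀ i u → digits l i ≡ to u → from (digit (index l) i) ≈ u
        at i u eq = trans (reflexive (≡.cong from (≡.trans (Fin.finToFun-funToFin (digits l) i) eq))) (strictlyInverseʳ u)

      pointAt : Fin ((2 ^ t) ^ 3) → Pt
      pointAt = makePoint ∘ triple

      lineAt : Fin ((2 ^ t) ^ 3) → Ln
      lineAt = makeLine ∘ triple

      lineAt-index : ∀ l → lineCoords (lineAt (index (lineCoords l))) ≈³ lineCoords l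
      lineAt-index l = ≈³-trans (makeLine-coords _) (triple-index (lineCoords l))

      -- A generated row depends on a line only through its coordinates, so one line for each triple
      -- suffices.
      search : ∀ {v} → 𝔹.Generated M v → (∀ l → v l ≡ false) ⊎ ∃[ l ] v l ≡ true
      search {v} g with Fin.any? (λ k → v (lineAt k) Bool.≟ true)
      ... | yes (k , eq) = inj₂ (lineAt k , eq)
      ... | no none = inj₁ λ l → ≡.trans (≡.sym (row-cong g (lineAt-index l))) (Bool.¬-not λ eq → none (index (lineCoords l) , eq))

      echelonForm : Echelon.Echelon Ln (M ∘ pointAt)
      echelonForm = Echelon.echelon Ln search (M ∘ pointAt) (𝔹.generator ∘ pointAt)

      module Dimension (E : Echelon.Echelon Ln (M ∘ pointAt)) where
        open Echelon.Echelon E public renaming (rank to dimension)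

        basis-generated : ∀ k → 𝔹.Generated M (basis k)
        basis-generated k = 𝔹.generated-trans (𝔹.generator ∘ pointAt) (contained k)

        rows-generated : ∀ p → 𝔹.Generated basis (M p)
        rows-generated p = 𝔹.resp (λ l → incidence-cong {pointAt k} {p} {l} {l} coords≈ ≈³-refl) (spanning k)
          where
          k = index (pointCoords p)
          coords≈ = ≈³-trans (makePoint-coords _) (triple-index (pointCoords p))

        hasRank : HasRank 𝔽₂ M dimension
        hasRank = basis , record
          { contained   = basis-generated
          ; independent = λ x eq k → ≡.trans (≡.sym (Σ𝔹.sum-δ x k))
              (≡.trans (Σ𝔹.sum-cong-≋ λ i → ≡.cong (x i ∧_) (≡.sym (reduced i k)))
                (≡.trans (≡.sym (𝔹.sum-eval (λ i l → x i ∧ basis i l) (column k))) (eq (column k))))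
          ; spanning    = λ g → let y , eq = 𝔹.coefficients basis (𝔹.generated-trans rows-generated g) in
              y , λ l → ≡.trans (eq l) (≡.sym (𝔹.sum-eval (λ i l → y i ∧ basis i l) l)) }

        extend : 𝔹.Function → 𝔽.Function
        extend v l = ⟦ v (makeLine l) ⟧

        extend-generated : ∀ {i i′} {I : Set i} {I′ : Set i′} {f : I → 𝔹.Function} {g : I′ → 𝔽.Function} →
          (∀ k → 𝔽.Generated g (extend (f k))) → ∀ {v} → 𝔹.Generated f v → 𝔽.Generated g (extend v)
        extend-generated G (𝔹.generator k)   = G k
        extend-generated G (𝔹.resp eq p)     = 𝔽.resp (λ l → ⟦⟧-cong (eq _)) (extend-generated G p)
        extend-generated G 𝔹.zero            = 𝔽.zero
        extend-generated G (𝔹.add {v} {w} p q) = 𝔽.resp (λ l → sym (⟦xor⟧ (v (makeLine l)) (w (makeLine l)))) (𝔽.add (extend-generated G p) (extend-generated G q))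
        extend-generated G (𝔹.scale x {v} p) = 𝔽.resp (λ l → sym (⟦∧⟧ x (v (makeLine l)))) (𝔽.scale ⟦ x ⟧ (extend-generated G p))

        extended-basis : Vector 𝔽.Function dimension
        extended-basis = extend ∘ basis

        -- At the coordinates of the pivot columns the basis is still the identity matrix, so it
        -- stays independent over `F`.
        extended-independent : 𝔽.Independent extended-basis
        extended-independent y eq k = trans (sym (Σ𝔽.sum-δ y k)) (trans (Σ𝔽.sum-cong-≋ λ i → *-congˡ (entry i)) (eq (lineCoords (column k))))
          where
          embed-δ : ∀ i → ⟦ Σ𝔹.δ i k ⟧ ≈ Σ𝔽.δ i k
          embed-δ i with i Fin.≟ k
          ... | yes _ = refl
          ... | no  _ = refl
          entry : ∀ i → Σ𝔽.δ i k ≈ extended-basis i (lineCoords (column k))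
          entry i = trans (sym (embed-δ i)) (⟦⟧-cong (≡.trans (≡.sym (reduced i k))
            (row-cong (basis-generated i) (≈³-sym (makeLine-coords (lineCoords (column k)))))))

        -- Over `F` the echelon basis and the basic rows are two independent families with the span
        -- of the point functions, so exchange in both directions gives equality.
        dimension≤rank : dimension ≤ rank
        dimension≤rank = independent-≤ extended-basis basicValue extended-independent λ k →
          extend-generated (λ p → 𝔽.resp (λ l → sym (trans (incidence p (makeLine l)) (pointValue-cong ≈³-refl (makeLine-coords l))))
            (points⊆basic (pointCoords p))) (basis-generated k)

        rank≤dimension : rank ≤ dimension
        rank≤dimension = independent-≤ basicValue extended-basis basic-independent λ k →
          𝔽.generated-trans (λ p → 𝔽.resp (λ l → trans (incidence (makePoint p) (makeLine l))
              (pointValue-cong (makePoint-coords p) (makeLine-coords l)))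
            (extend-generated 𝔽.generator (rows-generated (makePoint p)))) (basic⊆points k)

        dimension-formula : ℚ√17-Notation.fromℕ dimension ≡ rankFormula t
        dimension-formula = rankFormula-paths t dimension (≡.trans
          (≡.cong (ℕ._+ 2 ^ suc t) (ℕ.≤-antisym dimension≤rank rank≤dimension)) (length-basicRows t))

open import Data.Nat.Base using (_^_)

theorem1 : ∀ {c ℓ m ℓm} (t : ℕ) → 1 ≤ t →
    (F : FiniteField c ℓ (2 ^ t)) (S : SymplecticSpace F m ℓm) (B : SymplecticBasis F S) →
    ∃[ r ] (HasRank 𝔽₂ (SymplecticQuadrangle.incidenceMatrix B) r
    × ℚ√17-Notation.fromℕ r ≡ rankFormula t)
theorem1 t 1≤t F S B = dimension , hasRank , dimension-formula
  where
  open Coordinates.Quadrangle 1≤t B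
  open RankOverExtension.Rank.Matrix 1≤t F (SymplecticQuadrangle.incidenceMatrix B)
    PointCoordinates.coordinates LineCoordinates.coordinates
    makePoint makeLine makePoint-coordinates makeLine-coordinates incidence
  open Dimension echelonForm
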